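{- Let $q=p^r>9$ be a power of a prime $p\neq 2$ such that $r=1$ or $q\equiv 3\pmod 4$. Let $\mathcal{P}\subseteq\mathbb{F}_q'$ be an integral point set of cardinality $q$. Then $\mathcal{P}$ is isomorphic to one of the following sets: (a) the line $1\cdot\mathbb{F}_q=\{t\mid t\in\mathbb{F}_q\}$; (b) (only if $q\equiv 1\pmod 4$) the line $(1+\omega_q i)\cdot\mathbb{F}_q=\{(1+\omega_q i)t\mid t\in\mathbb{F}_q\}$; (c) (only if $q\equiv 1\pmod 4$) the set $(1\pm\omega_q i)\square_q=\{(1+\omega_q i)s\mid s\in\square_q\}\cup\{(1-\omega_q i)s\mid s\in\square_q\}$.
   Context: $\mathbb{F}_q'=\mathbb{F}_q[x]/(x^2+1)$, with $i$ the class of $x$; its elements are written uniquely $a+bi$ with $a,b\in\mathbb{F}_q$, and it is identified with $\mathbb{F}_q^2$ via $(a,b)\mapsto a+bi$. $\square_q=\{t^2\mid t\in\mathbb{F}_q\}$ (including $0$). For $q\equiv 1\pmod 4$, $\omega_q\in\mathbb{F}_q$ denotes a fixed element with $\omega_q^2=-1$. The squared distance is $d^2(a+bi,c+di)=(a-c)^2+(b-d)^2$. Two points are at integral distance if their squared distance lies in $\square_q$; $\Delta(u,v)=1$ if $u,v$ are at integral distance and $0$ otherwise. An integral point set is a set of points which are pairwise at integral distance. An automorphism of $\mathbb{F}_q'$ with respect to $\Delta$ is a bijection $\varphi$ of $\mathbb{F}_q'$ with $\Delta(\varphi(u),\varphi(v))=\Delta(u,v)$ for all $u,v$ and such that for all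 $u,w\in\mathbb{F}_q'$ there are $u',w'\in\mathbb{F}_q'$ with $\{\varphi(u+tw)\mid t\in\mathbb{F}_q\}=\{u'+tw'\mid t\in\mathbb{F}_q\}$. Two point sets are isomorphic if some such automorphism maps one onto the other. -}

module Defs where

open import Algebra.Bundles using (CommutativeRing)
open import Data.Bool.Base using (if_then_else_)
open import Data.Fin.Base using (Fin)
import Data.Fin.Properties as Fin
open import Data.List.Base using (List; length)
import Data.List.Membership.Setoid as Membership
import Data.List.Relation.Unary.Unique.Setoid as UniqueSetoid
open import Data.Nat.Base using (ℕ)
open import Data.Product.Base using (Σ-syntax; ∃-syntax; _×_; _,_)
open import Data.Product.Relation.Binary.Pointwise.NonDependent using (×-setoid)
open import Function.Bundles using (Inverse; Bijection; _⇔_)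
open import Function.Properties.Inverse using (Inverse⇒Injection)
import Function.Construct.Symmetry as Symmetry
open import Level using (Level; _⊔_; suc)
open import Relation.Binary.Bundles using (Setoid)
open import Relation.Binary.Definitions using (Decidable)
open import Relation.Binary.PropositionalEquality.Core using (_≡_)
open import Relation.Binary.PropositionalEquality.Properties using (setoid)
open import Relation.Nullary.Decidable using (does; map′; via-injection)
open import Relation.Nullary.Negation.Core using (¬_)
open import Relation.Unary as Unary using (Pred; _∈_; _≐_; _∪_; U)

record FiniteField c ℓ (q : ℕ) : Set (suc (c ⊔ ℓ)) where
  field
    commutativeRing : CommutativeRing c ℓ
  open CommutativeRing commutativeRing public renaming (setoid to ≈-setoid)
  field
    0≉1         : ¬ 0# ≈ 1#
    inverse     : ∀ x → ¬ x ≈ 0# → ∃[ y ] x * y ≈ 1#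
    enumeration : Inverse (setoid (Fin q)) ≈-setoid

module IntegralPointSets {c ℓ : Level} {q : ℕ} (F : FiniteField c ℓ q) where
  open FiniteField F

  □ : Pred Carrier (c ⊔ ℓ)
  □ x = ∃[ t ] x ≈ t * t

  _≟_ : Decidable _≈_
  _≟_ = via-injection (Inverse⇒Injection (Symmetry.inverse enumeration)) Fin._≟_

  □? : Unary.Decidable □
  □? x = map′
    (λ (k , x≈k²) → to k , x≈k²)
    (λ (t , x≈t²) → from t , trans x≈t² (sym (*-cong (strictlyInverseˡ t) (strictlyInverseˡ t))))
    (Fin.any? λ k → x ≟ (to k * to k))
    where open Inverse enumeration using (to; from; strictlyInverseˡ)

  -- The ring 𝔽_q[x]/(x² + 1), by normal forms: (a , b) stands for a + bi.
  𝔽′ : Set c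
  𝔽′ = Carrier × Carrier

  𝔽′-setoid : Setoid c ℓ
  𝔽′-setoid = ×-setoid ≈-setoid ≈-setoid

  open Setoid 𝔽′-setoid public using () renaming (_≈_ to _≈′_)

  infixl 6 _+′_
  infixl 7 _*′_

  _+′_ : 𝔽′ → 𝔽′ → 𝔽′
  (a , b) +′ (a′ , b′) = a + a′ , b + b′

  _*′_ : 𝔽′ → 𝔽′ → 𝔽′
  (a , b) *′ (a′ , b′) = a * a′ - b * b′ , a * b′ + b * a′

  ι : Carrier → 𝔽′
  ι t = t , 0#

  d² : 𝔽′ → 𝔽′ → Carrier
  d² (a , b) (a′ , b′) = (a - a′) * (a - a′) + (b - b′) * (b - b′)

  IntegralDistance : 𝔽′ → 𝔽′ → Set (c ⊔ ℓ)
  IntegralDistance u v = d² u v ∈ □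

  Δ : 𝔽′ → 𝔽′ → ℕ
  Δ u v = if does (□? (d² u v)) then 1 else 0

  IsIntegral : ∀ {m} → Pred 𝔽′ m → Set (c ⊔ ℓ ⊔ m)
  IsIntegral P = ∀ u v → u ∈ P → v ∈ P → IntegralDistance u v

  -- List membership is up to _≈′_, so this also forces P to respect _≈′_.
  HasCardinality : ∀ {m} → Pred 𝔽′ m → ℕ → Set (c ⊔ ℓ ⊔ m)
  HasCardinality P n =
    Σ[ zs ∈ List 𝔽′ ] Unique zs × length zs ≡ n × (∀ z → z ∈ P ⇔ z ∈ₗ zs)
    where
    open UniqueSetoid 𝔽′-setoid using (Unique)
    open Membership 𝔽′-setoid using () renaming (_∈_ to _∈ₗ_)

  Image : ∀ {m} → (𝔽′ → 𝔽′) → Pred 𝔽′ m → Pred 𝔽′ (c ⊔ ℓ ⊔ m)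
  Image f P z = ∃[ u ] u ∈ P × z ≈′ f u

  -- {u + t w ∣ t ∈ 𝔽_q}; the direction w is allowed to be zero.
  Line : 𝔽′ → 𝔽′ → Pred 𝔽′ (c ⊔ ℓ)
  Line u w z = ∃[ t ] z ≈′ u +′ ι t *′ w

  record Automorphism : Set (c ⊔ ℓ) where
    field
      bijection : Bijection 𝔽′-setoid 𝔽′-setoid
    open Bijection bijection public using (to)
    field
      Δ-preserving    : ∀ u v → Δ (to u) (to v) ≡ Δ u v
      line-preserving : ∀ u w → ∃[ u′ ] ∃[ w′ ] Image to (Line u w) ≐ Line u′ w′

  Isomorphic : ∀ {m n} → Pred 𝔽′ m → Pred 𝔽′ n → Set (c ⊔ ℓ ⊔ m ⊔ n)
  Isomorphic P Q = Σ[ φ ∈ Automorphism ] Image (Automorphism.to φ) P ≐ Q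

  infix 8 _·_

  _·_ : ∀ {m} → 𝔽′ → Pred Carrier m → Pred 𝔽′ (c ⊔ ℓ ⊔ m)
  (w · S) z = ∃[ s ] s ∈ S × z ≈′ w *′ ι s

  realLine : Pred 𝔽′ (c ⊔ ℓ)
  realLine = (1# , 0#) · U

  isotropicLine : Carrier → Pred 𝔽′ (c ⊔ ℓ)
  isotropicLine ω = (1# , ω) · U

  isotropicSquares : Carrier → Pred 𝔽′ (c ⊔ ℓ)
  isotropicSquares ω = (1# , ω) · □ ∪ (1# , - ω) · □

-- For q ≡ 3 mod 4 the ring 𝔽′ is a field, and Blokhuis' argument for the Paley graph of order q²
-- applies. In at least (q + 1)/2 of the directions the projection of P is the whole field, and the
-- j-th elementary symmetric function of a projection is a polynomial of degree at most j in the
-- slope; so the symmetric functions of P of degree 1 to (q - 1)/2 vanish. If 0 ∈ P, then {0} ∪ {1/x} is again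
-- integral, which gives the vanishing of the remaining ones up to degree q - 2, and x^(q-1) is constant on
-- P ∖ {0}: P is a line through 0.
--
-- For a prime q ≡ 1 mod 4, in the isotropic coordinates u = a + ωb and v = a - ωb the squared
-- distance is Δu Δv. With k = (q - 1)/2 and χ the quadratic character, the power sums
-- Σ (v - yu - t)^k are c (1 + y^k), so that for each of the k + 2 integral directions the sums
-- Σ χ(v - yu - t) do not depend on t modulo q. Inverting this transform recovers the numbers of points
-- on the lines of a direction. Counting pairs of points by direction then leaves, apart from
-- lines, c ∈ {1 , k} up to sign. The case c = 1 contradicts a second moment, and if c = k, any two lines
-- u = const and v = const through a point of P carry together more than half of P; a fullest line of
-- each of the two kinds covers P.

module Submission where

open import Defs
open import Algebra.Bundles using (CommutativeRing)
import Algebra.Properties.CommutativeMonoid.Sum as MonoidSum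
import Algebra.Properties.CommutativeSemiring.Exp as Exponentiation
import Algebra.Properties.Ring as RingProperties
import Algebra.Properties.Semiring.Sum as SemiringSum
import Algebra.Solver.Ring as RingSolver
open import Algebra.Solver.Ring.AlmostCommutativeRing using (AlmostCommutativeRing; fromCommutativeRing; _-Raw-AlmostCommutative⟶_)
open import Algebra.Structures using (IsCommutativeRing)
open import Data.Bool.Base using (if_then_else_; true; false)
open import Data.Fin.Base as Fin using (Fin)
open import Data.Fin.Permutation using (Permutation)
import Data.Fin.Properties as Finₚ
open import Data.Integer.Base as ℤ using (ℤ; -[1+_]; 0ℤ; 1ℤ; -1ℤ; +≤+)
import Data.Integer.DivMod as ℤDivMod
import Data.Integer.Properties as ℤₚ
import Data.Integer.Solver as ℤSolver
open import Data.List.Base using (List; []; _∷_; _++_; length; map; foldr; filter; allFin; take; tabulate; lookup)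
open import Data.List.Membership.Propositional using (_∈_)
import Data.List.Membership.Propositional.Properties as ∈ₚ
import Data.List.Membership.Setoid as SetoidMembership
import Data.List.Membership.Setoid.Properties as SetoidMembershipₚ
import Data.List.Properties as Listₚ
open import Data.List.Relation.Binary.Permutation.Propositional as Perm using (_↭_)
import Data.List.Relation.Binary.Permutation.Propositional.Properties as Permₚ
open import Data.List.Relation.Unary.All as All using (All; []; _∷_)
import Data.List.Relation.Unary.All.Properties as Allₚ
open import Data.List.Relation.Unary.AllPairs using (AllPairs; []; _∷_)
open import Data.List.Relation.Unary.Any as Any using (here; there)
import Data.List.Relation.Unary.Any.Properties as Anyₚ
open import Data.List.Relation.Unary.Unique.Propositional using (Unique)
import Data.List.Relation.Unary.Unique.Propositional.Properties as Uniqueₚ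
open import Data.Maybe.Base using (just; nothing)
open import Data.Nat.Base as ℕ using (ℕ; zero; suc; s≤s; z≤n)
open import Data.Nat.Coprimality using (coprime-Bézout; prime⇒coprime)
open import Data.Nat.DivMod using (m≡m%n+[m/n]*n; m%n<n; [m+kn]%n≡m%n)
open import Data.Nat.Divisibility using (divides)
open import Data.Nat.GCD using (module Bézout)
open import Data.Nat.Primality using (Prime; prime⇒irreducible)
import Data.Nat.Properties as ℕₚ
open import Data.Product.Base using (Σ-syntax; ∃-syntax; _×_; _,_; proj₁; proj₂)
import Data.Product.Properties as Productₚ
open import Data.Sum.Base as Sum using (_⊎_; inj₁; inj₂; [_,_]′)
open import Data.Unit.Base using (tt)
open import Function.Base using (_∘_)
open import Function.Bundles using (Inverse; Equivalence; _⇔_; mk⇔; mk↔ₛ′)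
open import Function.Definitions using (Injective)
open import Level using (Level; 0ℓ; _⊔_)
open import Relation.Binary.Bundles using (Setoid)
open import Relation.Binary.Definitions using (WeaklyDecidable)
open import Relation.Binary.PropositionalEquality as ≡ using (_≡_; _≢_; cong; cong₂; subst; module ≡-Reasoning)
open import Relation.Nullary.Decidable using (Dec; yes; no; ¬?; does; _×-dec_; does-⇔)
open import Relation.Nullary.Negation.Core using (¬_; contradiction)
open import Relation.Unary using (Pred; Decidable)

-- For q ≡ 3 mod 4, elementary symmetric functions are used because, unlike power sums, they still
-- determine a polynomial in small characteristic; prime powers are thus covered together with
-- primes. At the slope y = i, outside the field, a + b y is the point itself; that is why a
-- polynomial in y that vanishes at enough slopes of the field says something about P.
--
-- For q ≡ 1 mod 4 the ring 𝔽′ has zero divisors and points cannot be inverted, so the argument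
-- passes to the integers. A character sum of q terms lies between -q and q, and its residue modulo
-- q, if not 0, leaves two candidates for it. An equation in the field gives such a residue only if
-- the kernel of ℤ → 𝔽_q is qℤ, that is, for prime q. Replacing χ by -χ turns a residue c into q -
-- c, so 0 ≤ c ≤ k can be arranged; then the residue 2c of the other k integral directions is below
-- q as well. If c ≠ 0, the count of pairs becomes 2q (c - 1)(c - k) = 0, the origin of the two
-- values of c.

module IntegerCoefficients {c ℓ} (R : CommutativeRing c ℓ) where
  open CommutativeRing R hiding (zero)
  open RingProperties ring
  open import Relation.Binary.Reasoning.Setoid setoid

  -- The separate clause for 1 lets `fromℕ 1` reduce to `1#` and `fromℕ 2` to `1# + 1#`, without a
  -- trailing zero, so that solver constants agree definitionally with the terms written in the
  -- proofs.
  fromℕ : ℕ → Carrier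
  fromℕ 0 = 0#
  fromℕ 1 = 1#
  fromℕ (suc (suc n)) = 1# + fromℕ (suc n)

  fromℤ : ℤ → Carrier
  fromℤ (ℤ.+ n) = fromℕ n
  fromℤ (-[1+ n ]) = - fromℕ (suc n)

  fromℕ-suc : ∀ n → fromℕ (suc n) ≈ 1# + fromℕ n
  fromℕ-suc zero = sym (+-identityʳ 1#)
  fromℕ-suc (suc n) = refl

  fromℕ-+ : ∀ m n → fromℕ (m ℕ.+ n) ≈ fromℕ m + fromℕ n
  fromℕ-+ zero n = sym (+-identityˡ _)
  fromℕ-+ (suc m) n = begin
    fromℕ (suc (m ℕ.+ n)) ≈⟨ fromℕ-suc (m ℕ.+ n) ⟩
    1# + fromℕ (m ℕ.+ n) ≈⟨ +-congˡ (fromℕ-+ m n) ⟩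
    1# + (fromℕ m + fromℕ n) ≈⟨ +-assoc _ _ _ ⟨
    (1# + fromℕ m) + fromℕ n ≈⟨ +-congʳ (fromℕ-suc m) ⟨
    fromℕ (suc m) + fromℕ n ∎

  fromℕ-* : ∀ m n → fromℕ (m ℕ.* n) ≈ fromℕ m * fromℕ n
  fromℕ-* zero n = sym (zeroˡ _)
  fromℕ-* (suc m) n = begin
    fromℕ (n ℕ.+ m ℕ.* n) ≈⟨ fromℕ-+ n (m ℕ.* n) ⟩
    fromℕ n + fromℕ (m ℕ.* n) ≈⟨ +-cong (sym (*-identityˡ _)) (fromℕ-* m n) ⟩
    1# * fromℕ n + fromℕ m * fromℕ n ≈⟨ distribʳ _ _ _ ⟨
    (1# + fromℕ m) * fromℕ n ≈⟨ *-congʳ (fromℕ-suc m) ⟨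
    fromℕ (suc m) * fromℕ n ∎

  fromℤ-⊖ : ∀ m n → fromℤ (m ℤ.⊖ n) ≈ fromℕ m - fromℕ n
  fromℤ-⊖ zero zero = sym (-‿inverseʳ 0#)
  fromℤ-⊖ zero (suc n) = sym (+-identityˡ _)
  fromℤ-⊖ (suc m) zero = sym (trans (+-congˡ -0#≈0#) (+-identityʳ _))
  fromℤ-⊖ (suc m) (suc n) = begin
    fromℤ (suc m ℤ.⊖ suc n) ≡⟨ cong fromℤ (ℤₚ.[1+m]⊖[1+n]≡m⊖n m n) ⟩
    fromℤ (m ℤ.⊖ n) ≈⟨ fromℤ-⊖ m n ⟩
    fromℕ m - fromℕ n ≈⟨ +-congʳ (sym (+-identityˡ _)) ⟩
    (0# + fromℕ m) - fromℕ n ≈⟨ +-congʳ (+-congʳ (-‿inverseʳ 1#)) ⟨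
    (1# - 1# + fromℕ m) - fromℕ n ≈⟨ +-congʳ (trans (+-assoc _ _ _) (trans (+-congˡ (+-comm _ _)) (sym (+-assoc _ _ _)))) ⟩
    ((1# + fromℕ m) - 1#) - fromℕ n ≈⟨ +-assoc _ _ _ ⟩
    (1# + fromℕ m) + (- 1# - fromℕ n) ≈⟨ +-congˡ (-‿+-comm 1# (fromℕ n)) ⟩
    (1# + fromℕ m) - (1# + fromℕ n) ≈⟨ +-cong (fromℕ-suc m) (-‿cong (fromℕ-suc n)) ⟨
    fromℕ (suc m) - fromℕ (suc n) ∎

  fromℤ-neg : ∀ i → fromℤ (ℤ.- i) ≈ - fromℤ i
  fromℤ-neg (ℤ.+ zero) = sym -0#≈0#
  fromℤ-neg (ℤ.+ suc n) = refl
  fromℤ-neg (-[1+ n ]) = sym (-‿involutive _)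

  fromℤ-+ : ∀ i j → fromℤ (i ℤ.+ j) ≈ fromℤ i + fromℤ j
  fromℤ-+ (ℤ.+ m) (ℤ.+ n) = fromℕ-+ m n
  fromℤ-+ (ℤ.+ m) (-[1+ n ]) = fromℤ-⊖ m (suc n)
  fromℤ-+ (-[1+ m ]) (ℤ.+ n) = trans (fromℤ-⊖ n (suc m)) (+-comm _ _)
  fromℤ-+ (-[1+ m ]) (-[1+ n ]) = begin
    - fromℕ (suc (suc (m ℕ.+ n))) ≡⟨ cong (λ k → - fromℕ (suc k)) (ℕₚ.+-suc m n) ⟨
    - fromℕ (suc m ℕ.+ suc n) ≈⟨ -‿cong (fromℕ-+ (suc m) (suc n)) ⟩
    - (fromℕ (suc m) + fromℕ (suc n)) ≈⟨ -‿+-comm _ _ ⟨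
    - fromℕ (suc m) - fromℕ (suc n) ∎

  fromℤ-* : ∀ i j → fromℤ (i ℤ.* j) ≈ fromℤ i * fromℤ j
  fromℤ-* (ℤ.+ m) (ℤ.+ n) = trans (reflexive (cong fromℤ (≡.sym (ℤₚ.pos-* m n)))) (fromℕ-* m n)
  fromℤ-* (ℤ.+ m) (-[1+ n ]) = begin
    fromℤ (ℤ.+ m ℤ.* -[1+ n ]) ≡⟨ cong fromℤ (ℤₚ.neg-distribʳ-* (ℤ.+ m) (ℤ.+ suc n)) ⟨
    fromℤ (ℤ.- (ℤ.+ m ℤ.* ℤ.+ suc n)) ≈⟨ fromℤ-neg (ℤ.+ m ℤ.* ℤ.+ suc n) ⟩
    - fromℤ (ℤ.+ m ℤ.* ℤ.+ suc n) ≈⟨ -‿cong (fromℤ-* (ℤ.+ m) (ℤ.+ suc n)) ⟩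
    - (fromℕ m * fromℕ (suc n)) ≈⟨ -‿distribʳ-* _ _ ⟩
    fromℕ m * - fromℕ (suc n) ∎
  fromℤ-* (-[1+ m ]) (ℤ.+ n) = begin
    fromℤ (-[1+ m ] ℤ.* ℤ.+ n) ≡⟨ cong fromℤ (ℤₚ.neg-distribˡ-* (ℤ.+ suc m) (ℤ.+ n)) ⟨
    fromℤ (ℤ.- (ℤ.+ suc m ℤ.* ℤ.+ n)) ≈⟨ fromℤ-neg (ℤ.+ suc m ℤ.* ℤ.+ n) ⟩
    - fromℤ (ℤ.+ suc m ℤ.* ℤ.+ n) ≈⟨ -‿cong (fromℤ-* (ℤ.+ suc m) (ℤ.+ n)) ⟩
    - (fromℕ (suc m) * fromℕ n) ≈⟨ -‿distribˡ-* _ _ ⟩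
    - fromℕ (suc m) * fromℕ n ∎
  fromℤ-* (-[1+ m ]) (-[1+ n ]) = begin
    fromℕ (suc m ℕ.* suc n) ≈⟨ fromℕ-* (suc m) (suc n) ⟩
    fromℕ (suc m) * fromℕ (suc n) ≈⟨ -‿involutive _ ⟨
    - - (fromℕ (suc m) * fromℕ (suc n)) ≈⟨ -‿cong (-‿distribˡ-* _ _) ⟩
    - (- fromℕ (suc m) * fromℕ (suc n)) ≈⟨ -‿distribʳ-* _ _ ⟩
    - fromℕ (suc m) * - fromℕ (suc n) ∎

  private
    almostCommutativeRing : AlmostCommutativeRing c ℓ
    almostCommutativeRing = fromCommutativeRing R

    morphism : ℤ.+-*-rawRing -Raw-AlmostCommutative⟶ almostCommutativeRing
    morphism = record
      { ⟦_⟧ = fromℤ ; +-homo = fromℤ-+ ; *-homo = fromℤ-* ; -‿homo = fromℤ-neg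
      ; 0-homo = refl ; 1-homo = refl }

    coefficient≟ : WeaklyDecidable (λ i j → fromℤ i ≈ fromℤ j)
    coefficient≟ i j with i ℤₚ.≟ j
    ... | yes i≡j = just (reflexive (cong fromℤ i≡j))
    ... | no _ = nothing

  module Solver = RingSolver ℤ.+-*-rawRing almostCommutativeRing morphism coefficient≟

  :1 : ∀ {n} → Solver.Polynomial n
  :1 = Solver.con (ℤ.+ 1)

  :0 : ∀ {n} → Solver.Polynomial n
  :0 = Solver.con (ℤ.+ 0)

-- Polynomial functions, their roots, and elementary symmetric functions

module PolynomialFunctions {c ℓ} (R : CommutativeRing c ℓ) where
  open CommutativeRing R hiding (zero)
  open RingProperties ring
  open Exponentiation commutativeSemiring using (_^_)
  open MonoidSum +-commutativeMonoid using (sum)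
  open IntegerCoefficients R
  open Solver using (solve; _:+_; _:*_; _:-_; :-_; _:=_)
  open import Relation.Binary.Reasoning.Setoid setoid

  -- f is a polynomial function of degree at most n whose coefficient of xⁿ is a.
  Poly : ℕ → Carrier → (Carrier → Carrier) → Set (c ⊔ ℓ)
  Poly zero a f = ∀ x → f x ≈ a
  Poly (suc n) a f = Σ[ b ∈ Carrier ] Σ[ g ∈ (Carrier → Carrier) ] Poly n a g × (∀ x → f x ≈ b + x * g x)

  poly-ext : ∀ n {a b f g} → a ≈ b → (∀ x → f x ≈ g x) → Poly n a f → Poly n b g
  poly-ext zero a≈b f≈g pf x = trans (sym (f≈g x)) (trans (pf x) a≈b)
  poly-ext (suc n) a≈b f≈g (b , h , ph , f≈) =
    b , h , poly-ext n a≈b (λ _ → refl) ph , λ x → trans (sym (f≈g x)) (f≈ x)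

  poly-+ : ∀ n {a b f g} → Poly n a f → Poly n b g → Poly n (a + b) (λ x → f x + g x)
  poly-+ zero pf pg x = +-cong (pf x) (pg x)
  poly-+ (suc n) (b , f′ , pf , f≈) (b′ , g′ , pg , g≈) =
    b + b′ , _ , poly-+ n pf pg , λ x → trans (+-cong (f≈ x) (g≈ x))
      (solve 5 (λ b b′ x u v → (b :+ x :* u) :+ (b′ :+ x :* v) := (b :+ b′) :+ x :* (u :+ v)) refl b b′ x (f′ x) (g′ x))

  poly-scale : ∀ n {a f} d → Poly n a f → Poly n (d * a) (λ x → d * f x)
  poly-scale zero d pf x = *-congˡ (pf x)
  poly-scale (suc n) d (b , g , pg , f≈) =
    d * b , _ , poly-scale n d pg , λ x → trans (*-congˡ (f≈ x))
      (solve 4 (λ d b x u → d :* (b :+ x :* u) := d :* b :+ x :* (d :* u)) refl d b x (g x))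

  poly-weaken : ∀ n {a f} → Poly n a f → Poly (suc n) 0# f
  poly-weaken zero {a} pf = a , (λ _ → 0#) , (λ _ → refl) , λ x → trans (pf x) (sym (trans (+-congˡ (zeroʳ x)) (+-identityʳ a)))
  poly-weaken (suc n) (b , g , pg , f≈) = b , g , poly-weaken n pg , f≈

  poly-0 : ∀ n → Poly n 0# (λ _ → 0#)
  poly-0 zero _ = refl
  poly-0 (suc n) = poly-weaken n (poly-0 n)

  poly-const : ∀ n b → Poly (suc n) 0# (λ _ → b)
  poly-const zero b = poly-weaken 0 (λ _ → refl)
  poly-const (suc n) b = poly-weaken (suc n) (poly-const n b)

  poly-linear* : ∀ n {a f} b d → Poly n a f → Poly (suc n) (d * a) (λ x → (b + d * x) * f x)
  poly-linear* n {a} {f} b d pf = poly-ext (suc n) (+-identityˡ _)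
    (λ x → solve 4 (λ b d x u → b :* u :+ (:0 :+ x :* (d :* u)) := (b :+ d :* x) :* u) refl b d x (f x))
    (poly-+ (suc n) (poly-weaken n (poly-ext n refl (λ _ → refl) (poly-scale n b pf)))
                    (0# , (λ x → d * f x) , poly-scale n d pf , λ _ → refl))

  poly-^ : ∀ n b d → Poly n (d ^ n) (λ x → (b + d * x) ^ n)
  poly-^ zero b d _ = refl
  poly-^ (suc n) b d = poly-linear* n b d (poly-^ n b d)

  poly-id^ : ∀ n → Poly n 1# (λ x → x ^ n)
  poly-id^ zero _ = refl
  poly-id^ (suc n) = 0# , _ , poly-id^ n , λ _ → sym (+-identityˡ _)

  poly-sum : ∀ n {m} (a : Fin m → Carrier) (f : Fin m → Carrier → Carrier) →
             (∀ i → Poly n (a i) (f i)) → Poly n (sum a) (λ x → sum (λ i → f i x))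
  poly-sum n {zero} a f pf = poly-0 n
  poly-sum n {suc m} a f pf = poly-+ n (pf Fin.zero) (poly-sum n _ _ (λ i → pf (Fin.suc i)))

  -- Synthetic division in Horner form: if f = b + x h and h = h r + (x - r) h′, then h r + x h′ is
  -- the quotient, and it inherits the leading coefficient of h.
  poly-divide : ∀ n {a f} r → Poly (suc n) a f →
                Σ[ g ∈ (Carrier → Carrier) ] Poly n a g × (∀ x → f x ≈ f r + (x - r) * g x)
  poly-divide zero {a} r (b , h , ph , f≈) = (λ _ → a) , (λ _ → refl) , λ x → begin
    _ ≈⟨ f≈ x ⟩
    b + x * h x ≈⟨ +-congˡ (*-congˡ (ph x)) ⟩
    b + x * a ≈⟨ solve 4 (λ a b x r → b :+ x :* a := (b :+ r :* a) :+ (x :- r) :* a) refl a b x r ⟩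
    b + r * a + (x - r) * a ≈⟨ +-congʳ (trans (f≈ r) (+-congˡ (*-congˡ (ph r)))) ⟨
    _ ∎
  poly-divide (suc n) r (b , h , ph , f≈) with poly-divide n r ph
  ... | h′ , ph′ , h≈ = (λ x → h r + x * h′ x) , (h r , h′ , ph′ , λ _ → refl) , λ x → begin
    _ ≈⟨ f≈ x ⟩
    b + x * h x ≈⟨ +-congˡ (*-congˡ (h≈ x)) ⟩
    b + x * (h r + (x - r) * h′ x) ≈⟨ solve 5 (λ b x r u v → b :+ x :* (u :+ (x :- r) :* v) := (b :+ r :* u) :+ (x :- r) :* (u :+ x :* v)) refl b x r (h r) (h′ x) ⟩
    b + r * h r + (x - r) * (h r + x * h′ x) ≈⟨ +-congʳ (f≈ r) ⟨
    _ ∎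

  module Roots (integral : ∀ x y → x * y ≈ 0# → x ≈ 0# ⊎ y ≈ 0#) where

    fromRoots : List Carrier → Carrier → Carrier
    fromRoots rs x = foldr (λ r p → (x - r) * p) 1# rs

    fromRoots≈0 : ∀ rs {x} → fromRoots rs x ≈ 0# → ¬ 0# ≈ 1# → ¬ All (λ r → ¬ x ≈ r) rs
    fromRoots≈0 [] 1≈0 0≉1 _ = 0≉1 (sym 1≈0)
    fromRoots≈0 (r ∷ rs) {x} eq 0≉1 (x≉r ∷ x≉rs) with integral _ _ eq
    ... | inj₁ x-r≈0 = x≉r (x∙y⁻¹≈ε⇒x≈y x r x-r≈0)
    ... | inj₂ eq′ = fromRoots≈0 rs eq′ 0≉1 x≉rs

    -- After a root r is split off, the quotient still vanishes at every other root s, because s - r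
    -- is not zero. When the roots are used up only the constant `a` is left. Applied with a = 0,
    -- this shows that f vanishes everywhere.
    poly-factor : ∀ {a f} rs → AllPairs (λ x y → ¬ x ≈ y) rs → All (λ r → f r ≈ 0#) rs →
                  Poly (length rs) a f → ∀ x → f x ≈ a * fromRoots rs x
    poly-factor [] _ _ pf x = trans (pf x) (sym (*-identityʳ _))
    poly-factor {a} {f} (r ∷ rs) (r≉rs ∷ distinct) (fr≈0 ∷ frs≈0) pf x with poly-divide (length rs) r pf
    ... | g , pg , f≈ = begin
      f x ≈⟨ f≈ x ⟩
      f r + (x - r) * g x ≈⟨ +-cong fr≈0 (*-congˡ (poly-factor rs distinct (All.zipWith root (r≉rs , frs≈0)) pg x)) ⟩
      0# + (x - r) * (a * fromRoots rs x) ≈⟨ solve 4 (λ x r a u → :0 :+ (x :- r) :* (a :* u) := a :* ((x :- r) :* u)) refl x r a (fromRoots rs x) ⟩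
      a * ((x - r) * fromRoots rs x) ∎
      where
      root : ∀ {s} → ¬ r ≈ s × f s ≈ 0# → g s ≈ 0#
      root {s} (r≉s , fs≈0) with integral (s - r) (g s) (begin
        (s - r) * g s ≈⟨ +-identityˡ _ ⟨
        0# + (s - r) * g s ≈⟨ +-congʳ fr≈0 ⟨
        f r + (s - r) * g s ≈⟨ f≈ s ⟨
        f s ≈⟨ fs≈0 ⟩
        0# ∎)
      ... | inj₁ s-r≈0 = contradiction (sym (x∙y⁻¹≈ε⇒x≈y s r s-r≈0)) r≉s
      ... | inj₂ gs≈0 = gs≈0

    module _ (0≉1 : ¬ 0# ≈ 1#) where

      -- Factoring over all roots but one and evaluating at that one leaves `a` times a product of
      -- nonzero differences.
      leading≈0 : ∀ n {a f} rs → length rs ≡ suc n → AllPairs (λ x y → ¬ x ≈ y) rs →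
                  All (λ r → f r ≈ 0#) rs → Poly n a f → a ≈ 0#
      leading≈0 n (r ∷ rs) ≡.refl (r≉rs ∷ distinct) (fr≈0 ∷ frs≈0) pf
        with integral _ _ (trans (sym (poly-factor rs distinct frs≈0 pf r)) fr≈0)
      ... | inj₁ a≈0 = a≈0
      ... | inj₂ p≈0 = contradiction r≉rs (fromRoots≈0 rs p≈0 0≉1)

      -- The conclusion reaches every x of the ring; this is what allows a polynomial known at
      -- elements of the small field to be evaluated at `i`.
      tooManyRoots : ∀ n {a f} rs → length rs ≡ suc n → AllPairs (λ x y → ¬ x ≈ y) rs →
                     All (λ r → f r ≈ 0#) rs → Poly n a f → ∀ x → f x ≈ 0#
      tooManyRoots n rs len distinct roots pf x with rs | len | distinct | roots
      ... | r ∷ rs′ | ≡.refl | r≉ ∷ distinct′ | fr≈0 ∷ roots′ = begin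
        _ ≈⟨ poly-factor rs′ distinct′ roots′ pf x ⟩
        _ ≈⟨ *-congʳ (leading≈0 n (r ∷ rs′) ≡.refl (r≉ ∷ distinct′) (fr≈0 ∷ roots′) pf) ⟩
        0# * fromRoots rs′ x ≈⟨ zeroˡ _ ⟩
        0# ∎

  esym : ℕ → List Carrier → Carrier
  esym zero _ = 1#
  esym (suc j) [] = 0#
  esym (suc j) (x ∷ xs) = esym (suc j) xs + x * esym j xs

  esym-poly : ∀ j ps → ∃[ a ] Poly j a (λ y → esym j (map (λ p → proj₁ p + proj₂ p * y) ps))
  esym-poly zero ps = 1# , λ _ → refl
  esym-poly (suc j) [] = 0# , poly-0 (suc j)
  esym-poly (suc j) ((b , d) ∷ ps) =
    _ , poly-+ (suc j) (proj₂ (esym-poly (suc j) ps)) (poly-linear* j b d (proj₂ (esym-poly j ps)))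

  esym-↭ : ∀ j {xs ys} → xs ↭ ys → esym j xs ≈ esym j ys
  esym-↭ zero _ = refl
  esym-↭ (suc j) Perm.refl = refl
  esym-↭ (suc j) (Perm.prep x p) = +-cong (esym-↭ (suc j) p) (*-congˡ (esym-↭ j p))
  esym-↭ (suc zero) (Perm.swap {xs} {ys} x y p) = begin
    (esym 1 xs + y * 1#) + x * 1# ≈⟨ +-congʳ (+-congʳ (esym-↭ 1 p)) ⟩
    (esym 1 ys + y * 1#) + x * 1# ≈⟨ solve 3 (λ e x y → (e :+ y :* :1) :+ x :* :1 := (e :+ x :* :1) :+ y :* :1) refl (esym 1 ys) x y ⟩
    (esym 1 ys + x * 1#) + y * 1# ∎
  esym-↭ (suc (suc j)) (Perm.swap {xs} {ys} x y p) = begin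
    (esym (2 ℕ.+ j) xs + y * esym (1 ℕ.+ j) xs) + x * (esym (1 ℕ.+ j) xs + y * esym j xs)
      ≈⟨ +-cong (+-cong (esym-↭ (2 ℕ.+ j) p) (*-congˡ (esym-↭ (1 ℕ.+ j) p))) (*-congˡ (+-cong (esym-↭ (1 ℕ.+ j) p) (*-congˡ (esym-↭ j p)))) ⟩
    (esym (2 ℕ.+ j) ys + y * esym (1 ℕ.+ j) ys) + x * (esym (1 ℕ.+ j) ys + y * esym j ys)
      ≈⟨ solve 5 (λ e₂ e₁ e₀ x y → (e₂ :+ y :* e₁) :+ x :* (e₁ :+ y :* e₀) := (e₂ :+ x :* e₁) :+ y :* (e₁ :+ x :* e₀)) refl _ _ _ x y ⟩
    (esym (2 ℕ.+ j) ys + x * esym (1 ℕ.+ j) ys) + y * (esym (1 ℕ.+ j) ys + x * esym j ys) ∎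
  esym-↭ (suc j) (Perm.trans p p′) = trans (esym-↭ (suc j) p) (esym-↭ (suc j) p′)

  esym-scale : ∀ j d xs → esym j (map (d *_) xs) ≈ d ^ j * esym j xs
  esym-scale zero d xs = sym (*-identityʳ _)
  esym-scale (suc j) d [] = sym (zeroʳ _)
  esym-scale (suc j) d (x ∷ xs) = begin
    esym (suc j) (map (d *_) xs) + d * x * esym j (map (d *_) xs) ≈⟨ +-cong (esym-scale (suc j) d xs) (*-congˡ (esym-scale j d xs)) ⟩
    d * d ^ j * esym (suc j) xs + d * x * (d ^ j * esym j xs)
      ≈⟨ solve 5 (λ d p e x f → d :* p :* e :+ d :* x :* (p :* f) := d :* p :* (e :+ x :* f)) refl d (d ^ j) (esym (suc j) xs) x (esym j xs) ⟩
    d * d ^ j * (esym (suc j) xs + x * esym j xs) ∎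

  esym-overflow : ∀ j xs → length xs ℕ.< j → esym j xs ≈ 0#
  esym-overflow (suc j) [] _ = refl
  esym-overflow (suc j) (x ∷ xs) (s≤s lt) = begin
    esym (suc j) xs + x * esym j xs ≈⟨ +-cong (esym-overflow (suc j) xs (ℕₚ.m≤n⇒m≤1+n lt)) (*-congˡ (esym-overflow j xs lt)) ⟩
    0# + x * 0# ≈⟨ trans (+-identityˡ _) (zeroʳ x) ⟩
    0# ∎

  -- This compares coefficients in ∏ (1 + x t) = ∏ x · ∏ (1/x + t). The induction splits both sides
  -- at the head of the list; at the two ends of the range one of the summands overflows the tail
  -- and is zero.
  esym-inverse : ∀ inv i j xs → i ℕ.+ j ≡ length xs → All (λ x → x * inv x ≈ 1#) xs →
                 esym j (map inv xs) * foldr _*_ 1# xs ≈ esym i xs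
  esym-inverse inv zero zero [] _ _ = *-identityʳ _
  esym-inverse inv i j (x ∷ xs) i+j≡ (x*y≈1 ∷ inverses) = step i j i+j≡
    where
    y = inv x
    P = foldr _*_ 1# xs
    ys = map inv xs
    IH : ∀ i j → i ℕ.+ j ≡ length xs → esym j ys * P ≈ esym i xs
    IH i j eq = esym-inverse inv i j xs eq inverses
    length-ys : length ys ≡ length xs
    length-ys = Listₚ.length-map inv xs
    step : ∀ i j → i ℕ.+ j ≡ suc (length xs) → esym j (y ∷ ys) * (x * P) ≈ esym i (x ∷ xs)
    step zero (suc j) eq = begin
      (esym (suc j) ys + y * esym j ys) * (x * P) ≈⟨ *-congʳ (+-congʳ (esym-overflow (suc j) ys (ℕₚ.≤-reflexive (cong suc (≡.trans length-ys (≡.sym (ℕₚ.suc-injective eq))))))) ⟩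
      (0# + y * esym j ys) * (x * P) ≈⟨ solve 4 (λ x y e p → (:0 :+ y :* e) :* (x :* p) := (x :* y) :* (e :* p)) refl x y (esym j ys) P ⟩
      (x * y) * (esym j ys * P) ≈⟨ *-cong x*y≈1 (IH zero j (ℕₚ.suc-injective eq)) ⟩
      1# * 1# ≈⟨ *-identityˡ 1# ⟩
      1# ∎
    step (suc i) zero eq = begin
      1# * (x * P) ≈⟨ solve 2 (λ x p → :1 :* (x :* p) := :0 :+ x :* (:1 :* p)) refl x P ⟩
      0# + x * (1# * P) ≈⟨ +-cong (sym (esym-overflow (suc i) xs (s≤s (ℕₚ.≤-reflexive (≡.sym (≡.trans (≡.sym (ℕₚ.+-identityʳ i)) (ℕₚ.suc-injective eq))))))) (*-congˡ (IH i zero (ℕₚ.suc-injective eq))) ⟩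
      esym (suc i) xs + x * esym i xs ∎
    step (suc i) (suc j) eq = begin
      (esym (suc j) ys + y * esym j ys) * (x * P) ≈⟨ solve 5 (λ x y e f p → (e :+ y :* f) :* (x :* p) := (x :* y) :* (f :* p) :+ x :* (e :* p)) refl x y _ _ P ⟩
      (x * y) * (esym j ys * P) + x * (esym (suc j) ys * P)
        ≈⟨ +-cong (*-cong x*y≈1 (IH (suc i) j (ℕₚ.suc-injective (≡.trans (cong suc (≡.sym (ℕₚ.+-suc i j))) eq)))) (*-congˡ (IH i (suc j) (ℕₚ.suc-injective eq))) ⟩
      1# * esym (suc i) xs + x * esym i xs ≈⟨ +-congʳ (*-identityˡ _) ⟩
      esym (suc i) xs + x * esym i xs ∎

-- Stated over a variable ring because the operations of the quadratic extension unfold to components.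
module RingIdentities {c ℓ} (R : CommutativeRing c ℓ) where
  open CommutativeRing R hiding (zero)
  open IntegerCoefficients R
  open Solver using (solve; _:+_; _:*_; _:-_; :-_; _:=_)

  x≈x1+0 : ∀ x → x ≈ x * 1# + 0#
  x≈x1+0 = solve 1 (λ x → x := x :* :1 :+ :0) refl

  x≈[1+0]x : ∀ x → x ≈ (1# + 0#) * x
  x≈[1+0]x = solve 1 (λ x → x := (:1 :+ :0) :* x) refl

  x≈x+0y : ∀ x y → x ≈ x + 0# * y
  x≈x+0y = solve 2 (λ x y → x := x :+ :0 :* y) refl

  y≈x+[y-x] : ∀ x y → y ≈ x + (y - x)
  y≈x+[y-x] = solve 2 (λ x y → y := x :+ (y :- x)) refl

  x-0≈x : ∀ x → x - 0# ≈ x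
  x-0≈x = solve 1 (λ x → x :- :0 := x) refl

  -‿translate : ∀ z x y → x - y ≈ (x - z) - (y - z)
  -‿translate = solve 3 (λ z x y → x :- y := (x :- z) :- (y :- z)) refl

  [x-x]y≈0 : ∀ x y → (x - x) * y ≈ 0#
  [x-x]y≈0 = solve 2 (λ x y → (x :- x) :* y := :0) refl

  xx≈[-x][-x] : ∀ x → x * x ≈ - x * - x
  xx≈[-x][-x] = solve 1 (λ x → x :* x := :- x :* :- x) refl

  [-x]y≈-[0+xy] : ∀ x y → - x * y ≈ - (0# + x * y)
  [-x]y≈-[0+xy] = solve 2 (λ x y → :- x :* y := :- (:0 :+ x :* y)) refl

  y≈[y+xz]+[-x]z : ∀ x y z → y ≈ (y + x * z) + - x * z
  y≈[y+xz]+[-x]z = solve 3 (λ x y z → y := (y :+ x :* z) :+ :- x :* z) refl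

  x[yz]≈[xz]y : ∀ x y z → x * (y * z) ≈ (x * z) * y
  x[yz]≈[xz]y = solve 3 (λ x y z → x :* (y :* z) := (x :* z) :* y) refl

  inverse-difference : ∀ x y x′ y′ → (x′ - y′) * (x * y) ≈ (x * x′) * y - (y * y′) * x
  inverse-difference = solve 4 (λ x y x′ y′ → (x′ :- y′) :* (x :* y) := (x :* x′) :* y :- (y :* y′) :* x) refl

-- Pigeonhole principles for finite sets and for lists without repetition

injective⇒surjective : ∀ {n} {f : Fin n → Fin n} → Injective _≡_ _≡_ f → ∀ y → ∃[ x ] f x ≡ y
injective⇒surjective {suc n} {f} inj y with Finₚ.any? (λ x → f x Finₚ.≟ y)
... | yes found = found
... | no ∄ = contradiction (Finₚ.injective⇒≤ {f = λ x → Fin.punchOut (avoids x)} inj′) ℕₚ.1+n≰n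
  where
  avoids : ∀ x → y ≢ f x
  avoids x y≡fx = ∄ (x , ≡.sym y≡fx)
  inj′ : Injective _≡_ _≡_ (λ x → Fin.punchOut (avoids x))
  inj′ eq = inj (Finₚ.punchOut-injective (avoids _) (avoids _) eq)

injective⇒permutation : ∀ {n} {f : Fin n → Fin n} → Injective _≡_ _≡_ f → Permutation n n
injective⇒permutation {f = f} inj = mk↔ₛ′ f (proj₁ ∘ injective⇒surjective inj) (proj₂ ∘ injective⇒surjective inj)
  (λ x → inj (proj₂ (injective⇒surjective inj (f x))))

module _ {a} {A : Set a} where

  ∈⇒↭∷ : ∀ {x : A} {ys} → x ∈ ys → ∃[ zs ] ys ↭ x ∷ zs
  ∈⇒↭∷ x∈ys with ∈ₚ.∈-∃++ x∈ys
  ... | as , bs , ≡.refl = as ++ bs , Permₚ.shift _ as bs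

  unique⇒↭++ : ∀ {xs ys : List A} → Unique xs → (∀ {x} → x ∈ xs → x ∈ ys) → ∃[ zs ] ys ↭ xs ++ zs
  unique⇒↭++ {[]} {ys} _ _ = ys , Perm.refl
  unique⇒↭++ {x ∷ xs} {ys} (x∉xs ∷ u) xs⊆ys with ∈⇒↭∷ (xs⊆ys (here ≡.refl))
  ... | ys′ , p with unique⇒↭++ u (λ z∈xs → strengthen z∈xs (Permₚ.∈-resp-↭ p (xs⊆ys (there z∈xs))))
    where
    strengthen : ∀ {z} → z ∈ xs → z ∈ x ∷ ys′ → z ∈ ys′
    strengthen z∈xs (here ≡.refl) = contradiction ≡.refl (All.lookup x∉xs z∈xs)
    strengthen z∈xs (there z∈) = z∈
  ... | zs , p′ = zs , Perm.trans p (Perm.prep x p′)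

  unique⇒length≤ : ∀ {xs ys : List A} → Unique xs → (∀ {x} → x ∈ xs → x ∈ ys) → length xs ℕ.≤ length ys
  unique⇒length≤ {xs} u xs⊆ys with unique⇒↭++ u xs⊆ys
  ... | zs , p = ℕₚ.≤-trans (ℕₚ.m≤m+n (length xs) (length zs))
                            (ℕₚ.≤-reflexive (≡.trans (≡.sym (Listₚ.length-++ xs)) (≡.sym (Permₚ.↭-length p))))

  unique⇒↭ : ∀ {xs ys : List A} → Unique xs → (∀ {x} → x ∈ xs → x ∈ ys) → length ys ℕ.≤ length xs → ys ↭ xs
  unique⇒↭ {xs} u xs⊆ys len with unique⇒↭++ u xs⊆ys
  ... | [] , p = Perm.trans p (Perm.↭-reflexive (Listₚ.++-identityʳ xs))
  ... | z ∷ zs , p = contradiction len (ℕₚ.<⇒≱ (ℕₚ.≤-trans (ℕₚ.m<m+n (length xs) (s≤s ℕ.z≤n))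
                       (ℕₚ.≤-reflexive (≡.trans (≡.sym (Listₚ.length-++ xs)) (≡.sym (Permₚ.↭-length p))))))

-- Finite fields

record FieldOnFin (q : ℕ) : Set where
  infix 8 -_
  infixl 7 _*_
  infixl 6 _+_
  field
    _+_ _*_ : Fin q → Fin q → Fin q
    -_ : Fin q → Fin q
    0# 1# : Fin q
    isCommutativeRing : IsCommutativeRing _≡_ _+_ _*_ -_ 0# 1#
    0≢1 : 0# ≢ 1#
    inverse : ∀ x → x ≢ 0# → ∃[ y ] x * y ≡ 1#

  commutativeRing : CommutativeRing 0ℓ 0ℓ
  commutativeRing = record { isCommutativeRing = isCommutativeRing }

  open CommutativeRing commutativeRing public using (_-_)

module FieldTheory {q} (𝔾 : FieldOnFin q) where
  open FieldOnFin 𝔾 public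
  open CommutativeRing commutativeRing public
    using (ring; commutativeSemiring; +-commutativeMonoid; +-comm; +-assoc; *-comm; *-assoc; +-identityˡ; +-identityʳ; *-identityˡ; *-identityʳ; zeroˡ; zeroʳ; -‿inverseʳ)
  open RingProperties ring public using (x∙y⁻¹≈ε⇒x≈y; +-cancelʳ; +-cancelˡ)
  open Exponentiation commutativeSemiring public using (_^_; ^-distrib-*; ^-homo-*)
  open IntegerCoefficients commutativeRing public
  open Solver public using (solve; _:+_; _:*_; _:-_; :-_; _:=_)
  open PolynomialFunctions commutativeRing public
  open ≡-Reasoning

  infixl 7 _/_

  inv : Fin q → Fin q
  inv x with x Finₚ.≟ 0#
  ... | yes _ = 0#
  ... | no x≢0 = proj₁ (inverse x x≢0)

  x*inv : ∀ {x} → x ≢ 0# → x * inv x ≡ 1#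
  x*inv {x} x≢0 with x Finₚ.≟ 0#
  ... | yes x≡0 = contradiction x≡0 x≢0
  ... | no x≢0′ = proj₂ (inverse x x≢0′)

  _/_ : Fin q → Fin q → Fin q
  x / y = x * inv y

  *-cancelˡ : ∀ {x y z} → x ≢ 0# → x * y ≡ x * z → y ≡ z
  *-cancelˡ {x} {y} {z} x≢0 eq = begin
    y ≡⟨ lemma y ⟩
    inv x * (x * y) ≡⟨ cong (inv x *_) eq ⟩
    inv x * (x * z) ≡⟨ lemma z ⟨
    z ∎
    where
    lemma : ∀ w → w ≡ inv x * (x * w)
    lemma w = ≡.sym (≡.trans (solve 3 (λ i x w → i :* (x :* w) := (x :* i) :* w) ≡.refl (inv x) x w)
                      (≡.trans (cong (_* w) (x*inv x≢0)) (*-identityˡ w)))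

  integral : ∀ x y → x * y ≡ 0# → x ≡ 0# ⊎ y ≡ 0#
  integral x y xy≡0 with x Finₚ.≟ 0#
  ... | yes x≡0 = inj₁ x≡0
  ... | no x≢0 = inj₂ (*-cancelˡ x≢0 (≡.trans xy≡0 (≡.sym (zeroʳ x))))

  *-nonzero : ∀ {x y} → x ≢ 0# → y ≢ 0# → x * y ≢ 0#
  *-nonzero x≢0 y≢0 xy≡0 with integral _ _ xy≡0
  ... | inj₁ x≡0 = x≢0 x≡0
  ... | inj₂ y≡0 = y≢0 y≡0

  inv≢0 : ∀ {x} → x ≢ 0# → inv x ≢ 0#
  inv≢0 {x} x≢0 i≡0 = 0≢1 (≡.trans (≡.sym (zeroʳ x)) (≡.trans (cong (x *_) (≡.sym i≡0)) (x*inv x≢0)))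

  -- Translation by 1 permutes the field, so the sum of all elements equals itself plus q times 1.
  fromℕ-q : fromℕ q ≡ 0#
  fromℕ-q = +-cancelˡ (sum (λ x → x)) _ _ (begin
    sum (λ x → x) + fromℕ q ≡⟨ cong (sum (λ x → x) +_) (sum-1 q) ⟨
    sum (λ x → x) + sum {q} (λ _ → 1#) ≡⟨ ∑-distrib-+ {q} (λ x → x) (λ _ → 1#) ⟨
    sum (λ x → x + 1#) ≡⟨ sum-permute (λ x → x) (injective⇒permutation (λ {x} {y} → +-cancelʳ 1# x y)) ⟨
    sum (λ x → x) ≡⟨ +-identityʳ _ ⟨
    sum (λ x → x) + 0# ∎)
    where
    open MonoidSum +-commutativeMonoid using (sum; ∑-distrib-+; sum-permute)
    sum-1 : ∀ n → sum {n} (λ _ → 1#) ≡ fromℕ n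
    sum-1 zero = ≡.refl
    sum-1 (suc n) = ≡.trans (cong (1# +_) (sum-1 n)) (≡.sym (fromℕ-suc n))

  nonzeros : List (Fin q)
  nonzeros = filter (λ x → ¬? (x Finₚ.≟ 0#)) (allFin q)

  nonzeros-unique : Unique nonzeros
  nonzeros-unique = Uniqueₚ.filter⁺ (λ x → ¬? (x Finₚ.≟ 0#)) (Uniqueₚ.allFin⁺ q)

  ∈-nonzeros⁺ : ∀ {x} → x ≢ 0# → x ∈ nonzeros
  ∈-nonzeros⁺ {x} x≢0 = ∈ₚ.∈-filter⁺ (λ x → ¬? (x Finₚ.≟ 0#)) (∈ₚ.∈-allFin x) x≢0

  ∈-nonzeros⁻ : ∀ {x} → x ∈ nonzeros → x ≢ 0#
  ∈-nonzeros⁻ x∈ = proj₂ (∈ₚ.∈-filter⁻ (λ x → ¬? (x Finₚ.≟ 0#)) {xs = allFin q} x∈)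

  length-nonzeros : suc (length nonzeros) ≡ q
  length-nonzeros = ≡.trans (ℕₚ.≤-antisym
    (unique⇒length≤ (All.tabulate (λ x∈ 0≡x → ∈-nonzeros⁻ x∈ (≡.sym 0≡x)) ∷ nonzeros-unique) (λ {x} _ → ∈ₚ.∈-allFin x))
    (unique⇒length≤ (Uniqueₚ.allFin⁺ q) (λ {x} _ → split x)))
    (Listₚ.length-tabulate {n = q} (λ x → x))
    where
    split : ∀ x → x ∈ 0# ∷ nonzeros
    split x with x Finₚ.≟ 0#
    ... | yes ≡.refl = here ≡.refl
    ... | no x≢0 = there (∈-nonzeros⁺ x≢0)

  esym-length : ∀ xs → esym (length xs) xs ≡ foldr _*_ 1# xs
  esym-length [] = ≡.refl
  esym-length (x ∷ xs) = ≡.trans (cong₂ _+_ (esym-overflow (suc (length xs)) xs ℕₚ.≤-refl) (cong (x *_) (esym-length xs))) (+-identityˡ _)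

  product-nonzero : ∀ xs → All (_≢ 0#) xs → foldr _*_ 1# xs ≢ 0#
  product-nonzero [] _ = 0≢1 ∘ ≡.sym
  product-nonzero (x ∷ xs) (x≢0 ∷ xs≢0) = *-nonzero x≢0 (product-nonzero xs xs≢0)

  -- Multiplication by x permutes the nonzero elements and so fixes their top symmetric function,
  -- which by `esym-scale` it also multiplies by x^n. That function is the product of the nonzero
  -- elements and can be cancelled.
  fermat : ∀ {n} → q ≡ suc n → ∀ {x} → x ≢ 0# → x ^ n ≡ 1#
  fermat {n} q≡1+n {x} x≢0 = *-cancelˡ e≢0 (begin
    e * x ^ n ≡⟨ *-comm _ _ ⟩
    x ^ n * e ≡⟨ esym-scale n x nonzeros ⟨
    esym n (map (x *_) nonzeros) ≡⟨ esym-↭ n (unique⇒↭ unique-image image⊆ (ℕₚ.≤-reflexive (≡.sym (Listₚ.length-map (x *_) nonzeros)))) ⟨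
    e ≡⟨ *-identityʳ e ⟨
    e * 1# ∎)
    where
    e = esym n nonzeros
    n≡ : length nonzeros ≡ n
    n≡ = ℕₚ.suc-injective (≡.trans length-nonzeros q≡1+n)
    e≢0 : e ≢ 0#
    e≢0 = ≡.subst (λ m → esym m nonzeros ≢ 0#) n≡
      (λ eq → product-nonzero nonzeros (All.tabulate ∈-nonzeros⁻) (≡.trans (≡.sym (esym-length nonzeros)) eq))
    unique-image : Unique (map (x *_) nonzeros)
    unique-image = Uniqueₚ.map⁺ (*-cancelˡ x≢0) nonzeros-unique
    image⊆ : ∀ {y} → y ∈ map (x *_) nonzeros → y ∈ nonzeros
    image⊆ y∈ with ∈ₚ.∈-map⁻ (x *_) y∈
    ... | z , z∈ , ≡.refl = ∈-nonzeros⁺ (*-nonzero x≢0 (∈-nonzeros⁻ z∈))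

length-filter-¬ : ∀ {a p} {A : Set a} {P : Pred A p} (P? : Decidable P) xs →
                  length (filter P? xs) ℕ.+ length (filter (λ x → ¬? (P? x)) xs) ≡ length xs
length-filter-¬ P? [] = ≡.refl
length-filter-¬ P? (x ∷ xs) with does (P? x)
... | true = cong suc (length-filter-¬ P? xs)
... | false = ≡.trans (ℕₚ.+-suc _ _) (cong suc (length-filter-¬ P? xs))

-- Squares in a field of odd order

module Squares {q} (𝔾 : FieldOnFin q) where
  open FieldTheory 𝔾
  open ≡-Reasoning

  Square : Fin q → Set
  Square x = ∃[ t ] x ≡ t * t

  square? : Decidable Square
  square? x = Finₚ.any? (λ t → x Finₚ.≟ t * t)

  square-/ : ∀ {x y} → y ≢ 0# → Square y → Square (x * y) → Square x
  square-/ {x} {y} y≢0 (s , y≡s²) (t , xy≡t²) = t / s , *-cancelˡ y≢0 (begin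
    y * x ≡⟨ *-comm y x ⟩
    x * y ≡⟨ xy≡t² ⟩
    t * t ≡⟨ ≡.trans (≡.sym (*-identityˡ _)) (≡.trans (≡.sym (*-identityˡ _)) (cong (λ u → u * (u * (t * t))) (≡.sym (x*inv s≢0)))) ⟩
    (s * inv s) * ((s * inv s) * (t * t)) ≡⟨ solve 3 (λ s i t → (s :* i) :* ((s :* i) :* (t :* t)) := (s :* s) :* ((t :* i) :* (t :* i))) ≡.refl s (inv s) t ⟩
    (s * s) * (t / s * (t / s)) ≡⟨ cong (_* (t / s * (t / s))) y≡s² ⟨
    y * (t / s * (t / s)) ∎)
    where
    s≢0 : s ≢ 0#
    s≢0 ≡.refl = y≢0 (≡.trans y≡s² (zeroˡ _))

  square-* : ∀ {x y} → Square x → Square y → Square (x * y)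
  square-* (s , x≡s²) (t , y≡t²) = s * t , ≡.trans (cong₂ _*_ x≡s² y≡t²)
    (solve 2 (λ s t → (s :* s) :* (t :* t) := (s :* t) :* (s :* t)) ≡.refl s t)

  1^ : ∀ n → 1# ^ n ≡ 1#
  1^ zero = ≡.refl
  1^ (suc n) = ≡.trans (*-identityˡ _) (1^ n)

  square-^ : ∀ x n → x ^ (n ℕ.+ n) ≡ (x * x) ^ n
  square-^ x n = ≡.trans (^-homo-* x n n) (≡.sym (^-distrib-* x x n))

  module _ (k : ℕ) (q≡1+2k : q ≡ suc (k ℕ.+ k)) where

    -- The odd number q is 0 in the field by `fromℕ-q`, whereas 2 = 0 would make it 1.
    2≢0 : 1# + 1# ≢ 0#
    2≢0 2≡0 = 0≢1 (begin
      0# ≡⟨ fromℕ-q ⟨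
      fromℕ q ≡⟨ cong fromℕ q≡1+2k ⟩
      fromℕ (suc (k ℕ.+ k)) ≡⟨ fromℕ-suc (k ℕ.+ k) ⟩
      1# + fromℕ (k ℕ.+ k) ≡⟨ cong (1# +_) (fromℕ-+ k k) ⟩
      1# + (fromℕ k + fromℕ k) ≡⟨ solve 1 (λ u → :1 :+ (u :+ u) := :1 :+ (:1 :+ :1) :* u) ≡.refl (fromℕ k) ⟩
      1# + (1# + 1#) * fromℕ k ≡⟨ cong (λ u → 1# + u * fromℕ k) 2≡0 ⟩
      1# + 0# * fromℕ k ≡⟨ solve 1 (λ u → :1 :+ :0 :* u := :1) ≡.refl (fromℕ k) ⟩
      1# ∎)

    x≢-x : ∀ {x} → x ≢ 0# → x ≢ - x
    x≢-x {x} x≢0 x≡-x = *-nonzero 2≢0 x≢0 (begin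
      (1# + 1#) * x ≡⟨ solve 1 (λ x → (:1 :+ :1) :* x := x :+ x) ≡.refl x ⟩
      x + x ≡⟨ cong (x +_) x≡-x ⟩
      x - x ≡⟨ -‿inverseʳ x ⟩
      0# ∎)

    double-injective : ∀ {x y} → x + x ≡ y + y → x ≡ y
    double-injective {x} {y} eq = *-cancelˡ 2≢0 (≡.trans (double x) (≡.trans eq (≡.sym (double y))))
      where
      double : ∀ x → (1# + 1#) * x ≡ x + x
      double = solve 1 (λ x → (:1 :+ :1) :* x := x :+ x) ≡.refl

    -- With k odd, t² = -1 would give t^(2k) = (-1)^k = -1, against Fermat.
    -1-nonsquare : ∀ m → k ≡ suc (m ℕ.+ m) → ∀ t → t * t ≢ - 1#
    -1-nonsquare m k≡ t t²≡-1 = x≢-x (0≢1 ∘ ≡.sym) (begin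
      1# ≡⟨ fermat q≡1+2k t≢0 ⟨
      t ^ (k ℕ.+ k) ≡⟨ square-^ t k ⟩
      (t * t) ^ k ≡⟨ cong₂ _^_ t²≡-1 k≡ ⟩
      - 1# * (- 1#) ^ (m ℕ.+ m) ≡⟨ cong (- 1# *_) (square-^ (- 1#) m) ⟩
      - 1# * (- 1# * - 1#) ^ m ≡⟨ cong (λ u → - 1# * u ^ m) (solve 0 (:- :1 :* :- :1 := :1) ≡.refl) ⟩
      - 1# * 1# ^ m ≡⟨ cong (- 1# *_) (1^ m) ⟩
      - 1# * 1# ≡⟨ solve 0 (:- :1 :* :1 := :- :1) ≡.refl ⟩
      - 1# ∎)
      where
      t≢0 : t ≢ 0#
      t≢0 ≡.refl = 0≢1 (begin
        0# ≡⟨ solve 0 (:0 := :- (:0 :* :0)) ≡.refl ⟩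
        - (0# * 0#) ≡⟨ cong -_ t²≡-1 ⟩
        - - 1# ≡⟨ solve 0 (:- :- :1 := :1) ≡.refl ⟩
        1# ∎)

    -- A solution of 1 + y² = s² gives the two elements y ± s, with product -1 and sum 2y; those
    -- obtained from different y are different, and none of them is zero.
    circle-squares : (∀ y → 1# + y * y ≢ 0#) →
                     suc (length (filter (λ y → square? (1# + y * y)) (allFin q)) ℕ.+
                          length (filter (λ y → square? (1# + y * y)) (allFin q))) ℕ.≤ q
    circle-squares nonzero = subst (λ l → suc l ℕ.≤ q) lengths
      (ℕₚ.≤-trans (unique⇒length≤ unique (λ {x} _ → ∈ₚ.∈-allFin x)) (ℕₚ.≤-reflexive (Listₚ.length-tabulate {n = q} (λ x → x))))
      where
      Q? : Decidable (λ y → Square (1# + y * y))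
      Q? y = square? (1# + y * y)
      L = filter Q? (allFin q)
      root : Fin q → Fin q
      root y with Q? y
      ... | yes (s , _) = s
      ... | no _ = 0#
      root² : ∀ {y} → y ∈ L → 1# + y * y ≡ root y * root y
      root² {y} y∈ with Q? y
      ... | yes (_ , eq) = eq
      ... | no ¬sq = contradiction (proj₂ (∈ₚ.∈-filter⁻ Q? {xs = allFin q} y∈)) ¬sq
      w₁ w₂ : Fin q → Fin q
      w₁ y = y + root y
      w₂ y = y - root y
      w₁w₂ : ∀ {y} → y ∈ L → w₁ y * w₂ y ≡ - 1#
      w₁w₂ {y} y∈ = begin
        (y + root y) * (y - root y) ≡⟨ solve 2 (λ y s → (y :+ s) :* (y :- s) := y :* y :- s :* s) ≡.refl y (root y) ⟩
        y * y - root y * root y ≡⟨ cong (λ u → y * y - u) (root² y∈) ⟨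
        y * y - (1# + y * y) ≡⟨ solve 1 (λ y → y :* y :- (:1 :+ y :* y) := :- :1) ≡.refl y ⟩
        - 1# ∎
      -1≢0 : - 1# ≢ 0#
      -1≢0 eq = 0≢1 (≡.trans (solve 0 (:0 := :- :0) ≡.refl) (≡.trans (cong -_ (≡.sym eq)) (solve 0 (:- :- :1 := :1) ≡.refl)))
      w₁≢0 : ∀ {y} → y ∈ L → w₁ y ≢ 0#
      w₁≢0 {y} y∈ eq = -1≢0 (≡.trans (≡.sym (w₁w₂ y∈)) (≡.trans (cong (_* w₂ y) eq) (zeroˡ _)))
      w₂≢0 : ∀ {y} → y ∈ L → w₂ y ≢ 0#
      w₂≢0 {y} y∈ eq = -1≢0 (≡.trans (≡.sym (w₁w₂ y∈)) (≡.trans (cong (w₁ y *_) eq) (zeroʳ _)))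
      sum-eq : ∀ y → w₁ y + w₂ y ≡ y + y
      sum-eq y = solve 2 (λ y s → (y :+ s) :+ (y :- s) := y :+ y) ≡.refl y (root y)
      w₁-injective : ∀ {y z} → y ∈ L → z ∈ L → w₁ y ≡ w₁ z → y ≡ z
      w₁-injective {y} {z} y∈ z∈ eq = double-injective (begin
        y + y ≡⟨ sum-eq y ⟨
        w₁ y + w₂ y ≡⟨ cong₂ _+_ eq (*-cancelˡ (w₁≢0 y∈) (≡.trans (w₁w₂ y∈) (≡.trans (≡.sym (w₁w₂ z∈)) (cong (_* w₂ z) (≡.sym eq))))) ⟩
        w₁ z + w₂ z ≡⟨ sum-eq z ⟩
        z + z ∎)
      w₂-injective : ∀ {y z} → y ∈ L → z ∈ L → w₂ y ≡ w₂ z → y ≡ z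
      w₂-injective {y} {z} y∈ z∈ eq = w₁-injective y∈ z∈ (*-cancelˡ (w₂≢0 y∈) (begin
        w₂ y * w₁ y ≡⟨ *-comm _ _ ⟩
        w₁ y * w₂ y ≡⟨ w₁w₂ y∈ ⟩
        - 1# ≡⟨ w₁w₂ z∈ ⟨
        w₁ z * w₂ z ≡⟨ *-comm _ _ ⟩
        w₂ z * w₁ z ≡⟨ cong (_* w₁ z) eq ⟨
        w₂ y * w₁ z ∎))
      -- As both products are -1, w₁ y = w₂ z forces w₂ y = w₁ z. Comparing the sums gives y = z,
      -- and then w₁ y = w₂ y gives root y = 0, that is, 1 + y² = 0.
      w₁≢w₂ : ∀ {y z} → y ∈ L → z ∈ L → w₁ y ≢ w₂ z
      w₁≢w₂ {y} {z} y∈ z∈ eq = nonzero y (≡.trans (root² y∈) (≡.trans (cong (λ u → u * u) root≡0) (zeroˡ _)))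
        where
        w₂≡w₁ : w₂ y ≡ w₁ z
        w₂≡w₁ = *-cancelˡ (w₁≢0 y∈) (begin
          w₁ y * w₂ y ≡⟨ w₁w₂ y∈ ⟩
          - 1# ≡⟨ w₁w₂ z∈ ⟨
          w₁ z * w₂ z ≡⟨ *-comm _ _ ⟩
          w₂ z * w₁ z ≡⟨ cong (_* w₁ z) eq ⟨
          w₁ y * w₁ z ∎)
        y≡z : y ≡ z
        y≡z = double-injective (begin
          y + y ≡⟨ sum-eq y ⟨
          w₁ y + w₂ y ≡⟨ cong₂ _+_ eq w₂≡w₁ ⟩
          w₂ z + w₁ z ≡⟨ +-comm _ _ ⟩
          w₁ z + w₂ z ≡⟨ sum-eq z ⟩
          z + z ∎)
        root≡0 : root y ≡ 0#
        root≡0 = double-injective (begin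
          root y + root y ≡⟨ solve 2 (λ y s → s :+ s := (y :+ s) :- (y :- s)) ≡.refl y (root y) ⟩
          w₁ y - w₂ y ≡⟨ cong (λ u → u - w₂ y) (≡.trans eq (cong w₂ (≡.sym y≡z))) ⟩
          w₂ y - w₂ y ≡⟨ -‿inverseʳ _ ⟩
          0# ≡⟨ +-identityˡ _ ⟨
          0# + 0# ∎)
      map-unique : ∀ {f : Fin q → Fin q} xs → (∀ {y z} → y ∈ xs → z ∈ xs → f y ≡ f z → y ≡ z) → Unique xs → Unique (map f xs)
      map-unique [] inj [] = []
      map-unique (x ∷ xs) inj (x∉ ∷ u) =
        Allₚ.map⁺ (All.tabulate (λ z∈ eq → All.lookup x∉ z∈ (inj (here ≡.refl) (there z∈) eq)))
        ∷ map-unique xs (λ y∈ z∈ → inj (there y∈) (there z∈)) u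
      L-unique : Unique L
      L-unique = Uniqueₚ.filter⁺ Q? (Uniqueₚ.allFin⁺ q)
      unique : Unique (0# ∷ map w₁ L ++ map w₂ L)
      unique = Allₚ.++⁺ (Allₚ.map⁺ (All.tabulate (λ y∈ eq → w₁≢0 y∈ (≡.sym eq)))) (Allₚ.map⁺ (All.tabulate (λ y∈ eq → w₂≢0 y∈ (≡.sym eq))))
             ∷ Uniqueₚ.++⁺ (map-unique L w₁-injective L-unique) (map-unique L w₂-injective L-unique) disjoint
        where
        disjoint : ∀ {v} → ¬ (v ∈ map w₁ L × v ∈ map w₂ L)
        disjoint (v∈₁ , v∈₂) with ∈ₚ.∈-map⁻ w₁ v∈₁ | ∈ₚ.∈-map⁻ w₂ v∈₂
        ... | y , y∈ , v≡₁ | z , z∈ , v≡₂ = w₁≢w₂ y∈ z∈ (≡.trans (≡.sym v≡₁) v≡₂)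
      lengths : length (map w₁ L ++ map w₂ L) ≡ length L ℕ.+ length L
      lengths = ≡.trans (Listₚ.length-++ (map w₁ L)) (cong₂ ℕ._+_ (Listₚ.length-map w₁ L) (Listₚ.length-map w₂ L))

    -- By `circle-squares` at most k of the 2k + 1 slopes give a square. The remaining k + 1 are one
    -- more than the largest degree, k, to which they are applied as roots.
    circle-nonsquares : (∀ y → 1# + y * y ≢ 0#) → suc k ℕ.≤ length (filter (λ y → ¬? (square? (1# + y * y))) (allFin q))
    circle-nonsquares nonzero = ℕₚ.+-cancelˡ-≤ (length L) (suc k) (length N) (ℕₚ.≤-trans (ℕₚ.+-monoˡ-≤ (suc k) L≤k) (ℕₚ.≤-reflexive total))
      where
      L = filter (λ y → square? (1# + y * y)) (allFin q)
      N = filter (λ y → ¬? (square? (1# + y * y))) (allFin q)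
      total : k ℕ.+ suc k ≡ length L ℕ.+ length N
      total = ≡.trans (ℕₚ.+-suc k k) (≡.trans (≡.sym q≡1+2k) (≡.trans (≡.sym (Listₚ.length-tabulate {n = q} (λ x → x)))
                (≡.sym (length-filter-¬ (λ y → square? (1# + y * y)) (allFin q)))))
      L≤k : length L ℕ.≤ k
      L≤k with length L ℕₚ.≤? k
      ... | yes le = le
      ... | no ¬le = contradiction (ℕₚ.≤-trans (s≤s (ℕₚ.+-mono-≤ (ℕₚ.≰⇒≥ ¬le) (ℕₚ.≰⇒> ¬le))) (circle-squares nonzero))
                       (ℕₚ.<⇒≱ (ℕₚ.≤-trans (s≤s (ℕₚ.≤-reflexive q≡1+2k)) (s≤s (ℕₚ.≤-reflexive (≡.sym (ℕₚ.+-suc k k))))))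

-- The case q ≡ 3 mod 4

module Gaussian {q} (𝔾 : FieldOnFin q) where
  open FieldTheory 𝔾
  open Squares 𝔾
  open ≡-Reasoning

  infixl 7 _⊗_
  infixl 6 _⊕_ _⊝_

  K : Set
  K = Fin q × Fin q

  ι : Fin q → K
  ι t = t , 0#

  i : K
  i = 0# , 1#

  -- Opaque, so that terms of K are not compared componentwise.
  opaque
    _⊕_ _⊗_ : K → K → K
    (a , b) ⊕ (c , d) = a + c , b + d
    (a , b) ⊗ (c , d) = a * c - b * d , a * d + b * c

    negᴷ : K → K
    negᴷ (a , b) = - a , - b

  _⊝_ : K → K → K
  u ⊝ v = u ⊕ negᴷ v

  opaque
    unfolding _⊕_

    isCommutativeRing-K : IsCommutativeRing _≡_ _⊕_ _⊗_ negᴷ (ι 0#) (ι 1#)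
    isCommutativeRing-K = record
      { isRing = record
        { +-isAbelianGroup = record
          { isGroup = record
            { isMonoid = record
              { isSemigroup = record
                { isMagma = record { isEquivalence = ≡.isEquivalence ; ∙-cong = cong₂ _⊕_ }
                ; assoc = λ (a , b) (c , d) (e , f) → cong₂ _,_ (+-assoc a c e) (+-assoc b d f) }
              ; identity = (λ (a , b) → cong₂ _,_ (+-identityˡ a) (+-identityˡ b))
                         , (λ (a , b) → cong₂ _,_ (+-identityʳ a) (+-identityʳ b)) }
            ; inverse = (λ (a , b) → cong₂ _,_ (inverseˡ a) (inverseˡ b))
                      , (λ (a , b) → cong₂ _,_ (-‿inverseʳ a) (-‿inverseʳ b))
            ; ⁻¹-cong = cong negᴷ }
          ; comm = λ (a , b) (c , d) → cong₂ _,_ (+-comm a c) (+-comm b d) }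
        ; *-cong = cong₂ _⊗_
        ; *-assoc = λ (a , b) (c , d) (e , f) → cong₂ _,_
            (solve 6 (λ a b c d e f → (a :* c :- b :* d) :* e :- (a :* d :+ b :* c) :* f
                                   := a :* (c :* e :- d :* f) :- b :* (c :* f :+ d :* e)) ≡.refl a b c d e f)
            (solve 6 (λ a b c d e f → (a :* c :- b :* d) :* f :+ (a :* d :+ b :* c) :* e
                                   := a :* (c :* f :+ d :* e) :+ b :* (c :* e :- d :* f)) ≡.refl a b c d e f)
        ; *-identity = (λ (a , b) → cong₂ _,_ (solve 2 (λ a b → :1 :* a :- :0 :* b := a) ≡.refl a b)
                                              (solve 2 (λ a b → :1 :* b :+ :0 :* a := b) ≡.refl a b))
                     , (λ (a , b) → cong₂ _,_ (solve 2 (λ a b → a :* :1 :- b :* :0 := a) ≡.refl a b)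
                                              (solve 2 (λ a b → a :* :0 :+ b :* :1 := b) ≡.refl a b))
        ; distrib = (λ (a , b) (c , d) (e , f) → cong₂ _,_
                      (solve 6 (λ a b c d e f → a :* (c :+ e) :- b :* (d :+ f) := (a :* c :- b :* d) :+ (a :* e :- b :* f)) ≡.refl a b c d e f)
                      (solve 6 (λ a b c d e f → a :* (d :+ f) :+ b :* (c :+ e) := (a :* d :+ b :* c) :+ (a :* f :+ b :* e)) ≡.refl a b c d e f))
                  , (λ (a , b) (c , d) (e , f) → cong₂ _,_
                      (solve 6 (λ a b c d e f → (c :+ e) :* a :- (d :+ f) :* b := (c :* a :- d :* b) :+ (e :* a :- f :* b)) ≡.refl a b c d e f)
                      (solve 6 (λ a b c d e f → (c :+ e) :* b :+ (d :+ f) :* a := (c :* b :+ d :* a) :+ (e :* b :+ f :* a)) ≡.refl a b c d e f)) }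
      ; *-comm = λ (a , b) (c , d) → cong₂ _,_
          (solve 4 (λ a b c d → a :* c :- b :* d := c :* a :- d :* b) ≡.refl a b c d)
          (solve 4 (λ a b c d → a :* d :+ b :* c := c :* b :+ d :* a) ≡.refl a b c d) }
      where
      inverseˡ : ∀ a → - a + a ≡ 0#
      inverseˡ = solve 1 (λ a → :- a :+ a := :0) ≡.refl

    ⊝-components : ∀ z w → z ⊝ w ≡ (proj₁ z - proj₁ w , proj₂ z - proj₂ w)
    ⊝-components z w = ≡.refl

    ⊗-components : ∀ z w → z ⊗ w ≡ (proj₁ z * proj₁ w - proj₂ z * proj₂ w , proj₁ z * proj₂ w + proj₂ z * proj₁ w)
    ⊗-components z w = ≡.refl

    ι-⊗ : ∀ a b → ι a ⊗ ι b ≡ ι (a * b)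
    ι-⊗ a b = cong₂ _,_ (solve 2 (λ a b → a :* b :- :0 :* :0 := a :* b) ≡.refl a b) (solve 2 (λ a b → a :* :0 :+ :0 :* b := :0) ≡.refl a b)

    ι-linear : ∀ a b y → ι a ⊕ ι b ⊗ ι y ≡ ι (a + b * y)
    ι-linear a b y = cong₂ _,_ (solve 3 (λ a b y → a :+ (b :* y :- :0 :* :0) := a :+ b :* y) ≡.refl a b y)
                               (solve 2 (λ b y → :0 :+ (b :* :0 :+ :0 :* y) := :0) ≡.refl b y)

    ι-linear-i : ∀ a b → ι a ⊕ ι b ⊗ i ≡ (a , b)
    ι-linear-i a b = cong₂ _,_ (solve 2 (λ a b → a :+ (b :* :0 :- :0 :* :1) := a) ≡.refl a b)
                               (solve 2 (λ a b → :0 :+ (b :* :1 :+ :0 :* :0) := b) ≡.refl a b)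

  ring-K : CommutativeRing 0ℓ 0ℓ
  ring-K = record { isCommutativeRing = isCommutativeRing-K }

  norm : K → Fin q
  norm (a , b) = a * a + b * b

  norm-⊗ : ∀ z w → norm (z ⊗ w) ≡ norm z * norm w
  norm-⊗ z@(a , b) w@(c , d) = ≡.trans (cong norm (⊗-components z w))
    (solve 4 (λ a b c d → (a :* c :- b :* d) :* (a :* c :- b :* d) :+ (a :* d :+ b :* c) :* (a :* d :+ b :* c)
                       := (a :* a :+ b :* b) :* (c :* c :+ d :* d)) ≡.refl a b c d)

  norm-⊝-comm : ∀ z w → norm (z ⊝ w) ≡ norm (w ⊝ z)
  norm-⊝-comm z@(a , b) w@(c , d) = begin
    norm (z ⊝ w) ≡⟨ cong norm (⊝-components z w) ⟩
    (a - c) * (a - c) + (b - d) * (b - d) ≡⟨ solve 4 (λ a b c d → (a :- c) :* (a :- c) :+ (b :- d) :* (b :- d) := (c :- a) :* (c :- a) :+ (d :- b) :* (d :- b)) ≡.refl a b c d ⟩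
    (c - a) * (c - a) + (d - b) * (d - b) ≡⟨ cong norm (⊝-components w z) ⟨
    norm (w ⊝ z) ∎

-- Sets of q points at integral distances when -1 is not a square

module NonsquareMinusOne (m : ℕ) where

  private
    k n : ℕ
    k = suc (m ℕ.+ m)
    n = k ℕ.+ k

  module _ (𝔾 : FieldOnFin (suc n)) where
    open FieldTheory 𝔾
    open Squares 𝔾
    open Gaussian 𝔾
    private
      module K = CommutativeRing ring-K
      module Kᵣ = RingProperties K.ring
      module KP = PolynomialFunctions ring-K
      module KI = RingIdentities ring-K
      module KE = Exponentiation K.commutativeSemiring
      open KE using () renaming (_^_ to _^ᴷ_)
      open KP using () renaming (esym to e)
    open ≡-Reasoning

    no-i : ∀ t → t * t ≢ - 1#
    no-i = -1-nonsquare k ≡.refl m ≡.refl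

    -- With b ≠ 0, the quotient a / b would be a square root of -1.
    norm≡0 : ∀ z → norm z ≡ 0# → z ≡ ι 0#
    norm≡0 (a , b) eq with b Finₚ.≟ 0#
    ... | no b≢0 = contradiction (begin
      (a / b) * (a / b) ≡⟨ solve 4 (λ a b i u → (a :* i) :* (a :* i) := (a :* a :+ b :* b) :* (i :* i) :- (b :* i) :* (b :* i)) ≡.refl a b (inv b) 0# ⟩
      norm (a , b) * (inv b * inv b) - (b * inv b) * (b * inv b) ≡⟨ cong₂ (λ u v → u * (inv b * inv b) - v * v) eq (x*inv b≢0) ⟩
      0# * (inv b * inv b) - 1# * 1# ≡⟨ solve 1 (λ u → :0 :* u :- :1 :* :1 := :- :1) ≡.refl (inv b * inv b) ⟩
      - 1# ∎) (no-i (a / b))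
    ... | yes ≡.refl with integral a a (≡.trans (solve 1 (λ a → a :* a := a :* a :+ :0 :* :0) ≡.refl a) eq)
    ... | inj₁ ≡.refl = ≡.refl
    ... | inj₂ ≡.refl = ≡.refl

    integral-K : ∀ z w → z ⊗ w ≡ ι 0# → z ≡ ι 0# ⊎ w ≡ ι 0#
    integral-K z w zw≡0 with integral (norm z) (norm w) (begin
      norm z * norm w ≡⟨ norm-⊗ z w ⟨
      norm (z ⊗ w) ≡⟨ cong norm zw≡0 ⟩
      norm (ι 0#) ≡⟨ solve 0 (:0 :* :0 :+ :0 :* :0 := :0) ≡.refl ⟩
      0# ∎)
    ... | inj₁ eq = inj₁ (norm≡0 z eq)
    ... | inj₂ eq = inj₂ (norm≡0 w eq)

    open KP.Roots integral-K

    0≢1-K : ι 0# ≢ ι 1#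
    0≢1-K eq = 0≢1 (cong proj₁ eq)

    invᴷ : K → K
    invᴷ (a , b) = a * inv (a * a + b * b) , - b * inv (a * a + b * b)

    z⊗inv : ∀ {z} → z ≢ ι 0# → z ⊗ invᴷ z ≡ ι 1#
    z⊗inv {z@(a , b)} z≢0 = ≡.trans (⊗-components z (invᴷ z)) (cong₂ _,_
      (≡.trans (solve 3 (λ a b i → a :* (a :* i) :- b :* (:- b :* i) := (a :* a :+ b :* b) :* i) ≡.refl a b (inv (norm z))) (x*inv (z≢0 ∘ norm≡0 z)))
      (solve 3 (λ a b i → a :* (:- b :* i) :+ b :* (a :* i) := :0) ≡.refl a b (inv (norm z))))

    invᴷ≢0 : ∀ {z} → z ≢ ι 0# → invᴷ z ≢ ι 0#
    invᴷ≢0 {z} z≢0 eq = 0≢1-K (≡.trans (≡.sym (K.zeroʳ z)) (≡.trans (cong (z ⊗_) (≡.sym eq)) (z⊗inv z≢0)))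

    ι-^ : ∀ a j → ι a ^ᴷ j ≡ ι (a ^ j)
    ι-^ a zero = ≡.refl
    ι-^ a (suc j) = ≡.trans (cong (ι a ⊗_) (ι-^ a j)) (ι-⊗ a (a ^ j))

    ιnonzeros : List K
    ιnonzeros = map ι nonzeros

    length-ιnonzeros : length ιnonzeros ≡ n
    length-ιnonzeros = ≡.trans (Listₚ.length-map ι nonzeros) (ℕₚ.suc-injective length-nonzeros)

    unique-ιnonzeros : Unique ιnonzeros
    unique-ιnonzeros = Uniqueₚ.map⁺ (cong proj₁) nonzeros-unique

    map-* : ∀ (f : Fin (suc n) → Fin (suc n)) → Injective _≡_ _≡_ f → tabulate f ↭ allFin (suc n)
    map-* f inj = Perm.↭-sym (unique⇒↭ (Uniqueₚ.tabulate⁺ inj) (λ {x} _ → ∈ₚ.∈-allFin x)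
      (ℕₚ.≤-reflexive (≡.trans (Listₚ.length-tabulate {n = suc n} (λ x → x)) (≡.sym (Listₚ.length-tabulate f)))))

    -- Scaling by λ ≠ 0 permutes the field, so λʲ fixes the j-th symmetric function of all its
    -- elements; as not all λ satisfy λʲ = 1, that symmetric function is zero.
    esym-field : ∀ j → suc (suc j) ℕ.≤ n → e (suc j) (map ι (allFin (suc n))) ≡ ι 0#
    esym-field j j<n = begin
      E ≡⟨ KI.x≈x1+0 E ⟩
      E ⊗ ι 1# ⊕ ι 0# ≡⟨ leading≈0 0≢1-K (suc j) (take (suc (suc j)) ιnonzeros) lengths (Uniqueₚ.take⁺ (suc (suc j)) unique-ιnonzeros)
                                (Allₚ.take⁺ (suc (suc j)) (Allₚ.map⁺ (All.tabulate root)))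
                                (KP.poly-+ (suc j) (KP.poly-scale (suc j) E (KP.poly-id^ (suc j))) (KP.poly-const j (negᴷ E))) ⟩
      ι 0# ∎
      where
      F = map ι (allFin (suc n))
      E = e (suc j) F
      lengths : length (take (suc (suc j)) ιnonzeros) ≡ suc (suc j)
      lengths = ≡.trans (Listₚ.length-take (suc (suc j)) ιnonzeros) (≡.trans (cong (suc (suc j) ℕ.⊓_) length-ιnonzeros) (ℕₚ.m≤n⇒m⊓n≡m j<n))
      root : ∀ {t} → t ∈ nonzeros → E ⊗ (ι t ^ᴷ suc j) ⊕ (negᴷ E) ≡ ι 0#
      root {t} t∈ = begin
        E ⊗ (ι t ^ᴷ suc j) ⊕ (negᴷ E) ≡⟨ cong (_⊕ (negᴷ E)) (K.*-comm E _) ⟩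
        (ι t ^ᴷ suc j) ⊗ E ⊕ (negᴷ E) ≡⟨ cong (_⊕ (negᴷ E)) (KP.esym-scale (suc j) (ι t) F) ⟨
        e (suc j) (map (ι t ⊗_) F) ⊕ (negᴷ E) ≡⟨ cong (λ l → e (suc j) l ⊕ (negᴷ E)) maps ⟩
        e (suc j) (map ι (tabulate (t *_))) ⊕ (negᴷ E) ≡⟨ cong (_⊕ (negᴷ E)) (KP.esym-↭ (suc j) (Permₚ.map⁺ ι (map-* (t *_) (*-cancelˡ (∈-nonzeros⁻ t∈))))) ⟩
        E ⊕ (negᴷ E) ≡⟨ K.-‿inverseʳ E ⟩
        ι 0# ∎
        where
        maps : map (ι t ⊗_) F ≡ map ι (tabulate (t *_))
        maps = ≡.trans (≡.sym (Listₚ.map-∘ (allFin (suc n)))) (≡.trans (Listₚ.map-cong (ι-⊗ t) (allFin (suc n)))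
               (≡.trans (Listₚ.map-∘ (allFin (suc n))) (cong (map ι) (Listₚ.map-tabulate (λ x → x) (t *_)))))

    record Clique (pt : Fin (suc n) → K) : Set where
      field
        injective : Injective _≡_ _≡_ pt
        integralDistances : ∀ x y → Square (norm (pt x ⊝ pt y))

    1+y²≢0 : ∀ y → 1# + y * y ≢ 0#
    1+y²≢0 y eq = no-i y (begin
      y * y ≡⟨ solve 1 (λ y → y :* y := (:1 :+ y :* y) :- :1) ≡.refl y ⟩
      (1# + y * y) - 1# ≡⟨ cong (_- 1#) eq ⟩
      0# - 1# ≡⟨ +-identityˡ _ ⟩
      - 1# ∎)

    -- The j-th symmetric function of the values a + b y over the points (a , b) of a clique is a
    -- polynomial in y of degree at most j. For the more than k values of y in the field with
    -- 1 + y² a nonsquare, a + b y runs through the whole field; so the polynomial is zero, and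
    -- can be evaluated at y = i.
    esym-clique : ∀ {pt} → Clique pt → ∀ j → suc j ℕ.≤ k → e (suc j) (tabulate pt) ≡ ι 0#
    esym-clique {pt} clique j j<k = begin
      e (suc j) (tabulate pt) ≡⟨ cong (e (suc j)) at-i ⟨
      S i ≡⟨ tooManyRoots 0≢1-K (suc j) {f = S} (take (suc (suc j)) ys) lengths
                                         (Uniqueₚ.take⁺ (suc (suc j)) (Uniqueₚ.map⁺ (cong proj₁) (Uniqueₚ.filter⁺ N? (Uniqueₚ.allFin⁺ (suc n)))))
                                         (Allₚ.take⁺ (suc (suc j)) (Allₚ.map⁺ (All.tabulate (λ {y} y∈ → root y (proj₂ (∈ₚ.∈-filter⁻ N? {xs = allFin (suc n)} y∈))))))
                                         (proj₂ (KP.esym-poly (suc j) pairs)) i ⟩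
      ι 0# ∎
      where
      open Clique clique
      pair : Fin (suc n) → K × K
      pair x = ι (proj₁ (pt x)) , ι (proj₂ (pt x))
      pairs = tabulate pair
      S : K → K
      S Y = e (suc j) (map (λ p → proj₁ p ⊕ proj₂ p ⊗ Y) pairs)
      at-i : map (λ p → proj₁ p ⊕ proj₂ p ⊗ i) pairs ≡ tabulate pt
      at-i = ≡.trans (Listₚ.map-tabulate pair (λ p → proj₁ p ⊕ proj₂ p ⊗ i)) (Listₚ.tabulate-cong λ x → ι-linear-i (proj₁ (pt x)) (proj₂ (pt x)))
      N? : Decidable (λ y → ¬ Square (1# + y * y))
      N? y = ¬? (square? (1# + y * y))
      ys = map ι (filter N? (allFin (suc n)))
      -- Degree at most j + 1 calls for j + 2 roots; as j + 1 ≤ k, the k + 1 available slopes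
      -- suffice.
      lengths : length (take (suc (suc j)) ys) ≡ suc (suc j)
      lengths = ≡.trans (Listₚ.length-take (suc (suc j)) ys) (ℕₚ.m≤n⇒m⊓n≡m (ℕₚ.≤-trans (s≤s j<k)
        (ℕₚ.≤-trans (circle-nonsquares k ≡.refl 1+y²≢0) (ℕₚ.≤-reflexive (≡.sym (Listₚ.length-map ι (filter N? (allFin (suc n)))))))))
      root : ∀ y → ¬ Square (1# + y * y) → S (ι y) ≡ ι 0#
      root y nonsq = begin
        S (ι y) ≡⟨ cong (e (suc j)) (≡.trans (Listₚ.map-tabulate pair (λ p → proj₁ p ⊕ proj₂ p ⊗ ι y)) (≡.trans (Listₚ.tabulate-cong λ x → ι-linear (proj₁ (pt x)) (proj₂ (pt x)) y) (≡.sym (Listₚ.map-tabulate value ι)))) ⟩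
        e (suc j) (map ι (tabulate value)) ≡⟨ KP.esym-↭ (suc j) (Permₚ.map⁺ ι (map-* value value-injective)) ⟩
        e (suc j) (map ι (allFin (suc n))) ≡⟨ esym-field j (ℕₚ.≤-trans (s≤s j<k) (ℕₚ.≤-trans (ℕₚ.≤-reflexive (≡.sym (ℕₚ.+-comm k 1))) (ℕₚ.+-monoʳ-≤ k (s≤s z≤n)))) ⟩
        ι 0# ∎
        where
        value : Fin (suc n) → Fin (suc n)
        value x = proj₁ (pt x) + proj₂ (pt x) * y
        -- A collision a + b y = c + d y makes the squared distance of the two points equal to (1 +
        -- y²)(d - b)². This is a square while 1 + y² is not, so d = b.
        value-injective : Injective _≡_ _≡_ value
        value-injective {x} {x′} eq with pt x in eqx | pt x′ in eqx′
        ... | a , b | c , d = injective (≡.trans eqx (≡.trans (cong₂ _,_ a≡c b≡d) (≡.sym eqx′)))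
          where
          a-c : a - c ≡ (d - b) * y
          a-c = begin
            a - c ≡⟨ solve 4 (λ a b c y → a :- c := (a :+ b :* y) :- c :- b :* y) ≡.refl a b c y ⟩
            (a + b * y) - c - b * y ≡⟨ cong (λ u → u - c - b * y) eq ⟩
            (c + d * y) - c - b * y ≡⟨ solve 4 (λ b c d y → (c :+ d :* y) :- c :- b :* y := (d :- b) :* y) ≡.refl b c d y ⟩
            (d - b) * y ∎
          square : Square ((1# + y * y) * ((d - b) * (d - b)))
          square = subst Square (begin
            norm (pt x ⊝ pt x′) ≡⟨ cong norm (≡.trans (⊝-components (pt x) (pt x′)) (cong₂ (λ z w → proj₁ z - proj₁ w , proj₂ z - proj₂ w) eqx eqx′)) ⟩
            (a - c) * (a - c) + (b - d) * (b - d) ≡⟨ cong (λ u → u * u + (b - d) * (b - d)) a-c ⟩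
            ((d - b) * y) * ((d - b) * y) + (b - d) * (b - d) ≡⟨ solve 3 (λ b d y → ((d :- b) :* y) :* ((d :- b) :* y) :+ (b :- d) :* (b :- d) := (:1 :+ y :* y) :* ((d :- b) :* (d :- b))) ≡.refl b d y ⟩
            (1# + y * y) * ((d - b) * (d - b)) ∎) (integralDistances x x′)
          d-b≡0 : d - b ≡ 0#
          d-b≡0 with (d - b) Finₚ.≟ 0#
          ... | yes eq0 = eq0
          ... | no neq = contradiction (square-/ (*-nonzero neq neq) (d - b , ≡.refl) square) nonsq
          b≡d : b ≡ d
          b≡d = ≡.sym (x∙y⁻¹≈ε⇒x≈y d b d-b≡0)
          a≡c : a ≡ c
          a≡c = x∙y⁻¹≈ε⇒x≈y a c (≡.trans a-c (≡.trans (cong (_* y) d-b≡0) (zeroˡ y)))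

    -- The nonzero norm of the direction is recorded too: mapping the line to the real line divides
    -- by it.
    clique⇒collinear : ∀ {pt} → Clique pt → norm (pt (Fin.suc Fin.zero) ⊝ pt Fin.zero) ≢ 0# ×
      (∀ x → ∃[ t ] pt x ≡ pt Fin.zero ⊕ ι t ⊗ (pt (Fin.suc Fin.zero) ⊝ pt Fin.zero))
    clique⇒collinear {pt} clique = (δ≢0 Fin.zero ∘ norm≡0 w) , λ where
        Fin.zero → 0# , KI.x≈x+0y (pt Fin.zero) w
        (Fin.suc x) → let t , δx≡ = multiple x in t , (begin
          pt (Fin.suc x) ≡⟨ KI.y≈x+[y-x] (pt Fin.zero) (pt (Fin.suc x)) ⟩
          pt Fin.zero ⊕ δ x ≡⟨ cong (pt Fin.zero ⊕_) δx≡ ⟩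
          pt Fin.zero ⊕ ι t ⊗ w ∎)
      where
      open Clique clique
      δ : Fin n → K
      δ x = pt (Fin.suc x) ⊝ pt Fin.zero
      w = δ Fin.zero
      xs = tabulate δ
      δ≢0 : ∀ x → δ x ≢ ι 0#
      δ≢0 x eq with () ← injective (Kᵣ.x∙y⁻¹≈ε⇒x≈y _ _ eq)
      δ-injective : Injective _≡_ _≡_ δ
      δ-injective eq = Finₚ.suc-injective (injective (Kᵣ.+-cancelʳ (negᴷ (pt Fin.zero)) _ _ eq))
      -0ᴷ : ∀ z → z ⊝ ι 0# ≡ z
      -0ᴷ z = KI.x-0≈x z

      module _ (f : Fin n → K) (f≢0 : ∀ x → f x ≢ ι 0#) (f-injective : Injective _≡_ _≡_ f)
               (squares : ∀ x → Square (norm (f x))) (squares′ : ∀ x y → Square (norm (f x ⊝ f y))) where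

        extend : Fin (suc n) → K
        extend Fin.zero = ι 0#
        extend (Fin.suc x) = f x

        extend-clique : Clique extend
        extend-clique = record { injective = inj ; integralDistances = dist }
          where
          inj : Injective _≡_ _≡_ extend
          inj {Fin.zero} {Fin.zero} _ = ≡.refl
          inj {Fin.zero} {Fin.suc y} eq = contradiction (≡.sym eq) (f≢0 y)
          inj {Fin.suc x} {Fin.zero} eq = contradiction eq (f≢0 x)
          inj {Fin.suc x} {Fin.suc y} eq = cong Fin.suc (f-injective eq)
          dist : ∀ x y → Square (norm (extend x ⊝ extend y))
          dist Fin.zero Fin.zero = 0# , (begin
            norm (ι 0# ⊝ ι 0#) ≡⟨ cong norm (-0ᴷ (ι 0#)) ⟩
            norm (ι 0#) ≡⟨ solve 0 (:0 :* :0 :+ :0 :* :0 := :0 :* :0) ≡.refl ⟩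
            0# * 0# ∎)
          dist Fin.zero (Fin.suc y) = subst Square (≡.trans (cong norm (≡.sym (-0ᴷ (f y)))) (norm-⊝-comm (f y) (ι 0#))) (squares y)
          dist (Fin.suc x) Fin.zero = subst Square (cong norm (≡.sym (-0ᴷ (f x)))) (squares x)
          dist (Fin.suc x) (Fin.suc y) = squares′ x y

        -- A family of q - 1 nonzero values is completed by 0 to a clique of q points, and 0 adds
        -- nothing to a symmetric function. This is applied to the differences `δ` and to their
        -- inverses.
        esym-extend : ∀ j → suc j ℕ.≤ k → e (suc j) (tabulate f) ≡ ι 0#
        esym-extend j j<k = begin
          e (suc j) (tabulate f) ≡⟨ KI.x≈x+0y _ (e j (tabulate f)) ⟩
          e (suc j) (tabulate f) ⊕ ι 0# ⊗ e j (tabulate f) ≡⟨ esym-clique extend-clique j j<k ⟩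
          ι 0# ∎

      δ-squares : ∀ x → Square (norm (δ x))
      δ-squares x = integralDistances (Fin.suc x) Fin.zero
      δ-squares′ : ∀ x y → Square (norm (δ x ⊝ δ y))
      δ-squares′ x y = subst Square (cong norm (KI.-‿translate (pt Fin.zero) (pt (Fin.suc x)) (pt (Fin.suc y))))
                             (integralDistances (Fin.suc x) (Fin.suc y))

      -- 1/x - 1/y = (y - x)/(xy): inversion turns a clique containing 0 into another one.
      invᴷ-norm : ∀ x → norm (invᴷ (δ x)) * norm (δ x) ≡ 1#
      invᴷ-norm x = begin
        norm (invᴷ (δ x)) * norm (δ x) ≡⟨ norm-⊗ (invᴷ (δ x)) (δ x) ⟨
        norm (invᴷ (δ x) ⊗ δ x) ≡⟨ cong norm (≡.trans (K.*-comm (invᴷ (δ x)) (δ x)) (z⊗inv (δ≢0 x))) ⟩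
        norm (ι 1#) ≡⟨ solve 0 (:1 :* :1 :+ :0 :* :0 := :1) ≡.refl ⟩
        1# ∎
      inv-squares : ∀ x → Square (norm (invᴷ (δ x)))
      inv-squares x = square-/ (δ≢0 x ∘ norm≡0 (δ x)) (δ-squares x)
        (1# , ≡.trans (invᴷ-norm x) (≡.sym (*-identityˡ 1#)))
      inv-difference : ∀ x y → (invᴷ (δ x) ⊝ invᴷ (δ y)) ⊗ (δ x ⊗ δ y) ≡ δ y ⊝ δ x
      inv-difference x y = begin
        (invᴷ (δ x) ⊝ invᴷ (δ y)) ⊗ (δ x ⊗ δ y)
          ≡⟨ KI.inverse-difference (δ x) (δ y) (invᴷ (δ x)) (invᴷ (δ y)) ⟩
        (δ x ⊗ invᴷ (δ x)) ⊗ δ y ⊝ (δ y ⊗ invᴷ (δ y)) ⊗ δ x ≡⟨ cong₂ (λ u v → u ⊗ δ y ⊝ v ⊗ δ x) (z⊗inv (δ≢0 x)) (z⊗inv (δ≢0 y)) ⟩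
        ι 1# ⊗ δ y ⊝ ι 1# ⊗ δ x ≡⟨ cong₂ _⊝_ (K.*-identityˡ (δ y)) (K.*-identityˡ (δ x)) ⟩
        δ y ⊝ δ x ∎
      inv-squares′ : ∀ x y → Square (norm (invᴷ (δ x) ⊝ invᴷ (δ y)))
      inv-squares′ x y = square-/ (*-nonzero (δ≢0 x ∘ norm≡0 (δ x)) (δ≢0 y ∘ norm≡0 (δ y))) (square-* (δ-squares x) (δ-squares y))
        (subst Square (begin
          norm (δ y ⊝ δ x) ≡⟨ cong norm (inv-difference x y) ⟨
          norm ((invᴷ (δ x) ⊝ invᴷ (δ y)) ⊗ (δ x ⊗ δ y)) ≡⟨ norm-⊗ _ _ ⟩
          norm (invᴷ (δ x) ⊝ invᴷ (δ y)) * norm (δ x ⊗ δ y) ≡⟨ cong (norm (invᴷ (δ x) ⊝ invᴷ (δ y)) *_) (norm-⊗ (δ x) (δ y)) ⟩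
          norm (invᴷ (δ x) ⊝ invᴷ (δ y)) * (norm (δ x) * norm (δ y)) ∎) (δ-squares′ y x))
      inv-injective : Injective _≡_ _≡_ (λ x → invᴷ (δ x))
      inv-injective {x} {y} eq = δ-injective (≡.sym (Kᵣ.x∙y⁻¹≈ε⇒x≈y (δ y) (δ x) (begin
        δ y ⊝ δ x ≡⟨ inv-difference x y ⟨
        (invᴷ (δ x) ⊝ invᴷ (δ y)) ⊗ (δ x ⊗ δ y) ≡⟨ cong (λ u → (u ⊝ invᴷ (δ y)) ⊗ (δ x ⊗ δ y)) eq ⟩
        (invᴷ (δ y) ⊝ invᴷ (δ y)) ⊗ (δ x ⊗ δ y) ≡⟨ KI.[x-x]y≈0 (invᴷ (δ y)) (δ x ⊗ δ y) ⟩
        ι 0# ∎)))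

      esym-low : ∀ j → suc j ℕ.≤ k → e (suc j) xs ≡ ι 0#
      esym-low = esym-extend δ δ≢0 δ-injective δ-squares δ-squares′

      -- Up to the product of all entries, the function of degree l of the differences is the one of
      -- degree n - l of their inverses, where n - l lies in the low range.
      esym-high : ∀ l j → suc j ℕ.≤ k → l ℕ.+ suc j ≡ n → e l xs ≡ ι 0#
      esym-high l j j<k eq = begin
        e l xs ≡⟨ KP.esym-inverse invᴷ l (suc j) xs (≡.trans eq (≡.sym (Listₚ.length-tabulate δ))) (Allₚ.tabulate⁺ (λ x → z⊗inv (δ≢0 x))) ⟨
        e (suc j) (map invᴷ xs) ⊗ P ≡⟨ cong (λ l → e (suc j) l ⊗ P) (Listₚ.map-tabulate δ invᴷ) ⟩
        e (suc j) (tabulate (λ x → invᴷ (δ x))) ⊗ P ≡⟨ cong (_⊗ P) (esym-extend (λ x → invᴷ (δ x)) (λ x → invᴷ≢0 (δ≢0 x)) inv-injective inv-squares inv-squares′ j j<k) ⟩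
        ι 0# ⊗ P ≡⟨ K.zeroˡ P ⟩
        ι 0# ∎
        where P = foldr _⊗_ (ι 1#) xs

      -- Since n = 2k, a degree strictly between 0 and n is at most k or its complement in n is.
      esym-middle : ∀ l → suc l ℕ.< n → e (suc l) xs ≡ ι 0#
      esym-middle l l<n with suc l ℕₚ.≤? k
      ... | yes le = esym-low l le
      ... | no ¬le with ℕₚ.m≤n⇒∃[o]m+o≡n l<n
      ... | o , eq = esym-high (suc l) o (ℕₚ.+-cancelˡ-≤ k (suc o) k (ℕₚ.≤-trans (ℕₚ.+-monoˡ-≤ (suc o) (ℕₚ.<⇒≤ (ℕₚ.≰⇒> ¬le))) (ℕₚ.≤-reflexive eq′))) eq′
        where
        eq′ : suc l ℕ.+ suc o ≡ n
        eq′ = ≡.trans (ℕₚ.+-suc (suc l) o) eq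

      -- Let zs be the list without δ x. As e_j(xs) = e_j(zs) + δ x · e_(j-1)(zs) vanishes for 0 < j
      -- < n, it follows that e_j(zs) = (- δ x)^j. In degree n the first summand overflows, so
      -- e_n(xs) = δ x · (- δ x)^(n-1), and n is even.
      power-constant : ∀ x → δ x ^ᴷ n ≡ negᴷ (e n xs)
      power-constant x with ∈⇒↭∷ (∈ₚ.∈-tabulate⁺ {f = δ} x)
      ... | zs , xs↭ = begin
        δ x ^ᴷ n ≡⟨ KE.^-homo-* (δ x) k k ⟩
        (δ x ^ᴷ k) ⊗ (δ x ^ᴷ k) ≡⟨ KE.^-distrib-* (δ x) (δ x) k ⟨
        (δ x ⊗ δ x) ^ᴷ k ≡⟨ cong (_^ᴷ k) (KI.xx≈[-x][-x] (δ x)) ⟩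
        ((negᴷ (δ x)) ⊗ (negᴷ (δ x))) ^ᴷ k ≡⟨ KE.^-distrib-* (negᴷ (δ x)) (negᴷ (δ x)) k ⟩
        ((negᴷ (δ x)) ^ᴷ k) ⊗ ((negᴷ (δ x)) ^ᴷ k) ≡⟨ KE.^-homo-* (negᴷ (δ x)) k k ⟨
        (negᴷ (δ x)) ^ᴷ n ≡⟨ KI.[-x]y≈-[0+xy] (δ x) ((negᴷ (δ x)) ^ᴷ n′) ⟩
        negᴷ (ι 0# ⊕ δ x ⊗ ((negᴷ (δ x)) ^ᴷ n′)) ≡⟨ cong negᴷ (cong₂ (λ u v → u ⊕ δ x ⊗ v) (KP.esym-overflow n zs (s≤s (ℕₚ.≤-reflexive length-zs))) (rest n′ ℕₚ.≤-refl)) ⟨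
        negᴷ (e n zs ⊕ δ x ⊗ e n′ zs) ≡⟨ cong negᴷ (KP.esym-↭ n xs↭) ⟨
        negᴷ (e n xs) ∎
        where
        n′ = m ℕ.+ m ℕ.+ k
        length-zs : length zs ≡ n′
        length-zs = ℕₚ.suc-injective (≡.trans (≡.sym (Permₚ.↭-length xs↭)) (Listₚ.length-tabulate δ))
        rest : ∀ j → j ℕ.≤ n′ → e j zs ≡ (negᴷ (δ x)) ^ᴷ j
        rest zero _ = ≡.refl
        rest (suc j) le = begin
          e (suc j) zs ≡⟨ KI.y≈[y+xz]+[-x]z (δ x) (e (suc j) zs) (e j zs) ⟩
          (e (suc j) zs ⊕ δ x ⊗ e j zs) ⊕ (negᴷ (δ x)) ⊗ e j zs ≡⟨ cong (_⊕ (negᴷ (δ x)) ⊗ e j zs) (≡.trans (≡.sym (KP.esym-↭ (suc j) xs↭)) (esym-middle j (s≤s le))) ⟩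
          ι 0# ⊕ (negᴷ (δ x)) ⊗ e j zs ≡⟨ K.+-identityˡ _ ⟩
          (negᴷ (δ x)) ⊗ e j zs ≡⟨ cong ((negᴷ (δ x)) ⊗_) (rest j (ℕₚ.<⇒≤ le)) ⟩
          (negᴷ (δ x)) ⊗ ((negᴷ (δ x)) ^ᴷ j) ∎

      -- The quotient z = δ x / w satisfies z^n = 1 by `power-constant`. The n nonzero elements of
      -- the small field already account for all roots of Y^n - 1 in the integral domain `K`, so z
      -- is one of them.
      multiple : ∀ x → ∃[ t ] δ x ≡ ι t ⊗ w
      multiple x with Finₚ.any? (λ t → z ≟ᴷ ι t)
        where
        z = δ x ⊗ invᴷ w
        _≟ᴷ_ : (u v : K) → Dec (u ≡ v)
        _≟ᴷ_ = Productₚ.≡-dec Finₚ._≟_ Finₚ._≟_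
      ... | yes (t , z≡ιt) = t , (begin
        δ x ≡⟨ K.*-identityʳ (δ x) ⟨
        δ x ⊗ ι 1# ≡⟨ cong (δ x ⊗_) (z⊗inv (δ≢0 Fin.zero)) ⟨
        δ x ⊗ (w ⊗ invᴷ w) ≡⟨ KI.x[yz]≈[xz]y (δ x) w (invᴷ w) ⟩
        (δ x ⊗ invᴷ w) ⊗ w ≡⟨ cong (_⊗ w) z≡ιt ⟩
        ι t ⊗ w ∎)
      ... | no ∄ = contradiction (Allₚ.map⁺ (All.tabulate (λ {t} _ eq → ∄ (t , eq)))) (fromRoots≈0 ιnonzeros product≡0 0≢1-K)
        where
        z = δ x ⊗ invᴷ w
        zⁿ≡1 : z ^ᴷ n ≡ ι 1#
        zⁿ≡1 = begin
          z ^ᴷ n ≡⟨ KE.^-distrib-* (δ x) (invᴷ w) n ⟩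
          (δ x ^ᴷ n) ⊗ (invᴷ w ^ᴷ n) ≡⟨ cong (_⊗ (invᴷ w ^ᴷ n)) (≡.trans (power-constant x) (≡.sym (power-constant Fin.zero))) ⟩
          (w ^ᴷ n) ⊗ (invᴷ w ^ᴷ n) ≡⟨ KE.^-distrib-* w (invᴷ w) n ⟨
          (w ⊗ invᴷ w) ^ᴷ n ≡⟨ cong (_^ᴷ n) (z⊗inv (δ≢0 Fin.zero)) ⟩
          ι 1# ^ᴷ n ≡⟨ ι-^ 1# n ⟩
          ι (1# ^ n) ≡⟨ cong ι (1^ n) ⟩
          ι 1# ∎
        f : K → K
        f Y = (Y ^ᴷ n) ⊕ (negᴷ (ι 1#))
        product≡0 : fromRoots ιnonzeros z ≡ ι 0#
        product≡0 = begin
          fromRoots ιnonzeros z ≡⟨ KI.x≈[1+0]x (fromRoots ιnonzeros z) ⟩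
          (ι 1# ⊕ ι 0#) ⊗ fromRoots ιnonzeros z ≡⟨ poly-factor {a = ι 1# ⊕ ι 0#} {f = f} ιnonzeros unique-ιnonzeros
                                                       (Allₚ.map⁺ (All.tabulate (λ {t} t∈ → ≡.trans (cong (_⊕ (negᴷ (ι 1#))) (≡.trans (ι-^ t n) (cong ι (fermat ≡.refl (∈-nonzeros⁻ t∈))))) (K.-‿inverseʳ (ι 1#)))))
                                                       (subst (λ l → KP.Poly l (ι 1# ⊕ ι 0#) f) (≡.sym length-ιnonzeros) (KP.poly-+ n (KP.poly-id^ n) (KP.poly-const (m ℕ.+ m ℕ.+ k) (negᴷ (ι 1#))))) z ⟨
          f z ≡⟨ cong (_⊕ (negᴷ (ι 1#))) zⁿ≡1 ⟩
          ι 1# ⊕ (negᴷ (ι 1#)) ≡⟨ K.-‿inverseʳ (ι 1#) ⟩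
          ι 0# ∎

-- Counting points on lines

module IntegerSums where
  open import Data.Integer.Base using (_+_; _*_; _-_; -_; _≤_; _<_; +_)
  open MonoidSum ℤₚ.+-0-commutativeMonoid public using () renaming (sum to ∑; sum-cong-≗ to ∑-cong; ∑-distrib-+ to ∑-+; ∑-comm to ∑-swap; sum-permute to ∑-permute)
  open SemiringSum ℤₚ.+-*-semiring public using () renaming (*-distribˡ-sum to *-∑)
  open ℤSolver.+-*-Solver public using (Polynomial; solve; con; _:+_; _:*_; _:-_; :-_; _:=_)
  open ≡-Reasoning

  :0 :1 :2 :3 :4 :6 : ∀ {n} → Polynomial n
  :0 = con (+ 0)
  :1 = con (+ 1)
  :2 = con (+ 2)
  :3 = con (+ 3)
  :4 = con (+ 4)
  :6 = con (+ 6)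

  -- Inequalities are proved by writing b - a as a visibly nonnegative expression.
  ≤-by : ∀ {a b e} → b - a ≡ e → 0ℤ ≤ e → a ≤ b
  ≤-by eq 0≤e = ℤₚ.0≤i-j⇒j≤i (subst (0ℤ ≤_) (≡.sym eq) 0≤e)

  gap : ∀ {a b} → a ≤ b → 0ℤ ≤ b - a
  gap = ℤₚ.i≤j⇒0≤j-i

  infixr 5 _⊞_

  _⊞_ : ∀ {a b} → 0ℤ ≤ a → 0ℤ ≤ b → 0ℤ ≤ a + b
  _⊞_ = ℤₚ.+-mono-≤

  0≤+ : ∀ n → 0ℤ ≤ + n
  0≤+ n = +≤+ z≤n

  nonneg-* : ∀ {a b} → 0ℤ ≤ a → 0ℤ ≤ b → 0ℤ ≤ a * b
  nonneg-* {+ m} {+ n} _ _ = subst (0ℤ ≤_) (ℤₚ.pos-* m n) (+≤+ z≤n)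

  -- The common ending of the counting arguments: all inequalities are added up to one nonnegative
  -- quantity, which a ring identity shows to be at most -1.
  absurd-≤ : ∀ {a e} {A : Set} → a ≡ - (1ℤ + e) → 0ℤ ≤ a → 0ℤ ≤ e → A
  absurd-≤ {e = + n} ≡.refl () _

  ∑-- : ∀ {n} (f g : Fin n → ℤ) → ∑ (λ i → f i - g i) ≡ ∑ f - ∑ g
  ∑-- {zero} f g = ≡.refl
  ∑-- {suc n} f g = ≡.trans (cong (λ s → f Fin.zero - g Fin.zero + s) (∑-- (f ∘ Fin.suc) (g ∘ Fin.suc)))
    (solve 4 (λ a b c d → a :- b :+ (c :- d) := a :+ c :- (b :+ d)) ≡.refl (f Fin.zero) (g Fin.zero) (∑ (f ∘ Fin.suc)) (∑ (g ∘ Fin.suc)))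

  ∑-const : ∀ n c → ∑ {n} (λ _ → c) ≡ + n * c
  ∑-const zero c = ≡.sym (ℤₚ.*-zeroˡ c)
  ∑-const (suc n) c = ≡.trans (cong (λ s → c + s) (∑-const n c)) (≡.sym (≡.trans (cong (_* c) (ℤₚ.pos-+ 1 n)) (solve 2 (λ n c → (:1 :+ n) :* c := c :+ n :* c) ≡.refl (+ n) c)))

  ∑-nonneg : ∀ {n} (f : Fin n → ℤ) → (∀ i → 0ℤ ≤ f i) → 0ℤ ≤ ∑ f
  ∑-nonneg {zero} f 0≤f = ℤₚ.≤-refl
  ∑-nonneg {suc n} f 0≤f = 0≤f Fin.zero ⊞ ∑-nonneg (f ∘ Fin.suc) (0≤f ∘ Fin.suc)

  ∑-mono : ∀ {n} (f g : Fin n → ℤ) → (∀ i → f i ≤ g i) → ∑ f ≤ ∑ g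
  ∑-mono f g f≤g = ≤-by (≡.sym (∑-- g f)) (∑-nonneg (λ i → g i - f i) (λ i → gap (f≤g i)))

  δ : ∀ {n} → Fin n → Fin n → ℤ
  δ x y = if does (x Finₚ.≟ y) then 1ℤ else 0ℤ

  δ-view : ∀ {n} (x y : Fin n) → (x ≡ y × δ x y ≡ 1ℤ) ⊎ (x ≢ y × δ x y ≡ 0ℤ)
  δ-view x y with x Finₚ.≟ y
  ... | yes x≡y = inj₁ (x≡y , ≡.refl)
  ... | no x≢y = inj₂ (x≢y , ≡.refl)

  δ-≡ : ∀ {n} {x y : Fin n} → x ≡ y → δ x y ≡ 1ℤ
  δ-≡ {x = x} {y} x≡y with δ-view x y
  ... | inj₁ (_ , eq) = eq
  ... | inj₂ (x≢y , _) = contradiction x≡y x≢y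

  δ-≢ : ∀ {n} {x y : Fin n} → x ≢ y → δ x y ≡ 0ℤ
  δ-≢ {x = x} {y} x≢y with δ-view x y
  ... | inj₁ (x≡y , _) = contradiction x≡y x≢y
  ... | inj₂ (_ , eq) = eq

  0≤δ : ∀ {n} (x y : Fin n) → 0ℤ ≤ δ x y
  0≤δ x y with δ-view x y
  ... | inj₁ (_ , eq) = subst (0ℤ ≤_) (≡.sym eq) (0≤+ 1)
  ... | inj₂ (_ , eq) = subst (0ℤ ≤_) (≡.sym eq) (0≤+ 0)

  δ≤1 : ∀ {n} (x y : Fin n) → δ x y ≤ 1ℤ
  δ≤1 x y with δ-view x y
  ... | inj₁ (_ , eq) = subst (_≤ 1ℤ) (≡.sym eq) ℤₚ.≤-refl
  ... | inj₂ (_ , eq) = subst (_≤ 1ℤ) (≡.sym eq) (0≤+ 1)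

  ∑-δ : ∀ {n} (y : Fin n) (f : Fin n → ℤ) → ∑ (λ x → δ x y * f x) ≡ f y
  ∑-δ {suc n} Fin.zero f = begin
    1ℤ * f Fin.zero + ∑ (λ x → 0ℤ * f (Fin.suc x)) ≡⟨ cong₂ _+_ (ℤₚ.*-identityˡ (f Fin.zero)) (∑-cong (λ x → ℤₚ.*-zeroˡ (f (Fin.suc x)))) ⟩
    f Fin.zero + ∑ {n} (λ x → 0ℤ) ≡⟨ cong (λ s → f Fin.zero + s) (≡.trans (∑-const n 0ℤ) (ℤₚ.*-zeroʳ (+ n))) ⟩
    f Fin.zero + 0ℤ ≡⟨ ℤₚ.+-identityʳ (f Fin.zero) ⟩
    f Fin.zero ∎
  ∑-δ {suc n} (Fin.suc y) f = begin
    0ℤ * f Fin.zero + ∑ (λ x → δ x y * f (Fin.suc x)) ≡⟨ cong₂ _+_ (ℤₚ.*-zeroˡ (f Fin.zero)) (∑-δ y (f ∘ Fin.suc)) ⟩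
    0ℤ + f (Fin.suc y) ≡⟨ ℤₚ.+-identityˡ _ ⟩
    f (Fin.suc y) ∎

  ∑-δ₁ : ∀ {n} (y : Fin n) → ∑ (λ x → δ x y) ≡ 1ℤ
  ∑-δ₁ y = ≡.trans (∑-cong (λ x → ≡.sym (ℤₚ.*-identityʳ (δ x y)))) (∑-δ y (λ _ → 1ℤ))

  δ-sym : ∀ {n} (x y : Fin n) → δ x y ≡ δ y x
  δ-sym x y with δ-view x y
  ... | inj₁ (eq , d) = ≡.trans d (≡.sym (δ-≡ (≡.sym eq)))
  ... | inj₂ (ne , d) = ≡.trans d (≡.sym (δ-≢ (ne ∘ ≡.sym)))

  term≤∑ : ∀ {n} (f : Fin n → ℤ) → (∀ i → 0ℤ ≤ f i) → ∀ i → f i ≤ ∑ f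
  term≤∑ f 0≤f i = subst (_≤ ∑ f) (∑-δ i f) (∑-mono (λ j → δ j i * f j) f bound)
    where
    bound : ∀ j → δ j i * f j ≤ f j
    bound j = ≤-by (solve 2 (λ d x → x :- d :* x := (:1 :- d) :* x) ≡.refl (δ j i) (f j)) (nonneg-* (gap (δ≤1 j i)) (0≤f j))

  -- Each gap g i - f i is bounded by the sum of all gaps, which is 0. This serves to read off every
  -- term of a sum that attains its trivial bound.
  ∑-equal : ∀ {n} (f g : Fin n → ℤ) → (∀ i → f i ≤ g i) → ∑ f ≡ ∑ g → ∀ i → f i ≡ g i
  ∑-equal f g f≤g ∑f≡∑g i = ℤₚ.≤-antisym (f≤g i)
    (≤-by (solve 2 (λ a b → a :- b := :0 :- (b :- a)) ≡.refl (f i) (g i))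
          (gap (subst (g i - f i ≤_) zero-sum (term≤∑ (λ i → g i - f i) (λ i → gap (f≤g i)) i))))
    where
    zero-sum : ∑ (λ i → g i - f i) ≡ 0ℤ
    zero-sum = ≡.trans (∑-- g f) (≡.trans (cong (λ s → ∑ g - s) ∑f≡∑g) (ℤₚ.+-inverseʳ (∑ g)))

  argmax : ∀ {n} (f : Fin (suc n) → ℤ) → ∃[ i ] (∀ j → f j ≤ f i)
  argmax {zero} f = Fin.zero , λ where Fin.zero → ℤₚ.≤-refl
  argmax {suc n} f with argmax (f ∘ Fin.suc)
  ... | i , max with ℤₚ.≤-total (f Fin.zero) (f (Fin.suc i))
  ... | inj₁ le = Fin.suc i , λ where
    Fin.zero → le
    (Fin.suc j) → max j
  ... | inj₂ ge = Fin.zero , λ where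
    Fin.zero → ℤₚ.≤-refl
    (Fin.suc j) → ℤₚ.≤-trans (max j) ge

module Multiplicity {n : ℕ} where
  open import Data.Integer.Base using (_+_; _*_; _-_; -_; _≤_; _<_; +_)
  open IntegerSums
  open ≡-Reasoning

  N : (Fin (suc n) → Fin (suc n)) → Fin (suc n) → ℤ
  N w x = ∑ (λ b → δ (w b) x)

  0≤N : ∀ w x → 0ℤ ≤ N w x
  0≤N w x = ∑-nonneg (λ b → δ (w b) x) (λ b → 0≤δ (w b) x)

  ∑N : ∀ w → ∑ (N w) ≡ + suc n
  ∑N w = begin
    ∑ (λ x → ∑ (λ b → δ (w b) x)) ≡⟨ ∑-swap (λ x b → δ (w b) x) ⟩
    ∑ (λ b → ∑ (λ x → δ (w b) x)) ≡⟨ ∑-cong (λ b → ≡.trans (∑-cong (δ-sym (w b))) (∑-δ₁ (w b))) ⟩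
    ∑ {suc n} (λ b → 1ℤ) ≡⟨ ∑-const (suc n) 1ℤ ⟩
    + suc n * 1ℤ ≡⟨ ℤₚ.*-identityʳ (+ suc n) ⟩
    + suc n ∎

  ∑-fibres : ∀ w (f : Fin (suc n) → ℤ) → ∑ (λ x → N w x * f x) ≡ ∑ (λ b → f (w b))
  ∑-fibres w f = begin
    ∑ (λ x → N w x * f x) ≡⟨ ∑-cong (λ x → ≡.trans (ℤₚ.*-comm (N w x) (f x)) (*-∑ (f x) (λ b → δ (w b) x))) ⟩
    ∑ (λ x → ∑ (λ b → f x * δ (w b) x)) ≡⟨ ∑-swap (λ x b → f x * δ (w b) x) ⟩
    ∑ (λ b → ∑ (λ x → f x * δ (w b) x)) ≡⟨ ∑-cong (λ b → ≡.trans (∑-cong (λ x → ≡.trans (ℤₚ.*-comm (f x) (δ (w b) x)) (cong (λ d → d * f x) (δ-sym (w b) x)))) (∑-δ (w b) f)) ⟩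
    ∑ (λ b → f (w b)) ∎

  N-injective : ∀ w → (∀ b → N w (w b) ≡ 1ℤ) → Injective _≡_ _≡_ w
  N-injective w N≡1 {b} {b′} wb≡wb′ with b Finₚ.≟ b′
  ... | yes b≡b′ = b≡b′
  ... | no b≢b′ = absurd-≤ {e = 0ℤ} (cong₂ _-_ (≡.trans (cong (N w) (≡.sym wb≡wb′)) (N≡1 b)) two) (gap (∑-mono (λ c → δ c b + δ c b′) (λ c → δ (w c) (w b′)) bound)) ℤₚ.≤-refl
    where
    two : ∑ (λ c → δ c b + δ c b′) ≡ + 2
    two = ≡.trans (∑-+ (λ c → δ c b) (λ c → δ c b′)) (cong₂ _+_ (∑-δ₁ b) (∑-δ₁ b′))
    bound : ∀ c → δ c b + δ c b′ ≤ δ (w c) (w b′)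
    bound c with δ-view c b | δ-view c b′
    ... | inj₁ (c≡b , d) | inj₁ (c≡b′ , d′) = contradiction (≡.trans (≡.sym c≡b) c≡b′) b≢b′
    ... | inj₁ (c≡b , d) | inj₂ (_ , d′) rewrite d | d′ | c≡b = ℤₚ.≤-reflexive (≡.sym (δ-≡ wb≡wb′))
    ... | inj₂ (_ , d) | inj₁ (c≡b′ , d′) rewrite d | d′ | c≡b′ = ℤₚ.≤-reflexive (≡.sym (δ-≡ {x = w b′} ≡.refl))
    ... | inj₂ (_ , d) | inj₂ (_ , d′) rewrite d | d′ = 0≤δ (w c) (w b′)

  N-constant : ∀ w b → N w (w b) ≡ + suc n → ∀ c → w c ≡ w b
  N-constant w b N≡q c with δ-view (w c) (w b)
  ... | inj₁ (eq , _) = eq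
  ... | inj₂ (_ , d) with () ← ≡.trans (≡.sym d) (∑-equal (λ c → δ (w c) (w b)) (λ _ → 1ℤ) (λ c → δ≤1 (w c) (w b))
                                 (≡.trans N≡q (≡.sym (≡.trans (∑-const (suc n) 1ℤ) (ℤₚ.*-identityʳ (+ suc n))))) c)

  -- The nonempty fibres cut the q points into parts of equal size m, so m divides the prime q and
  -- is 1 or q. `hit` is the indicator of the image.
  N-equal : Prime (suc n) → ∀ w (m : ℤ) → (∀ b → N w (w b) ≡ m) → Injective _≡_ _≡_ w ⊎ (∀ b c → w b ≡ w c)
  N-equal q-prime w m N≡m with m in eq
  ... | -[1+ _ ] = contradiction (subst (0ℤ ≤_) (N≡m Fin.zero) (0≤N w (w Fin.zero))) λ ()
  ... | + m′ with prime⇒irreducible q-prime (divides ℤ.∣ ∑ hit ∣ product)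
    where
    hit : Fin (suc n) → ℤ
    hit x with Finₚ.any? (λ b → w b Finₚ.≟ x)
    ... | yes _ = 1ℤ
    ... | no _ = 0ℤ
    N≡ : ∀ x → N w x ≡ + m′ * hit x
    N≡ x with Finₚ.any? (λ b → w b Finₚ.≟ x)
    ... | yes (b , ≡.refl) = ≡.trans (N≡m b) (≡.sym (ℤₚ.*-identityʳ (+ m′)))
    ... | no ∄ = ≡.trans (∑-cong (λ b → δ-≢ (λ eq → ∄ (b , eq)))) (≡.trans (∑-const (suc n) 0ℤ) (≡.trans (ℤₚ.*-zeroʳ (+ suc n)) (≡.sym (ℤₚ.*-zeroʳ (+ m′)))))
    product : suc n ≡ ℤ.∣ ∑ hit ∣ ℕ.* m′
    product = ≡.trans (cong ℤ.∣_∣ (begin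
      + suc n ≡⟨ ∑N w ⟨
      ∑ (N w) ≡⟨ ∑-cong N≡ ⟩
      ∑ (λ x → + m′ * hit x) ≡⟨ *-∑ (+ m′) hit ⟨
      + m′ * ∑ hit ∎)) (≡.trans (ℤₚ.abs-* (+ m′) (∑ hit)) (ℕₚ.*-comm m′ ℤ.∣ ∑ hit ∣))
  ... | inj₁ ≡.refl = inj₁ (N-injective w N≡m)
  ... | inj₂ ≡.refl = inj₂ (λ b c → N-constant w c (N≡m c) b)

-- κ stands for (x , y) ↦ ± χ(x - y), where χ is the quadratic character of a field with
-- q ≡ 1 mod 4 elements. If the character sums R w t are all congruent to c mod q, with
-- 0 < c < q, then R w t = c - q T t with T t ∈ {0,1}, and inversion recovers the
-- multiplicities N w from T.
module Kernel {n : ℕ} (κ : Fin (suc n) → Fin (suc n) → ℤ)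
  (κ-sym : ∀ x y → κ x y ≡ κ y x)
  (κ-diagonal : ∀ x → κ x x ≡ 0ℤ)
  (κ-unit : ∀ x y → x ≢ y → κ x y ≡ 1ℤ ⊎ κ x y ≡ -1ℤ)
  (κ-sum : ∀ y → IntegerSums.∑ (λ x → κ x y) ≡ 0ℤ)
  (κ-correlation : ∀ x y → IntegerSums.∑ (λ t → κ x t ℤ.* κ t y) ≡ ℤ.+ suc n ℤ.* IntegerSums.δ x y ℤ.- 1ℤ)
  where

  open import Data.Integer.Base using (_+_; _*_; _-_; -_; _≤_; _<_; +_)
  open IntegerSums
  open Multiplicity {n}
  open ≡-Reasoning

  private
    q : ℤ
    q = + suc n

  R : (Fin (suc n) → Fin (suc n)) → Fin (suc n) → ℤ
  R w t = ∑ (λ b → κ (w b) t)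

  κ≤1 : ∀ x y → 0ℤ ≤ 1ℤ - κ x y
  κ≤1 x y with x Finₚ.≟ y
  ... | yes ≡.refl rewrite κ-diagonal x = 0≤+ 1
  ... | no x≢y with κ-unit x y x≢y
  ... | inj₁ eq rewrite eq = 0≤+ 0
  ... | inj₂ eq rewrite eq = 0≤+ 2

  -1≤κ : ∀ x y → 0ℤ ≤ 1ℤ + κ x y
  -1≤κ x y with x Finₚ.≟ y
  ... | yes ≡.refl rewrite κ-diagonal x = 0≤+ 1
  ... | no x≢y with κ-unit x y x≢y
  ... | inj₁ eq rewrite eq = 0≤+ 2
  ... | inj₂ eq rewrite eq = 0≤+ 0

  ∑-1 : ∑ {suc n} (λ _ → 1ℤ) ≡ q
  ∑-1 = ≡.trans (∑-const (suc n) 1ℤ) (ℤₚ.*-identityʳ q)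

  R≤q : ∀ w t → 0ℤ ≤ q - R w t
  R≤q w t = subst (0ℤ ≤_) (≡.trans (∑-- (λ _ → 1ℤ) (λ b → κ (w b) t)) (cong (λ s → s - R w t) ∑-1))
              (∑-nonneg (λ b → 1ℤ - κ (w b) t) (λ b → κ≤1 (w b) t))

  -q≤R : ∀ w t → 0ℤ ≤ q + R w t
  -q≤R w t = subst (0ℤ ≤_) (≡.trans (∑-+ (λ _ → 1ℤ) (λ b → κ (w b) t)) (cong (λ s → s + R w t) ∑-1))
              (∑-nonneg (λ b → 1ℤ + κ (w b) t) (λ b → -1≤κ (w b) t))

  -- κ x t + δ x t is 1 or -1 for every x, also on the diagonal, so the sum consists of q odd terms.
  R+N-odd : ∀ w t → ∃[ h ] R w t + N w t ≡ q + + 2 * h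
  R+N-odd w t = ∑ (λ b → half (w b)) , (begin
    R w t + N w t ≡⟨ ∑-+ (λ b → κ (w b) t) (λ b → δ (w b) t) ⟨
    ∑ (λ b → κ (w b) t + δ (w b) t) ≡⟨ ∑-cong (λ b → half-eq (w b)) ⟩
    ∑ (λ b → 1ℤ + + 2 * half (w b)) ≡⟨ ∑-+ (λ _ → 1ℤ) (λ b → + 2 * half (w b)) ⟩
    ∑ {suc n} (λ _ → 1ℤ) + ∑ (λ b → + 2 * half (w b)) ≡⟨ cong₂ _+_ ∑-1 (≡.sym (*-∑ (+ 2) (λ b → half (w b)))) ⟩
    q + + 2 * ∑ (λ b → half (w b)) ∎)
    where
    odd : ∀ x → ∃[ h ] κ x t + δ x t ≡ 1ℤ + + 2 * h
    odd x with δ-view x t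
    ... | inj₁ (≡.refl , d) rewrite d | κ-diagonal x = 0ℤ , ≡.refl
    ... | inj₂ (x≢t , d) rewrite d with κ-unit x t x≢t
    ... | inj₁ eq rewrite eq = 0ℤ , ≡.refl
    ... | inj₂ eq rewrite eq = -1ℤ , ≡.refl
    half : Fin (suc n) → ℤ
    half x = proj₁ (odd x)
    half-eq : ∀ x → κ x t + δ x t ≡ 1ℤ + + 2 * half x
    half-eq x = proj₂ (odd x)

  ∑R : ∀ w → ∑ (R w) ≡ 0ℤ
  ∑R w = begin
    ∑ (λ t → ∑ (λ b → κ (w b) t)) ≡⟨ ∑-swap (λ t b → κ (w b) t) ⟩
    ∑ (λ b → ∑ (λ t → κ (w b) t)) ≡⟨ ∑-cong (λ b → ≡.trans (∑-cong (κ-sym (w b))) (κ-sum (w b))) ⟩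
    ∑ {suc n} (λ b → 0ℤ) ≡⟨ ∑-const (suc n) 0ℤ ⟩
    q * 0ℤ ≡⟨ ℤₚ.*-zeroʳ q ⟩
    0ℤ ∎

  -- In matrix form `κ-correlation` says κ² = q I - J, with J the all-ones matrix. As R is N
  -- multiplied by κ, a second multiplication returns q N minus the total number q of points.
  inversion : ∀ w x → ∑ (λ t → R w t * κ t x) ≡ q * N w x - q
  inversion w x = begin
    ∑ (λ t → R w t * κ t x) ≡⟨ ∑-cong (λ t → ≡.trans (ℤₚ.*-comm (R w t) (κ t x)) (*-∑ (κ t x) (λ b → κ (w b) t))) ⟩
    ∑ (λ t → ∑ (λ b → κ t x * κ (w b) t)) ≡⟨ ∑-swap (λ t b → κ t x * κ (w b) t) ⟩
    ∑ (λ b → ∑ (λ t → κ t x * κ (w b) t)) ≡⟨ ∑-cong (λ b → ≡.trans (∑-cong (λ t → ℤₚ.*-comm (κ t x) (κ (w b) t))) (κ-correlation (w b) x)) ⟩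
    ∑ (λ b → q * δ (w b) x - 1ℤ) ≡⟨ ∑-- (λ b → q * δ (w b) x) (λ _ → 1ℤ) ⟩
    ∑ (λ b → q * δ (w b) x) - ∑ {suc n} (λ _ → 1ℤ) ≡⟨ cong₂ _-_ (≡.sym (*-∑ q (λ b → δ (w b) x))) ∑-1 ⟩
    q * N w x - q ∎

  Residue : (Fin (suc n) → Fin (suc n)) → ℤ → Set
  Residue w c = ∀ t → ∃[ z ] R w t ≡ c + q * z

  -- Since -q ≤ R ≤ q, each quotient z t is -1, 0 or 1, and if it is not 0 the sum is extremal and
  -- all its terms equal z t. Hence R w t * κ t (w b) = q (z t)² for every b, and by `inversion` all
  -- nonempty fibres of w have the same size.
  residue-0 : Prime (suc n) → ∀ w → Residue w 0ℤ → Injective _≡_ _≡_ w ⊎ (∀ b c → w b ≡ w c)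
  residue-0 q-prime w residue = N-equal q-prime w (1ℤ + ∑ (λ t → z t * z t)) λ b →
    ℤₚ.*-cancelˡ-≡ q _ _ (begin
      q * N w (w b) ≡⟨ solve 2 (λ q N → q :* N := q :+ (q :* N :- q)) ≡.refl q (N w (w b)) ⟩
      q + (q * N w (w b) - q) ≡⟨ cong (λ s → q + s) (inversion w (w b)) ⟨
      q + ∑ (λ t → R w t * κ t (w b)) ≡⟨ cong (λ s → q + s) (∑-cong (λ t → term t b)) ⟩
      q + ∑ (λ t → q * (z t * z t)) ≡⟨ cong (λ s → q + s) (*-∑ q (λ t → z t * z t)) ⟨
      q + q * ∑ (λ t → z t * z t) ≡⟨ solve 2 (λ q s → q :+ q :* s := q :* (:1 :+ s)) ≡.refl q (∑ (λ t → z t * z t)) ⟩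
      q * (1ℤ + ∑ (λ t → z t * z t)) ∎)
    where
    z : Fin (suc n) → ℤ
    z t = proj₁ (residue t)
    R≡ : ∀ t → R w t ≡ q * z t
    R≡ t = ≡.trans (proj₂ (residue t)) (ℤₚ.+-identityˡ (q * z t))
    sign : ∀ t b → z t * κ (w b) t ≡ z t * z t
    sign t b with z t | R≡ t
    ... | + 0 | _ = ≡.trans (ℤₚ.*-zeroˡ (κ (w b) t)) ≡.refl
    ... | + 1 | eq = cong (λ s → 1ℤ * s) (∑-equal (λ b → κ (w b) t) (λ _ → 1ℤ) (λ b → ≤-by ≡.refl (κ≤1 (w b) t)) (≡.trans eq (≡.trans (ℤₚ.*-identityʳ q) (≡.sym ∑-1))) b)
    ... | + suc (suc m) | eq = absurd-≤ {e = + n + q * + m} (begin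
      q - R w t ≡⟨ cong (λ r → q - r) eq ⟩
      q - q * + (2 ℕ.+ m) ≡⟨ cong₂ (λ a b → a - a * b) (ℤₚ.pos-+ 1 n) (ℤₚ.pos-+ 2 m) ⟩
      (1ℤ + + n) - (1ℤ + + n) * (+ 2 + + m) ≡⟨ solve 2 (λ n m → (:1 :+ n) :- (:1 :+ n) :* (:2 :+ m) := :- (:1 :+ (n :+ (:1 :+ n) :* m))) ≡.refl (+ n) (+ m) ⟩
      - (1ℤ + (+ n + (1ℤ + + n) * + m)) ≡⟨ cong (λ a → - (1ℤ + (+ n + a * + m))) (ℤₚ.pos-+ 1 n) ⟨
      - (1ℤ + (+ n + q * + m)) ∎) (R≤q w t) (0≤+ n ⊞ nonneg-* (0≤+ (suc n)) (0≤+ m))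
    ... | -[1+ 0 ] | eq = cong (λ s → -1ℤ * s) (≡.sym (∑-equal (λ _ → -1ℤ) (λ b → κ (w b) t) (λ b → ≤-by (solve 1 (λ a → a :- con -1ℤ := :1 :+ a) ≡.refl (κ (w b) t)) (-1≤κ (w b) t)) (≡.trans (∑-const (suc n) -1ℤ) (≡.sym eq)) b))
    ... | -[1+ suc m ] | eq = absurd-≤ {e = + n + q * + m} (begin
      q + R w t ≡⟨ cong (λ r → q + r) eq ⟩
      q + q * - (+ (2 ℕ.+ m)) ≡⟨ cong₂ (λ a b → a + a * - b) (ℤₚ.pos-+ 1 n) (ℤₚ.pos-+ 2 m) ⟩
      (1ℤ + + n) + (1ℤ + + n) * - (+ 2 + + m) ≡⟨ solve 2 (λ n m → (:1 :+ n) :+ (:1 :+ n) :* :- (:2 :+ m) := :- (:1 :+ (n :+ (:1 :+ n) :* m))) ≡.refl (+ n) (+ m) ⟩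
      - (1ℤ + (+ n + (1ℤ + + n) * + m)) ≡⟨ cong (λ a → - (1ℤ + (+ n + a * + m))) (ℤₚ.pos-+ 1 n) ⟨
      - (1ℤ + (+ n + q * + m)) ∎) (-q≤R w t) (0≤+ n ⊞ nonneg-* (0≤+ (suc n)) (0≤+ m))
    term : ∀ t b → R w t * κ t (w b) ≡ q * (z t * z t)
    term t b = begin
      R w t * κ t (w b) ≡⟨ cong₂ _*_ (R≡ t) (κ-sym t (w b)) ⟩
      q * z t * κ (w b) t ≡⟨ ℤₚ.*-assoc q (z t) (κ (w b) t) ⟩
      q * (z t * κ (w b) t) ≡⟨ cong (λ s → q * s) (sign t b) ⟩
      q * (z t * z t) ∎

  module Positive (w : Fin (suc n) → Fin (suc n)) (c : ℤ) (0<c : 0ℤ ≤ c - 1ℤ) (c<q : 0ℤ ≤ (q - c) - 1ℤ) (residue : Residue w c) where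

    T : Fin (suc n) → ℤ
    T t = - proj₁ (residue t)

    R≡ : ∀ t → R w t ≡ c - q * T t
    R≡ t = ≡.trans (proj₂ (residue t)) (solve 3 (λ c q z → c :+ q :* z := c :- q :* :- z) ≡.refl c q (proj₁ (residue t)))

    T-bit : ∀ t → T t ≡ 0ℤ ⊎ T t ≡ 1ℤ
    T-bit t with proj₁ (residue t) | proj₂ (residue t)
    ... | + 0 | _ = inj₁ ≡.refl
    ... | -[1+ 0 ] | _ = inj₂ ≡.refl
    ... | + suc m | eq = absurd-≤ {e = (c - 1ℤ) + q * + m} (begin
      q - R w t ≡⟨ cong (λ r → q - r) eq ⟩
      q - (c + q * + suc m) ≡⟨ cong (λ s → q - (c + q * s)) (ℤₚ.pos-+ 1 m) ⟩
      q - (c + q * (1ℤ + + m)) ≡⟨ solve 3 (λ q c m → q :- (c :+ q :* (:1 :+ m)) := :- (:1 :+ ((c :- :1) :+ q :* m))) ≡.refl q c (+ m) ⟩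
      - (1ℤ + ((c - 1ℤ) + q * + m)) ∎) (R≤q w t) (0<c ⊞ nonneg-* (0≤+ (suc n)) (0≤+ m))
    ... | -[1+ suc m ] | eq = absurd-≤ {e = ((q - c) - 1ℤ) + q * + m} (begin
      q + R w t ≡⟨ cong (λ r → q + r) eq ⟩
      q + (c + q * - (+ (2 ℕ.+ m))) ≡⟨ cong (λ s → q + (c + q * - s)) (ℤₚ.pos-+ 2 m) ⟩
      q + (c + q * - (+ 2 + + m)) ≡⟨ solve 3 (λ q c m → q :+ (c :+ q :* :- (:2 :+ m)) := :- (:1 :+ (((q :- c) :- :1) :+ q :* m))) ≡.refl q c (+ m) ⟩
      - (1ℤ + (((q - c) - 1ℤ) + q * + m)) ∎) (-q≤R w t) (c<q ⊞ nonneg-* (0≤+ (suc n)) (0≤+ m))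

    0≤T : ∀ t → 0ℤ ≤ T t
    0≤T t with T-bit t
    ... | inj₁ eq = subst (0ℤ ≤_) (≡.sym eq) (0≤+ 0)
    ... | inj₂ eq = subst (0ℤ ≤_) (≡.sym eq) (0≤+ 1)

    0≤1-T : ∀ t → 0ℤ ≤ 1ℤ - T t
    0≤1-T t with T-bit t
    ... | inj₁ eq = subst (λ s → 0ℤ ≤ 1ℤ - s) (≡.sym eq) (0≤+ 1)
    ... | inj₂ eq = subst (λ s → 0ℤ ≤ 1ℤ - s) (≡.sym eq) (0≤+ 0)

    ∑T : ∑ T ≡ c
    ∑T = ℤₚ.*-cancelˡ-≡ q _ _ (begin
      q * ∑ T ≡⟨ solve 2 (λ s x → s := x :- (x :- s)) ≡.refl (q * ∑ T) (q * c) ⟩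
      q * c - (q * c - q * ∑ T) ≡⟨ cong (λ s → q * c - s) (begin
        q * c - q * ∑ T ≡⟨ cong₂ _-_ (≡.sym (∑-const (suc n) c)) (*-∑ q T) ⟩
        ∑ {suc n} (λ _ → c) - ∑ (λ t → q * T t) ≡⟨ ∑-- (λ _ → c) (λ t → q * T t) ⟨
        ∑ (λ t → c - q * T t) ≡⟨ ∑-cong R≡ ⟨
        ∑ (R w) ≡⟨ ∑R w ⟩
        0ℤ ∎) ⟩
      q * c - 0ℤ ≡⟨ ℤₚ.+-identityʳ (q * c) ⟩
      q * c ∎)

    N≡ : ∀ x → N w x ≡ 1ℤ - ∑ (λ t → T t * κ t x)
    N≡ x = ℤₚ.*-cancelˡ-≡ q _ _ (begin
      q * N w x ≡⟨ solve 2 (λ q N → q :* N := q :+ (q :* N :- q)) ≡.refl q (N w x) ⟩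
      q + (q * N w x - q) ≡⟨ cong (λ s → q + s) (inversion w x) ⟨
      q + ∑ (λ t → R w t * κ t x) ≡⟨ cong (λ s → q + s) (∑-cong (λ t → ≡.trans (cong (λ r → r * κ t x) (R≡ t))
                                                            (solve 4 (λ c q T k → (c :- q :* T) :* k := c :* k :- q :* (T :* k)) ≡.refl c q (T t) (κ t x)))) ⟩
      q + ∑ (λ t → c * κ t x - q * (T t * κ t x)) ≡⟨ cong (λ s → q + s) (∑-- (λ t → c * κ t x) (λ t → q * (T t * κ t x))) ⟩
      q + (∑ (λ t → c * κ t x) - ∑ (λ t → q * (T t * κ t x))) ≡⟨ cong₂ (λ a b → q + (a - b)) (≡.sym (*-∑ c (λ t → κ t x))) (≡.sym (*-∑ q (λ t → T t * κ t x))) ⟩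
      q + (c * ∑ (λ t → κ t x) - q * S) ≡⟨ cong (λ s → q + (c * s - q * S)) (κ-sum x) ⟩
      q + (c * 0ℤ - q * S) ≡⟨ solve 3 (λ q c S → q :+ (c :* :0 :- q :* S) := q :* (:1 :- S)) ≡.refl q c S ⟩
      q * (1ℤ - S) ∎)
      where S = ∑ (λ t → T t * κ t x)

    -- In `N≡` the bits T sum to c and every κ is at least -1, so - ∑ T κ ≤ c.
    N≤1+c : ∀ x → 0ℤ ≤ (1ℤ + c) - N w x
    N≤1+c x = subst (0ℤ ≤_) (≡.sym (begin
      (1ℤ + c) - N w x ≡⟨ cong (λ s → (1ℤ + c) - s) (N≡ x) ⟩
      (1ℤ + c) - (1ℤ - S) ≡⟨ solve 2 (λ c S → (:1 :+ c) :- (:1 :- S) := c :+ S) ≡.refl c S ⟩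
      c + S ≡⟨ cong (λ s → s + S) ∑T ⟨
      ∑ T + S ≡⟨ ∑-+ T (λ t → T t * κ t x) ⟨
      ∑ (λ t → T t + T t * κ t x) ≡⟨ ∑-cong (λ t → solve 2 (λ T k → T :+ T :* k := T :* (:1 :+ k)) ≡.refl (T t) (κ t x)) ⟩
      ∑ (λ t → T t * (1ℤ + κ t x)) ∎)) (∑-nonneg (λ t → T t * (1ℤ + κ t x)) (λ t → nonneg-* (0≤T t) (-1≤κ t x)))
      where S = ∑ (λ t → T t * κ t x)

    -- As ∑ κ = 0, the complementary bits give ∑ (1 - T) κ = - ∑ T κ; they sum to q - c, and κ ≤ 1.
    N≤1+q-c : ∀ x → 0ℤ ≤ (1ℤ + (q - c)) - N w x
    N≤1+q-c x = subst (0ℤ ≤_) (≡.sym (begin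
      (1ℤ + (q - c)) - N w x ≡⟨ cong (λ s → (1ℤ + (q - c)) - s) (N≡ x) ⟩
      (1ℤ + (q - c)) - (1ℤ - S) ≡⟨ solve 3 (λ q c S → (:1 :+ (q :- c)) :- (:1 :- S) := (q :- c) :- (:0 :- S)) ≡.refl q c S ⟩
      (q - c) - (0ℤ - S) ≡⟨ cong₂ (λ a b → a - b) (cong₂ _-_ ∑-1 ∑T) (cong (λ s → s - S) (κ-sum x)) ⟨
      (∑ {suc n} (λ _ → 1ℤ) - ∑ T) - (∑ (λ t → κ t x) - S) ≡⟨ cong₂ _-_ (∑-- (λ _ → 1ℤ) T) (∑-- (λ t → κ t x) (λ t → T t * κ t x)) ⟨
      ∑ (λ t → 1ℤ - T t) - ∑ (λ t → κ t x - T t * κ t x) ≡⟨ ∑-- (λ t → 1ℤ - T t) (λ t → κ t x - T t * κ t x) ⟨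
      ∑ (λ t → (1ℤ - T t) - (κ t x - T t * κ t x)) ≡⟨ ∑-cong (λ t → solve 2 (λ T k → (:1 :- T) :- (k :- T :* k) := (:1 :- T) :* (:1 :- k)) ≡.refl (T t) (κ t x)) ⟩
      ∑ (λ t → (1ℤ - T t) * (1ℤ - κ t x)) ∎)) (∑-nonneg (λ t → (1ℤ - T t) * (1ℤ - κ t x)) (λ t → nonneg-* (0≤1-T t) (κ≤1 t x)))
      where S = ∑ (λ t → T t * κ t x)

    -- The ordered pairs of distinct points on a common line of this direction. Exchanging the two
    -- summations turns their number into - ∑ T R, and R is c - q wherever T is 1.
    ∑N-1 : ∑ (λ b → N w (w b) - 1ℤ) ≡ c * (q - c)
    ∑N-1 = begin
      ∑ (λ b → N w (w b) - 1ℤ) ≡⟨ ∑-cong (λ b → ≡.trans (cong (λ s → s - 1ℤ) (N≡ (w b))) (solve 1 (λ s → (:1 :- s) :- :1 := :0 :- s) ≡.refl (∑ (λ t → T t * κ t (w b))))) ⟩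
      ∑ (λ b → 0ℤ - ∑ (λ t → T t * κ t (w b))) ≡⟨ ∑-- (λ _ → 0ℤ) (λ b → ∑ (λ t → T t * κ t (w b))) ⟩
      ∑ {suc n} (λ b → 0ℤ) - ∑ (λ b → ∑ (λ t → T t * κ t (w b))) ≡⟨ cong₂ _-_ (≡.trans (∑-const (suc n) 0ℤ) (ℤₚ.*-zeroʳ q)) (begin
        ∑ (λ b → ∑ (λ t → T t * κ t (w b))) ≡⟨ ∑-swap (λ b t → T t * κ t (w b)) ⟩
        ∑ (λ t → ∑ (λ b → T t * κ t (w b))) ≡⟨ ∑-cong (λ t → ≡.trans (≡.sym (*-∑ (T t) (λ b → κ t (w b)))) (cong (λ s → T t * s) (∑-cong (λ b → κ-sym t (w b))))) ⟩
        ∑ (λ t → T t * R w t) ≡⟨ ∑-cong TR ⟩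
        ∑ (λ t → (c - q) * T t) ≡⟨ *-∑ (c - q) T ⟨
        (c - q) * ∑ T ≡⟨ cong (λ s → (c - q) * s) ∑T ⟩
        (c - q) * c ∎) ⟩
      0ℤ - (c - q) * c ≡⟨ solve 2 (λ c q → :0 :- (c :- q) :* c := c :* (q :- c)) ≡.refl c q ⟩
      c * (q - c) ∎
      where
      TR : ∀ t → T t * R w t ≡ (c - q) * T t
      TR t = ≡.trans (cong (λ r → T t * r) (R≡ t)) (case (T-bit t))
        where
        case : T t ≡ 0ℤ ⊎ T t ≡ 1ℤ → T t * (c - q * T t) ≡ (c - q) * T t
        case (inj₁ eq) rewrite eq = solve 2 (λ c q → :0 :* (c :- q :* :0) := (c :- q) :* :0) ≡.refl c q
        case (inj₂ eq) rewrite eq = solve 2 (λ c q → :1 :* (c :- q :* :1) := (c :- q) :* :1) ≡.refl c q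

    -- By `R+N-odd`, T t and c decide the parity of a multiplicity; this later shows that certain
    -- lines cannot be empty.
    parity : ∀ t → ∃[ h ] N w t ≡ q * (1ℤ + T t) - c + + 2 * h
    parity t with R+N-odd w t
    ... | h , eq = h , (begin
      N w t ≡⟨ solve 2 (λ r N → N := (r :+ N) :- r) ≡.refl (R w t) (N w t) ⟩
      (R w t + N w t) - R w t ≡⟨ cong₂ _-_ eq (R≡ t) ⟩
      (q + + 2 * h) - (c - q * T t) ≡⟨ solve 4 (λ q h c T → (q :+ :2 :* h) :- (c :- q :* T) := q :* (:1 :+ T) :- c :+ :2 :* h) ≡.refl q h c (T t) ⟩
      q * (1ℤ + T t) - c + + 2 * h ∎)

even≢odd : ∀ z → ℤ.+ 2 ℤ.* z ≢ 1ℤ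
even≢odd z eq = absurd ℤ.∣ z ∣ (≡.trans (≡.sym (ℤₚ.abs-* (ℤ.+ 2) z)) (cong ℤ.∣_∣ eq))
  where
  absurd : ∀ m → 2 ℕ.* m ≢ 1
  absurd (suc m) eq with () ← ≡.trans (≡.sym (ℕₚ.+-suc m (m ℕ.+ 0))) (ℕₚ.suc-injective eq)

-- The points are cells (u b , v b) of a grid. By `large`, the column and the row of a point, which
-- share that point, carry together at least K + 1 of the 2K + 1 points. `E` marks K + 1 rows that
-- are known to contain a point. The aim is `fullest-large`.
module LargeColumn {n : ℕ} (K : ℤ) (q≡1+2K : ℤ.+ suc n ≡ 1ℤ ℤ.+ (K ℤ.+ K))
  (u v : Fin (suc n) → Fin (suc n))
  (injective : ∀ {a b} → u a ≡ u b → v a ≡ v b → a ≡ b)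
  (large : ∀ a → 0ℤ ℤ.≤ (Multiplicity.N u (u a) ℤ.+ Multiplicity.N v (v a)) ℤ.- (K ℤ.+ ℤ.+ 2))
  (E : Fin (suc n) → ℤ)
  (∑E : IntegerSums.∑ E ≡ K ℤ.+ 1ℤ)
  (E-hit : ∀ t → E t ≡ 0ℤ ⊎ (E t ≡ 1ℤ × ∃[ b ] v b ≡ t))
  where

  open import Data.Integer.Base using (_+_; _*_; _-_; -_; _≤_; _<_; +_)
  open IntegerSums
  open Multiplicity {n}
  open ≡-Reasoning

  private
    q : ℤ
    q = + suc n

  Hit : Fin (suc n) → Fin (suc n) → Set
  Hit x y = ∃[ b ] u b ≡ x × v b ≡ y

  hit? : ∀ x y → Dec (Hit x y)
  hit? x y = Finₚ.any? (λ b → (u b Finₚ.≟ x) ×-dec (v b Finₚ.≟ y))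

  M : Fin (suc n) → Fin (suc n) → ℤ
  M x y = ∑ (λ b → δ (v b) y * δ (u b) x)

  M≥0 : ∀ x y → 0ℤ ≤ M x y
  M≥0 x y = ∑-nonneg (λ b → δ (v b) y * δ (u b) x) (λ b → nonneg-* (0≤δ (v b) y) (0≤δ (u b) x))

  M-hit : ∀ x y → (Hit x y × M x y ≡ 1ℤ) ⊎ (¬ Hit x y × M x y ≡ 0ℤ)
  M-hit x y with hit? x y
  ... | yes (b₀ , ≡.refl , ≡.refl) = inj₁ ((b₀ , ≡.refl , ≡.refl) , ≡.trans (∑-cong term) (∑-δ₁ b₀))
    where
    term : ∀ b → δ (v b) (v b₀) * δ (u b) (u b₀) ≡ δ b b₀
    term b with δ-view (v b) (v b₀) | δ-view (u b) (u b₀)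
    ... | inj₁ (v≡ , d) | inj₁ (u≡ , d′) rewrite d | d′ = ≡.sym (δ-≡ (injective u≡ v≡))
    ... | inj₁ (_ , d) | inj₂ (u≢ , d′) rewrite d | d′ = ≡.sym (δ-≢ (u≢ ∘ cong u))
    ... | inj₂ (v≢ , d) | _ rewrite d = ≡.trans (ℤₚ.*-zeroˡ (δ (u b) (u b₀))) (≡.sym (δ-≢ (v≢ ∘ cong v)))
  ... | no ∄ = inj₂ (∄ , ≡.trans (∑-cong term) (≡.trans (∑-const (suc n) 0ℤ) (ℤₚ.*-zeroʳ q)))
    where
    term : ∀ b → δ (v b) y * δ (u b) x ≡ 0ℤ
    term b with δ-view (v b) y | δ-view (u b) x
    ... | inj₁ (v≡ , d) | inj₁ (u≡ , d′) = contradiction (b , u≡ , v≡) ∄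
    ... | inj₁ (_ , d) | inj₂ (_ , d′) rewrite d | d′ = ≡.refl
    ... | inj₂ (_ , d) | _ rewrite d = ℤₚ.*-zeroˡ (δ (u b) x)

  N≡∑M : ∀ x → N u x ≡ ∑ (M x)
  N≡∑M x = begin
    ∑ (λ b → δ (u b) x) ≡⟨ ∑-cong (λ b → ≡.sym (≡.trans (∑-cong (λ y → cong (λ d → d * δ (u b) x) (δ-sym (v b) y))) (∑-δ (v b) (λ _ → δ (u b) x)))) ⟩
    ∑ (λ b → ∑ (λ y → δ (v b) y * δ (u b) x)) ≡⟨ ∑-swap (λ b y → δ (v b) y * δ (u b) x) ⟩
    ∑ (λ y → ∑ (λ b → δ (v b) y * δ (u b) x)) ∎

  -- The two lines through a carry more than half of the points, and so do those through d.
  rectangle : ∀ a d → u a ≢ u d → v a ≢ v d → ¬ Hit (u a) (v d) → Hit (u d) (v a)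
  rectangle a d ua≢ud va≢vd ∄ with hit? (u d) (v a)
  ... | yes hit = hit
  ... | no ∄′ = absurd-≤ {e = 0ℤ} total (large a ⊞ large d ⊞ gap (∑-mono f g bound)) ℤₚ.≤-refl
    where
    -- `f` counts how many of the two columns and two rows through a and d contain b. If both
    -- opposite corners are empty, only a and d lie on two of them, so the total is at most q + 2 =
    -- 2K + 3, whereas `large` gives at least 2K + 4.
    f g : Fin (suc n) → ℤ
    f b = (δ (u b) (u a) + δ (v b) (v a)) + (δ (u b) (u d) + δ (v b) (v d))
    g b = 1ℤ + (δ b a + δ b d)
    one : ∀ b → 1ℤ ≤ g b
    one b = ≤-by (solve 2 (λ x y → (:1 :+ (x :+ y)) :- :1 := x :+ y) ≡.refl (δ b a) (δ b d)) (0≤δ b a ⊞ 0≤δ b d)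
    bound : ∀ b → f b ≤ g b
    bound b with δ-view (u b) (u a) | δ-view (v b) (v a) | δ-view (u b) (u d) | δ-view (v b) (v d)
    ... | inj₁ (ua , p) | _ | inj₁ (ud , r) | _ = contradiction (≡.trans (≡.sym ua) ud) ua≢ud
    ... | _ | inj₁ (va , p) | _ | inj₁ (vd , r) = contradiction (≡.trans (≡.sym va) vd) va≢vd
    ... | inj₁ (ua , p) | _ | _ | inj₁ (vd , s) = contradiction (b , ua , vd) ∄
    ... | _ | inj₁ (va , p) | inj₁ (ud , s) | _ = contradiction (b , ud , va) ∄′
    ... | inj₁ (ua , p) | inj₁ (va , r) | inj₂ (_ , s) | inj₂ (_ , t) rewrite p | r | s | t | δ-≡ (injective {b} {a} ua va) = two
      where
      two : + 2 ≤ 1ℤ + (1ℤ + δ b d)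
      two = ≤-by (solve 1 (λ x → (:1 :+ (:1 :+ x)) :- :2 := x) ≡.refl (δ b d)) (0≤δ b d)
    ... | inj₂ (_ , p) | inj₂ (_ , r) | inj₁ (ud , s) | inj₁ (vd , t) rewrite p | r | s | t | δ-≡ (injective {b} {d} ud vd) = two
      where
      two : + 2 ≤ 1ℤ + (δ b a + 1ℤ)
      two = ≤-by (solve 1 (λ x → (:1 :+ (x :+ :1)) :- :2 := x) ≡.refl (δ b a)) (0≤δ b a)
    ... | inj₁ (_ , p) | inj₂ (_ , r) | inj₂ (_ , s) | inj₂ (_ , t) rewrite p | r | s | t = one b
    ... | inj₂ (_ , p) | inj₁ (_ , r) | inj₂ (_ , s) | inj₂ (_ , t) rewrite p | r | s | t = one b
    ... | inj₂ (_ , p) | inj₂ (_ , r) | inj₁ (_ , s) | inj₂ (_ , t) rewrite p | r | s | t = one b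
    ... | inj₂ (_ , p) | inj₂ (_ , r) | inj₂ (_ , s) | inj₁ (_ , t) rewrite p | r | s | t = one b
    ... | inj₂ (_ , p) | inj₂ (_ , r) | inj₂ (_ , s) | inj₂ (_ , t) rewrite p | r | s | t = ℤₚ.≤-trans (0≤+ 1) (one b)
    total : ((N u (u a) + N v (v a)) - (K + + 2)) + (((N u (u d) + N v (v d)) - (K + + 2)) + (∑ g - ∑ f)) ≡ - (1ℤ + 0ℤ)
    total = begin
      ((N u (u a) + N v (v a)) - (K + + 2)) + (((N u (u d) + N v (v d)) - (K + + 2)) + (∑ g - ∑ f))
        ≡⟨ cong (λ s → ((N u (u a) + N v (v a)) - (K + + 2)) + (((N u (u d) + N v (v d)) - (K + + 2)) + s)) (cong₂ _-_ ∑g ∑f) ⟩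
      ((N u (u a) + N v (v a)) - (K + + 2)) + (((N u (u d) + N v (v d)) - (K + + 2)) + (((1ℤ + (K + K)) + + 2) - ((N u (u a) + N v (v a)) + (N u (u d) + N v (v d)))))
        ≡⟨ solve 3 (λ x y K → (x :- (K :+ :2)) :+ ((y :- (K :+ :2)) :+ (((:1 :+ (K :+ K)) :+ :2) :- (x :+ y))) := :- (:1 :+ :0)) ≡.refl (N u (u a) + N v (v a)) (N u (u d) + N v (v d)) K ⟩
      - (1ℤ + 0ℤ) ∎
      where
      ∑g : ∑ g ≡ (1ℤ + (K + K)) + + 2
      ∑g = ≡.trans (∑-+ (λ _ → 1ℤ) (λ b → δ b a + δ b d)) (cong₂ _+_ (≡.trans (≡.trans (∑-const (suc n) 1ℤ) (ℤₚ.*-identityʳ q)) q≡1+2K)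
             (≡.trans (∑-+ (λ b → δ b a) (λ b → δ b d)) (cong₂ _+_ (∑-δ₁ a) (∑-δ₁ d))))
      ∑f : ∑ f ≡ (N u (u a) + N v (v a)) + (N u (u d) + N v (v d))
      ∑f = ≡.trans (∑-+ (λ b → δ (u b) (u a) + δ (v b) (v a)) (λ b → δ (u b) (u d) + δ (v b) (v d)))
             (cong₂ _+_ (∑-+ (λ b → δ (u b) (u a)) (λ b → δ (v b) (v a))) (∑-+ (λ b → δ (u b) (u d)) (λ b → δ (v b) (v d))))

  fullest : ∃[ a ] (∀ b → N u (u b) ≤ N u (u a))
  fullest = argmax (λ b → N u (u b))

  -- A fullest column meets every nonempty row: if the row of d missed it, the column of d would
  -- contain all its heights and that of d.
  meets : ∀ d → Hit (u (proj₁ fullest)) (v d)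
  meets d with hit? (u (proj₁ fullest)) (v d)
  ... | yes hit = hit
  ... | no ∄ = absurd-≤ {e = 0ℤ} total (gap (proj₂ fullest d) ⊞ gap (∑-mono f (M (u d)) bound)) ℤₚ.≤-refl
    where
    a = proj₁ fullest
    f : Fin (suc n) → ℤ
    f y = M (u a) y + δ y (v d)
    hit≤ : ∀ {x y z} → z ≤ 1ℤ → Hit x y → z ≤ M x y
    hit≤ {x} {y} z≤1 hit with M-hit x y
    ... | inj₁ (_ , eq) = ℤₚ.≤-trans z≤1 (ℤₚ.≤-reflexive (≡.sym eq))
    ... | inj₂ (∄ , _) = contradiction hit ∄
    bound : ∀ y → f y ≤ M (u d) y
    bound y with δ-view y (v d) | M-hit (u a) y
    ... | inj₁ (≡.refl , _) | inj₁ (hit , _) = contradiction hit ∄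
    ... | inj₁ (≡.refl , p) | inj₂ (_ , r) rewrite p | r = hit≤ ℤₚ.≤-refl (d , ≡.refl , ≡.refl)
    ... | inj₂ (_ , p) | inj₂ (_ , r) rewrite p | r = M≥0 (u d) y
    ... | inj₂ (y≢ , p) | inj₁ ((b , ub≡ , vb≡) , r) rewrite p | r =
      hit≤ ℤₚ.≤-refl (subst (Hit (u d)) vb≡ (rectangle b d
        (λ ub≡ud → ∄ (d , ≡.trans (≡.sym ub≡ud) ub≡ , ≡.refl))
        (λ vb≡vd → y≢ (≡.trans (≡.sym vb≡) vb≡vd))
        (subst (λ x → ¬ Hit x (v d)) (≡.sym ub≡) ∄)))
    total : (N u (u a) - N u (u d)) + (∑ (M (u d)) - ∑ f) ≡ - (1ℤ + 0ℤ)
    total = begin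
      (N u (u a) - N u (u d)) + (∑ (M (u d)) - ∑ f) ≡⟨ cong (λ s → (N u (u a) - N u (u d)) + s) (cong₂ _-_ (≡.sym (N≡∑M (u d))) (≡.trans (∑-+ (M (u a)) (λ y → δ y (v d))) (cong₂ _+_ (≡.sym (N≡∑M (u a))) (∑-δ₁ (v d))))) ⟩
      (N u (u a) - N u (u d)) + (N u (u d) - (N u (u a) + 1ℤ)) ≡⟨ solve 2 (λ x y → (x :- y) :+ (y :- (x :+ :1)) := :- (:1 :+ :0)) ≡.refl (N u (u a)) (N u (u d)) ⟩
      - (1ℤ + 0ℤ) ∎

  -- Each of the K + 1 rows marked by `E` is nonempty, hence by `meets` contains a point of the
  -- fullest column.
  fullest-large : K + 1ℤ ≤ N u (u (proj₁ fullest))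
  fullest-large = subst₂′ ∑E (≡.sym (N≡∑M (u a))) (∑-mono E (M (u a)) bound)
    where
    a = proj₁ fullest
    subst₂′ : ∀ {x x′ y y′} → x ≡ x′ → y ≡ y′ → x ≤ y → x′ ≤ y′
    subst₂′ ≡.refl ≡.refl le = le
    bound : ∀ t → E t ≤ M (u a) t
    bound t with E-hit t
    ... | inj₁ eq rewrite eq = M≥0 (u a) t
    ... | inj₂ (eq , b , ≡.refl) rewrite eq with M-hit (u a) (v b)
    ... | inj₁ (_ , M≡1) = ℤₚ.≤-reflexive (≡.sym M≡1)
    ... | inj₂ (∄ , _) = contradiction (meets b) ∄

module CrossCounting {n : ℕ} (K : ℤ) (q≡1+2K : ℤ.+ suc n ≡ 1ℤ ℤ.+ (K ℤ.+ K)) (3≤k : 0ℤ ℤ.≤ K ℤ.- ℤ.+ 3) where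
  open import Data.Integer.Base using (_+_; _*_; _-_; -_; _≤_; _<_; +_)
  open IntegerSums
  open Multiplicity {n}
  open ≡-Reasoning

  corner≤1 : ∀ (f g : Fin (suc n) → Fin (suc n)) (x y : Fin (suc n)) → (∀ {a b} → g a ≡ g b → f a ≡ f b → a ≡ b) →
             ∑ (λ z → δ (f z) x * δ (g z) y) ≤ 1ℤ
  corner≤1 f g x y inj with Finₚ.any? (λ z → (f z Finₚ.≟ x) ×-dec (g z Finₚ.≟ y))
  ... | yes (z₀ , ≡.refl , ≡.refl) = ℤₚ.≤-trans (∑-mono (λ z → δ (f z) (f z₀) * δ (g z) (g z₀)) (λ z → δ z z₀) bound) (ℤₚ.≤-reflexive (∑-δ₁ z₀))
    where
    bound : ∀ z → δ (f z) (f z₀) * δ (g z) (g z₀) ≤ δ z z₀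
    bound z with δ-view (f z) (f z₀) | δ-view (g z) (g z₀)
    ... | inj₁ (f≡ , p) | inj₁ (g≡ , r) rewrite p | r = ℤₚ.≤-reflexive (≡.sym (δ-≡ (inj g≡ f≡)))
    ... | inj₁ (_ , p) | inj₂ (_ , r) rewrite p | r = 0≤δ z z₀
    ... | inj₂ (_ , p) | _ rewrite p = ℤₚ.≤-trans (ℤₚ.≤-reflexive (ℤₚ.*-zeroˡ (δ (g z) (g z₀)))) (0≤δ z z₀)
  ... | no ∄ = ℤₚ.≤-trans (∑-mono (λ z → δ (f z) x * δ (g z) y) (λ _ → 0ℤ) bound) (ℤₚ.≤-trans (ℤₚ.≤-reflexive (≡.trans (∑-const (suc n) 0ℤ) (ℤₚ.*-zeroʳ (+ suc n)))) (0≤+ 1))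
    where
    bound : ∀ z → δ (f z) x * δ (g z) y ≤ 0ℤ
    bound z with δ-view (f z) x | δ-view (g z) y
    ... | inj₁ (f≡ , p) | inj₁ (g≡ , r) = contradiction (z , f≡ , g≡) ∄
    ... | inj₁ (_ , p) | inj₂ (_ , r) rewrite p | r = ℤₚ.≤-refl
    ... | inj₂ (_ , p) | _ rewrite p = ℤₚ.≤-reflexive (ℤₚ.*-zeroˡ (δ (g z) y))

  -- A line of one kind and a line of the other share at most one point, and K + 1 ≥ 4. The point
  -- found here later fixes the scale and square class of the cross.
  second : ∀ (f g : Fin (suc n) → Fin (suc n)) (a b : Fin (suc n)) → (∀ {a b} → g a ≡ g b → f a ≡ f b → a ≡ b) → K + 1ℤ ≤ N f (f a) → ∃[ z ] f z ≡ f a × g z ≢ g b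
  second f g a b inj N-large with Finₚ.any? (λ z → (f z Finₚ.≟ f a) ×-dec ¬? (g z Finₚ.≟ g b))
  ... | yes found = found
  ... | no ∄ = absurd-≤ {e = + 2} (begin
    (N f (f a) - (K + 1ℤ)) + ((K - + 3) + (∑ h - N f (f a)) + (1ℤ - ∑ h)) ≡⟨ solve 3 (λ N K h → (N :- (K :+ :1)) :+ ((K :- :3) :+ (h :- N) :+ (:1 :- h)) := :- (:1 :+ :2)) ≡.refl (N f (f a)) K (∑ h) ⟩
    - (1ℤ + + 2) ∎) (gap N-large ⊞ (3≤k ⊞ gap (∑-mono (λ z → δ (f z) (f a)) h bound)) ⊞ gap (corner≤1 f g (f a) (g b) inj)) (0≤+ 2)
    where
    h : Fin (suc n) → ℤ
    h z = δ (f z) (f a) * δ (g z) (g b)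
    bound : ∀ z → δ (f z) (f a) ≤ h z
    bound z with δ-view (f z) (f a) | δ-view (g z) (g b)
    ... | inj₁ (_ , p) | inj₁ (_ , r) rewrite p | r = ℤₚ.≤-refl
    ... | inj₁ (f≡ , p) | inj₂ (g≢ , _) = contradiction (z , f≡ , g≢) ∄
    ... | inj₂ (_ , p) | _ rewrite p = ℤₚ.≤-reflexive (≡.sym (ℤₚ.*-zeroˡ (δ (g z) (g b))))

  module _ (u v : Fin (suc n) → Fin (suc n)) (injective : ∀ {a b} → u a ≡ u b → v a ≡ v b → a ≡ b) where

    -- The column and the row have at least 2K + 2 points between them and share at most one, so
    -- they exhaust the 2K + 1 points.
    in-cross : ∀ (a b : Fin (suc n)) → K + 1ℤ ≤ N u (u a) → K + 1ℤ ≤ N v (v b) → ∀ z → u z ≡ u a ⊎ v z ≡ v b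
    in-cross a b u-large v-large z₀ with u z₀ Finₚ.≟ u a | v z₀ Finₚ.≟ v b
    ... | yes u≡ | _ = inj₁ u≡
    ... | no _ | yes v≡ = inj₂ v≡
    ... | no u≢ | no v≢ = absurd-≤ {e = 0ℤ} total (gap u-large ⊞ gap v-large ⊞ gap (corner≤1 u v (u a) (v b) (λ v≡ u≡ → injective u≡ v≡)) ⊞ gap (∑-mono f g bound)) ℤₚ.≤-refl
      where
      corner f g : Fin (suc n) → ℤ
      corner z = δ (u z) (u a) * δ (v z) (v b)
      f z = (δ (u z) (u a) + δ (v z) (v b)) + δ z z₀
      g z = 1ℤ + corner z
      bound : ∀ z → f z ≤ g z
      bound z with δ-view (u z) (u a) | δ-view (v z) (v b) | δ-view z z₀
      ... | inj₁ (u≡ , _) | _ | inj₁ (≡.refl , _) = contradiction u≡ u≢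
      ... | _ | inj₁ (v≡ , _) | inj₁ (≡.refl , _) = contradiction v≡ v≢
      ... | inj₂ (_ , p) | inj₂ (_ , r) | inj₁ (_ , s) rewrite p | r | s = ℤₚ.≤-refl
      ... | inj₁ (_ , p) | inj₁ (_ , r) | inj₂ (_ , s) rewrite p | r | s = ℤₚ.≤-refl
      ... | inj₁ (_ , p) | inj₂ (_ , r) | inj₂ (_ , s) rewrite p | r | s = ℤₚ.≤-refl
      ... | inj₂ (_ , p) | inj₁ (_ , r) | inj₂ (_ , s) rewrite p | r | s = ℤₚ.≤-refl
      ... | inj₂ (_ , p) | inj₂ (_ , r) | inj₂ (_ , s) rewrite p | r | s = 0≤+ 1
      total : (N u (u a) - (K + 1ℤ)) + ((N v (v b) - (K + 1ℤ)) + ((1ℤ - ∑ corner) + (∑ g - ∑ f))) ≡ - (1ℤ + 0ℤ)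
      total = begin
        (N u (u a) - (K + 1ℤ)) + ((N v (v b) - (K + 1ℤ)) + ((1ℤ - ∑ corner) + (∑ g - ∑ f)))
          ≡⟨ cong (λ s → (N u (u a) - (K + 1ℤ)) + ((N v (v b) - (K + 1ℤ)) + ((1ℤ - ∑ corner) + s))) (cong₂ _-_
               (≡.trans (∑-+ (λ _ → 1ℤ) corner) (cong (λ s → s + ∑ corner) (≡.trans (≡.trans (∑-const (suc n) 1ℤ) (ℤₚ.*-identityʳ (+ suc n))) q≡1+2K)))
               (≡.trans (∑-+ (λ z → δ (u z) (u a) + δ (v z) (v b)) (λ z → δ z z₀)) (cong₂ _+_ (∑-+ (λ z → δ (u z) (u a)) (λ z → δ (v z) (v b))) (∑-δ₁ z₀)))) ⟩
        (N u (u a) - (K + 1ℤ)) + ((N v (v b) - (K + 1ℤ)) + ((1ℤ - ∑ corner) + (((1ℤ + (K + K)) + ∑ corner) - ((N u (u a) + N v (v b)) + 1ℤ))))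
          ≡⟨ solve 4 (λ x y K c → (x :- (K :+ :1)) :+ ((y :- (K :+ :1)) :+ ((:1 :- c) :+ (((:1 :+ (K :+ K)) :+ c) :- ((x :+ y) :+ :1)))) := :- (:1 :+ :0)) ≡.refl (N u (u a)) (N v (v b)) K (∑ corner) ⟩
        - (1ℤ + 0ℤ) ∎

distinct-points : ∀ m → 0ℤ ℤ.≤ ℤ.+ (m ℕ.+ m) ℤ.- ℤ.+ 3 →
                  Σ[ a ∈ Fin (suc (m ℕ.+ m ℕ.+ (m ℕ.+ m))) ] Σ[ b ∈ Fin (suc (m ℕ.+ m ℕ.+ (m ℕ.+ m))) ] b ≢ a
distinct-points zero ()
distinct-points (suc m) _ = Fin.zero , Fin.suc Fin.zero , λ ()

-- The net of lines in the k + 2 integral directions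

module Net (k′ : ℕ) where
  private
    k n : ℕ
    k = k′ ℕ.+ k′
    n = k ℕ.+ k

  open import Data.Integer.Base using (_+_; _*_; _-_; -_; _≤_; _<_; +_)
  open IntegerSums
  open Multiplicity {n}
  open ≡-Reasoning

  private
    q K : ℤ
    q = + suc n
    K = + k

    q≡ : q ≡ 1ℤ + (K + K)
    q≡ = ≡.trans (ℤₚ.pos-+ 1 n) (cong (λ s → 1ℤ + s) (ℤₚ.pos-+ k k))

    K≡ : K ≡ + k′ + + k′
    K≡ = ℤₚ.pos-+ k′ k′

  module _
    (q-prime : Prime (suc n)) (3≤k : 0ℤ ≤ K - + 3)
    (κ : Fin (suc n) → Fin (suc n) → ℤ)
    (κ-sym : ∀ x y → κ x y ≡ κ y x)
    (κ-diagonal : ∀ x → κ x x ≡ 0ℤ)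
    (κ-unit : ∀ x y → x ≢ y → κ x y ≡ 1ℤ ⊎ κ x y ≡ -1ℤ)
    (κ-sum : ∀ y → IntegerSums.∑ (λ x → κ x y) ≡ 0ℤ)
    (κ-correlation : ∀ x y → IntegerSums.∑ (λ t → κ x t * κ t y) ≡ + suc n * IntegerSums.δ x y - 1ℤ)
    (u v : Fin (suc n) → Fin (suc n))
    (w : Fin (suc n) → Fin (suc n) → Fin (suc n))
    (σ : Fin (suc n) → ℤ)
    (σ-bit : ∀ y → σ y ≡ 0ℤ ⊎ σ y ≡ 1ℤ)
    (∑σ : IntegerSums.∑ σ ≡ + (k′ ℕ.+ k′))
    (injective : ∀ {a b} → u a ≡ u b → v a ≡ v b → a ≡ b)
    (incidence : ∀ a b → b ≢ a →
      IntegerSums.δ (u b) (u a) + IntegerSums.δ (v b) (v a) + IntegerSums.∑ (λ y → σ y * IntegerSums.δ (w y b) (w y a)) ≡ 1ℤ)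
    where

    open Kernel {n} κ κ-sym κ-diagonal κ-unit κ-sum κ-correlation

    Constant : (Fin (suc n) → Fin (suc n)) → Set
    Constant f = ∀ a b → f a ≡ f b

    constant? : ∀ f → Dec (Constant f)
    constant? f = Finₚ.all? (λ a → Finₚ.all? (λ b → f a Finₚ.≟ f b))

    data Shape : Set where
      vertical : Constant u → Shape
      horizontal : Constant v → Shape
      slanted : ∀ y → σ y ≡ 1ℤ → Constant (w y) → Shape
      cross : ∀ a b → (∀ z → u z ≡ u a ⊎ v z ≡ v b) →
                   (∃[ z ] u z ≡ u a × v z ≢ v b) → (∃[ z ] v z ≡ v b × u z ≢ u a) → Shape

    -- By `residue-0` the points are collinear in a direction or all on different lines of it. If
    -- the latter held for every direction, two points would have no common line, against
    -- `incidence`.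
    trivial-residues : Residue u 0ℤ → Residue v 0ℤ → (∀ y → σ y ≡ 1ℤ → Residue (w y) 0ℤ) → Shape
    trivial-residues residue-u residue-v residue-w with residue-0 q-prime u residue-u | residue-0 q-prime v residue-v
    ... | inj₂ u-constant | _ = vertical u-constant
    ... | inj₁ _ | inj₂ v-constant = horizontal v-constant
    ... | inj₁ u-inj | inj₁ v-inj with Finₚ.any? (λ y → (σ y ℤₚ.≟ 1ℤ) ×-dec constant? (w y))
    ... | yes (y , σ≡1 , w-constant) = slanted y σ≡1 w-constant
    ... | no ∄ = contradiction (≡.trans (≡.sym (incidence a b b≢a)) (cong₂ _+_ (cong₂ _+_ (δ-≢ (b≢a ∘ u-inj)) (δ-≢ (b≢a ∘ v-inj)))
                            (≡.trans (∑-cong term) (≡.trans (∑-const (suc n) 0ℤ) (ℤₚ.*-zeroʳ q))))) λ ()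
      where
      ab = distinct-points k′ 3≤k
      a = proj₁ ab
      b = proj₁ (proj₂ ab)
      b≢a = proj₂ (proj₂ ab)
      term : ∀ y → σ y * δ (w y b) (w y a) ≡ 0ℤ
      term y with σ-bit y
      ... | inj₁ eq rewrite eq = ℤₚ.*-zeroˡ (δ (w y b) (w y a))
      ... | inj₂ eq with residue-0 q-prime (w y) (residue-w y eq)
      ... | inj₁ w-inj = ≡.trans (cong (λ d → σ y * d) (δ-≢ (b≢a ∘ w-inj))) (ℤₚ.*-zeroʳ (σ y))
      ... | inj₂ w-constant = contradiction (y , eq , w-constant) ∄

    -- The lines through a partition the other q - 1 points: this is `incidence` summed over b,
    -- where subtracting `δ b a` removes the term b = a.
    pencil : ∀ a → ((N u (u a) - 1ℤ) + (N v (v a) - 1ℤ)) + ∑ (λ y → σ y * (N (w y) (w y a) - 1ℤ)) ≡ q - 1ℤ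
    pencil a = begin
      ((N u (u a) - 1ℤ) + (N v (v a) - 1ℤ)) + ∑ (λ y → σ y * (N (w y) (w y a) - 1ℤ))
        ≡⟨ cong₂ _+_ (cong₂ _+_ (minus u) (minus v)) (∑-cong (λ y → ≡.trans (cong (λ s → σ y * s) (minus (w y))) (*-∑ (σ y) (λ b → δ (w y b) (w y a) - δ b a)))) ⟩
      (∑ (λ b → δ (u b) (u a) - δ b a) + ∑ (λ b → δ (v b) (v a) - δ b a)) + ∑ (λ y → ∑ (λ b → σ y * (δ (w y b) (w y a) - δ b a)))
        ≡⟨ cong₂ _+_ (≡.sym (∑-+ (λ b → δ (u b) (u a) - δ b a) (λ b → δ (v b) (v a) - δ b a))) (∑-swap (λ y b → σ y * (δ (w y b) (w y a) - δ b a))) ⟩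
      ∑ (λ b → (δ (u b) (u a) - δ b a) + (δ (v b) (v a) - δ b a)) + ∑ (λ b → ∑ (λ y → σ y * (δ (w y b) (w y a) - δ b a)))
        ≡⟨ ∑-+ (λ b → (δ (u b) (u a) - δ b a) + (δ (v b) (v a) - δ b a)) (λ b → ∑ (λ y → σ y * (δ (w y b) (w y a) - δ b a))) ⟨
      ∑ (λ b → ((δ (u b) (u a) - δ b a) + (δ (v b) (v a) - δ b a)) + ∑ (λ y → σ y * (δ (w y b) (w y a) - δ b a)))
        ≡⟨ ∑-cong term ⟩
      ∑ (λ b → 1ℤ - δ b a) ≡⟨ ∑-- (λ _ → 1ℤ) (λ b → δ b a) ⟩
      ∑ {suc n} (λ _ → 1ℤ) - ∑ (λ b → δ b a) ≡⟨ cong₂ _-_ ∑-1 (∑-δ₁ a) ⟩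
      q - 1ℤ ∎
      where
      minus : ∀ f → N f (f a) - 1ℤ ≡ ∑ (λ b → δ (f b) (f a) - δ b a)
      minus f = ≡.trans (cong (λ s → N f (f a) - s) (≡.sym (∑-δ₁ a))) (≡.sym (∑-- (λ b → δ (f b) (f a)) (λ b → δ b a)))
      term : ∀ b → ((δ (u b) (u a) - δ b a) + (δ (v b) (v a) - δ b a)) + ∑ (λ y → σ y * (δ (w y b) (w y a) - δ b a)) ≡ 1ℤ - δ b a
      term b with δ-view b a
      ... | inj₁ (≡.refl , d) rewrite d = cong₂ _+_ (cong₂ _+_ (self u) (self v))
              (≡.trans (∑-cong (λ y → ≡.trans (cong (λ s → σ y * s) (self (w y))) (ℤₚ.*-zeroʳ (σ y)))) (≡.trans (∑-const (suc n) 0ℤ) (ℤₚ.*-zeroʳ q)))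
        where
        self : ∀ f → δ (f b) (f b) - 1ℤ ≡ 0ℤ
        self f = cong (λ s → s - 1ℤ) (δ-≡ {x = f b} ≡.refl)
      ... | inj₂ (b≢a , d) rewrite d = ≡.trans (cong₂ _+_ (cong₂ _+_ (ℤₚ.+-identityʳ (δ (u b) (u a))) (ℤₚ.+-identityʳ (δ (v b) (v a))))
              (∑-cong (λ y → cong (λ s → σ y * s) (ℤₚ.+-identityʳ (δ (w y b) (w y a)))))) (incidence a b b≢a)

    module PositiveResidues (c : ℕ) (c≤k : suc c ℕ.≤ k) (residue-u : Residue u (+ suc c)) (residue-v : Residue v (+ suc c))
      (residue-w : ∀ y → σ y ≡ 1ℤ → Residue (w y) (+ 2 * + suc c)) where

      C : ℤ
      C = + suc c

      0≤K-C : 0ℤ ≤ K - C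
      0≤K-C = gap (+≤+ c≤k)

      C≡ : C ≡ 1ℤ + + c
      C≡ = ℤₚ.pos-+ 1 c

      0<C : 0ℤ ≤ C - 1ℤ
      0<C = subst (0ℤ ≤_) (≡.trans (solve 1 (λ c → c := (:1 :+ c) :- :1) ≡.refl (+ c)) (cong (λ s → s - 1ℤ) (≡.sym C≡))) (0≤+ c)

      C<q : 0ℤ ≤ (q - C) - 1ℤ
      C<q = subst (0ℤ ≤_) (≡.trans (solve 2 (λ K C → K :+ (K :- C) := ((:1 :+ (K :+ K)) :- C) :- :1) ≡.refl K C) (cong (λ s → (s - C) - 1ℤ) (≡.sym q≡)))
              (0≤+ k ⊞ 0≤K-C)

      0<2C : 0ℤ ≤ + 2 * C - 1ℤ
      0<2C = subst (0ℤ ≤_) (solve 1 (λ C → C :+ (C :- :1) := :2 :* C :- :1) ≡.refl C) (0≤+ (suc c) ⊞ 0<C)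

      2C<q : 0ℤ ≤ (q - + 2 * C) - 1ℤ
      2C<q = subst (0ℤ ≤_) (≡.trans (solve 2 (λ K C → (K :- C) :+ (K :- C) := ((:1 :+ (K :+ K)) :- :2 :* C) :- :1) ≡.refl K C) (cong (λ s → (s - + 2 * C) - 1ℤ) (≡.sym q≡)))
              (0≤K-C ⊞ 0≤K-C)

      module U = Positive u C 0<C C<q residue-u
      module V = Positive v C 0<C C<q residue-v
      module W y (σ≡1 : σ y ≡ 1ℤ) = Positive (w y) (+ 2 * C) 0<2C 2C<q (residue-w y σ≡1)

      -- Both sides count ordered pairs of distinct points. On the left they are sorted by
      -- direction, with `∑N-1` applied to residue C for u and v and to residue 2C for each of the k
      -- slopes.
      pencil-total : (C * (q - C) + C * (q - C)) + K * (+ 2 * C * (q - + 2 * C)) ≡ q * (q - 1ℤ)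
      pencil-total = begin
        (C * (q - C) + C * (q - C)) + K * (+ 2 * C * (q - + 2 * C))
          ≡⟨ cong₂ _+_ (cong₂ _+_ U.∑N-1 V.∑N-1) slanted-total ⟨
        (∑ (λ a → N u (u a) - 1ℤ) + ∑ (λ a → N v (v a) - 1ℤ)) + ∑ (λ a → ∑ (λ y → σ y * (N (w y) (w y a) - 1ℤ)))
          ≡⟨ cong (λ s → s + ∑ (λ a → ∑ (λ y → σ y * (N (w y) (w y a) - 1ℤ)))) (∑-+ (λ a → N u (u a) - 1ℤ) (λ a → N v (v a) - 1ℤ)) ⟨
        ∑ (λ a → (N u (u a) - 1ℤ) + (N v (v a) - 1ℤ)) + ∑ (λ a → ∑ (λ y → σ y * (N (w y) (w y a) - 1ℤ)))
          ≡⟨ ∑-+ (λ a → (N u (u a) - 1ℤ) + (N v (v a) - 1ℤ)) (λ a → ∑ (λ y → σ y * (N (w y) (w y a) - 1ℤ))) ⟨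
        ∑ (λ a → ((N u (u a) - 1ℤ) + (N v (v a) - 1ℤ)) + ∑ (λ y → σ y * (N (w y) (w y a) - 1ℤ)))
          ≡⟨ ∑-cong pencil ⟩
        ∑ {suc n} (λ a → q - 1ℤ) ≡⟨ ∑-const (suc n) (q - 1ℤ) ⟩
        q * (q - 1ℤ) ∎
        where
        D = + 2 * C * (q - + 2 * C)
        slanted-term : ∀ y → σ y * ∑ (λ a → N (w y) (w y a) - 1ℤ) ≡ D * σ y
        slanted-term y with σ-bit y
        ... | inj₁ eq rewrite eq = ≡.trans (ℤₚ.*-zeroˡ (∑ (λ a → N (w y) (w y a) - 1ℤ))) (≡.sym (ℤₚ.*-zeroʳ D))
        ... | inj₂ eq = ≡.trans (cong (λ s → σ y * s) (W.∑N-1 y eq)) (ℤₚ.*-comm (σ y) D)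
        slanted-total : ∑ (λ a → ∑ (λ y → σ y * (N (w y) (w y a) - 1ℤ))) ≡ K * D
        slanted-total = begin
          ∑ (λ a → ∑ (λ y → σ y * (N (w y) (w y a) - 1ℤ))) ≡⟨ ∑-swap (λ a y → σ y * (N (w y) (w y a) - 1ℤ)) ⟩
          ∑ (λ y → ∑ (λ a → σ y * (N (w y) (w y a) - 1ℤ))) ≡⟨ ∑-cong (λ y → ≡.trans (≡.sym (*-∑ (σ y) (λ a → N (w y) (w y a) - 1ℤ))) (slanted-term y)) ⟩
          ∑ (λ y → D * σ y) ≡⟨ *-∑ D σ ⟨
          D * ∑ σ ≡⟨ ≡.trans (cong (λ s → D * s) ∑σ) (ℤₚ.*-comm D K) ⟩
          K * D ∎

      -- Substituting q = 2K + 1, the difference of the two sides of `pencil-total` factors as 2q (C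
      -- - 1)(C - K).
      C≡1⊎C≡K : C ≡ 1ℤ ⊎ C ≡ K
      C≡1⊎C≡K = [ (λ 2q≡0 → [ (λ ()) , (λ ()) ]′ (ℤₚ.i*j≡0⇒i≡0∨j≡0 (+ 2) {q} 2q≡0))
                , (λ p≡0 → Sum.map (ℤₚ.i-j≡0⇒i≡j C 1ℤ) (ℤₚ.i-j≡0⇒i≡j C K) (ℤₚ.i*j≡0⇒i≡0∨j≡0 (C - 1ℤ) {C - K} p≡0)) ]′
                (ℤₚ.i*j≡0⇒i≡0∨j≡0 (+ 2 * q) {(C - 1ℤ) * (C - K)} product≡0)
        where
        product≡0 : + 2 * q * ((C - 1ℤ) * (C - K)) ≡ 0ℤ
        product≡0 = begin
          + 2 * q * ((C - 1ℤ) * (C - K)) ≡⟨ cong (λ s → + 2 * s * ((C - 1ℤ) * (C - K))) q≡ ⟩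
          + 2 * (1ℤ + (K + K)) * ((C - 1ℤ) * (C - K))
            ≡⟨ solve 2 (λ K C → :2 :* (:1 :+ (K :+ K)) :* ((C :- :1) :* (C :- K))
                             := (:1 :+ (K :+ K)) :* ((:1 :+ (K :+ K)) :- :1)
                                :- ((C :* ((:1 :+ (K :+ K)) :- C) :+ C :* ((:1 :+ (K :+ K)) :- C)) :+ K :* (:2 :* C :* ((:1 :+ (K :+ K)) :- :2 :* C)))) ≡.refl K C ⟩
          (1ℤ + (K + K)) * ((1ℤ + (K + K)) - 1ℤ) - ((C * ((1ℤ + (K + K)) - C) + C * ((1ℤ + (K + K)) - C)) + K * (+ 2 * C * ((1ℤ + (K + K)) - + 2 * C)))
            ≡⟨ cong (λ s → s * (s - 1ℤ) - ((C * (s - C) + C * (s - C)) + K * (+ 2 * C * (s - + 2 * C)))) q≡ ⟨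
          q * (q - 1ℤ) - ((C * (q - C) + C * (q - C)) + K * (+ 2 * C * (q - + 2 * C))) ≡⟨ cong (λ s → q * (q - 1ℤ) - s) pencil-total ⟩
          q * (q - 1ℤ) - q * (q - 1ℤ) ≡⟨ ℤₚ.+-inverseʳ (q * (q - 1ℤ)) ⟩
          0ℤ ∎

      slope : ∃[ y ] σ y ≡ 1ℤ
      slope with Finₚ.any? (λ y → σ y ℤₚ.≟ 1ℤ)
      ... | yes found = found
      ... | no ∄ = absurd-≤ {e = + 2} (≡.trans (cong (λ s → s - + 3) (≡.trans (≡.sym ∑σ) (≡.trans (∑-cong zero-σ) (≡.trans (∑-const (suc n) 0ℤ) (ℤₚ.*-zeroʳ q))))) ≡.refl) 3≤k (0≤+ 2)
        where
        zero-σ : ∀ y → σ y ≡ 0ℤ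
        zero-σ y with σ-bit y
        ... | inj₁ eq = eq
        ... | inj₂ eq = contradiction (y , eq) ∄

      -- For a slope y the residue is 2, so the multiplicities N x lie in {0,…,3} and are odd with at
      -- most two exceptions: their variance is too small for the value prescribed by ∑N-1.
      C≢1 : C ≢ 1ℤ
      C≢1 C≡1 = absurd-≤ {e = + 4 * (K - + 3) + + 3} total (∑-nonneg f 0≤f) (nonneg-* (0≤+ 4) 3≤k ⊞ 0≤+ 3)
        where
        y = proj₁ slope
        module P = W y (proj₂ slope)
        m : Fin (suc n) → ℤ
        m = N (w y)
        -- The product (1 - m)(3 - m) vanishes at the odd values 1 and 3, and its maximum over 0 ≤ m
        -- ≤ 3 is 3; so `f` is nonnegative in all cases. Its sum, however, is 10 - 2q.
        f : Fin (suc n) → ℤ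
        f x = + 3 * P.T x - (1ℤ - m x) * (+ 3 - m x)
        2C≡2 : + 2 * C ≡ + 2
        2C≡2 = cong (λ s → + 2 * s) C≡1
        cases : ∀ a t → (t ≡ 0ℤ ⊎ t ≡ 1ℤ) → 0ℤ ≤ a → 0ℤ ≤ + 3 - a → ∃[ h ] a ≡ q * (1ℤ + t) - + 2 + + 2 * h →
                0ℤ ≤ + 3 * t - (1ℤ - a) * (+ 3 - a)
        cases (+ 0) t (inj₁ ≡.refl) _ _ (h , eq) = contradiction (begin
          + 2 * (1ℤ - (K + h)) ≡⟨ solve 2 (λ K h → :2 :* (:1 :- (K :+ h)) := :1 :- ((:1 :+ (K :+ K)) :* (:1 :+ :0) :- :2 :+ :2 :* h)) ≡.refl K h ⟩
          1ℤ - ((1ℤ + (K + K)) * (1ℤ + 0ℤ) - + 2 + + 2 * h) ≡⟨ cong (λ s → 1ℤ - (s * (1ℤ + 0ℤ) - + 2 + + 2 * h)) q≡ ⟨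
          1ℤ - (q * (1ℤ + 0ℤ) - + 2 + + 2 * h) ≡⟨ cong (λ s → 1ℤ - s) eq ⟨
          1ℤ ∎) (even≢odd (1ℤ - (K + h)))
        cases (+ 1) t (inj₁ ≡.refl) _ _ _ = 0≤+ 0
        cases (+ 2) t (inj₁ ≡.refl) _ _ (h , eq) = contradiction (begin
          + 2 * (+ 2 - (K + h)) ≡⟨ solve 2 (λ K h → :2 :* (:2 :- (K :+ h)) := :3 :- ((:1 :+ (K :+ K)) :* (:1 :+ :0) :- :2 :+ :2 :* h)) ≡.refl K h ⟩
          + 3 - ((1ℤ + (K + K)) * (1ℤ + 0ℤ) - + 2 + + 2 * h) ≡⟨ cong (λ s → + 3 - (s * (1ℤ + 0ℤ) - + 2 + + 2 * h)) q≡ ⟨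
          + 3 - (q * (1ℤ + 0ℤ) - + 2 + + 2 * h) ≡⟨ cong (λ s → + 3 - s) eq ⟨
          1ℤ ∎) (even≢odd (+ 2 - (K + h)))
        cases (+ 3) t (inj₁ ≡.refl) _ _ _ = 0≤+ 0
        cases (+ 0) t (inj₂ ≡.refl) _ _ _ = 0≤+ 0
        cases (+ 1) t (inj₂ ≡.refl) _ _ _ = 0≤+ 3
        cases (+ 2) t (inj₂ ≡.refl) _ _ _ = 0≤+ 4
        cases (+ 3) t (inj₂ ≡.refl) _ _ _ = 0≤+ 3
        cases (+ suc (suc (suc (suc a)))) t _ _ () _
        0≤f : ∀ x → 0ℤ ≤ f x
        0≤f x = cases (m x) (P.T x) (P.T-bit x) (0≤N (w y) x)
          (subst (λ s → 0ℤ ≤ (1ℤ + s) - m x) 2C≡2 (P.N≤1+c x))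
          (subst (λ s → ∃[ h ] m x ≡ q * (1ℤ + P.T x) - s + + 2 * h) 2C≡2 (P.parity x))
        ∑m² : ∑ (λ x → m x * m x) ≡ q + + 2 * (q - + 2)
        ∑m² = begin
          ∑ (λ x → m x * m x) ≡⟨ ∑-fibres (w y) m ⟩
          ∑ (λ b → m (w y b)) ≡⟨ ∑-cong (λ b → solve 1 (λ x → x := :1 :+ (x :- :1)) ≡.refl (m (w y b))) ⟩
          ∑ (λ b → 1ℤ + (m (w y b) - 1ℤ)) ≡⟨ ∑-+ (λ _ → 1ℤ) (λ b → m (w y b) - 1ℤ) ⟩
          ∑ {suc n} (λ _ → 1ℤ) + ∑ (λ b → m (w y b) - 1ℤ) ≡⟨ cong₂ _+_ ∑-1 (≡.trans P.∑N-1 (cong (λ s → s * (q - s)) 2C≡2)) ⟩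
          q + + 2 * (q - + 2) ∎
        total : ∑ f ≡ - (1ℤ + (+ 4 * (K - + 3) + + 3))
        total = begin
          ∑ f ≡⟨ ∑-cong (λ x → solve 2 (λ t a → :3 :* t :- (:1 :- a) :* (:3 :- a) := (:3 :* t :+ :4 :* a) :- (a :* a :+ :3)) ≡.refl (P.T x) (m x)) ⟩
          ∑ (λ x → (+ 3 * P.T x + + 4 * m x) - (m x * m x + + 3)) ≡⟨ ∑-- (λ x → + 3 * P.T x + + 4 * m x) (λ x → m x * m x + + 3) ⟩
          ∑ (λ x → + 3 * P.T x + + 4 * m x) - ∑ (λ x → m x * m x + + 3) ≡⟨ cong₂ _-_ (∑-+ (λ x → + 3 * P.T x) (λ x → + 4 * m x)) (∑-+ (λ x → m x * m x) (λ _ → + 3)) ⟩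
          (∑ (λ x → + 3 * P.T x) + ∑ (λ x → + 4 * m x)) - (∑ (λ x → m x * m x) + ∑ {suc n} (λ _ → + 3))
            ≡⟨ cong₂ _-_ (cong₂ _+_ (≡.trans (≡.sym (*-∑ (+ 3) P.T)) (cong (λ s → + 3 * s) (≡.trans P.∑T 2C≡2))) (≡.trans (≡.sym (*-∑ (+ 4) m)) (cong (λ s → + 4 * s) (∑N (w y)))))
                         (cong₂ _+_ ∑m² (∑-const (suc n) (+ 3))) ⟩
          (+ 6 + + 4 * q) - ((q + + 2 * (q - + 2)) + q * + 3) ≡⟨ cong (λ q → (+ 6 + + 4 * q) - ((q + + 2 * (q - + 2)) + q * + 3)) q≡ ⟩
          (+ 6 + + 4 * (1ℤ + (K + K))) - (((1ℤ + (K + K)) + + 2 * ((1ℤ + (K + K)) - + 2)) + (1ℤ + (K + K)) * + 3)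
            ≡⟨ solve 1 (λ K → (:6 :+ :4 :* (:1 :+ (K :+ K))) :- (((:1 :+ (K :+ K)) :+ :2 :* ((:1 :+ (K :+ K)) :- :2)) :+ (:1 :+ (K :+ K)) :* :3)
                         := :- (:1 :+ (:4 :* (K :- :3) :+ :3))) ≡.refl K ⟩
          - (1ℤ + (+ 4 * (K - + 3) + + 3)) ∎

      module _ (C≡K : C ≡ K) where

        -- For C = K a slanted line has at most 1 + (q - 2K) = 2 points. The k slanted lines through
        -- a therefore contain at most K of the other 2K points, and the column and row of a contain
        -- the remaining K or more.
        large : ∀ a → 0ℤ ≤ (N u (u a) + N v (v a)) - (K + + 2)
        large a = subst (0ℤ ≤_) total (gap (∑-mono f σ bound))
          where
          f : Fin (suc n) → ℤ
          f y = σ y * (N (w y) (w y a) - 1ℤ)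
          bound : ∀ y → f y ≤ σ y
          bound y with σ-bit y
          ... | inj₁ eq rewrite eq = ℤₚ.≤-reflexive (ℤₚ.*-zeroˡ (N (w y) (w y a) - 1ℤ))
          ... | inj₂ eq = ≤-by (≡.trans (cong (λ s → s - s * (N (w y) (w y a) - 1ℤ)) eq) (begin
            1ℤ - 1ℤ * (N (w y) (w y a) - 1ℤ) ≡⟨ solve 2 (λ N K → :1 :- :1 :* (N :- :1) := (:1 :+ ((:1 :+ (K :+ K)) :- :2 :* K)) :- N) ≡.refl (N (w y) (w y a)) K ⟩
            (1ℤ + ((1ℤ + (K + K)) - + 2 * K)) - N (w y) (w y a) ≡⟨ cong₂ (λ s C → (1ℤ + (s - + 2 * C)) - N (w y) (w y a)) q≡ C≡K ⟨
            (1ℤ + (q - + 2 * C)) - N (w y) (w y a) ∎)) (W.N≤1+q-c y eq (w y a))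
          total : ∑ σ - ∑ f ≡ (N u (u a) + N v (v a)) - (K + + 2)
          total = begin
            ∑ σ - ∑ f ≡⟨ solve 3 (λ s x f → s :- f := s :+ x :- (x :+ f)) ≡.refl (∑ σ) ((N u (u a) - 1ℤ) + (N v (v a) - 1ℤ)) (∑ f) ⟩
            ∑ σ + ((N u (u a) - 1ℤ) + (N v (v a) - 1ℤ)) - (((N u (u a) - 1ℤ) + (N v (v a) - 1ℤ)) + ∑ f) ≡⟨ cong₂ (λ s x → s + ((N u (u a) - 1ℤ) + (N v (v a) - 1ℤ)) - x) ∑σ (≡.trans (pencil a) (cong (λ s → s - 1ℤ) q≡)) ⟩
            K + ((N u (u a) - 1ℤ) + (N v (v a) - 1ℤ)) - ((1ℤ + (K + K)) - 1ℤ) ≡⟨ solve 3 (λ x y K → K :+ ((x :- :1) :+ (y :- :1)) :- ((:1 :+ (K :+ K)) :- :1) := (x :+ y) :- (K :+ :2)) ≡.refl (N u (u a)) (N v (v a)) K ⟩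
            (N u (u a) + N v (v a)) - (K + + 2) ∎

        module Occupied (f : Fin (suc n) → Fin (suc n)) (residue : Residue f C) where
          open Positive f C 0<C C<q residue

          E : Fin (suc n) → ℤ
          E t = 1ℤ - T t

          ∑E : ∑ E ≡ K + 1ℤ
          ∑E = begin
            ∑ E ≡⟨ ∑-- (λ _ → 1ℤ) T ⟩
            ∑ {suc n} (λ _ → 1ℤ) - ∑ T ≡⟨ cong₂ _-_ (≡.trans ∑-1 q≡) (≡.trans ∑T C≡K) ⟩
            (1ℤ + (K + K)) - K ≡⟨ solve 1 (λ K → (:1 :+ (K :+ K)) :- K := K :+ :1) ≡.refl K ⟩
            K + 1ℤ ∎

          -- Here C = K = 2k′ is even and q is odd, so by `parity` a value t with T t = 0 has odd
          -- multiplicity and is attained. This is a second use of q ≡ 1 mod 4, besides the symmetry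
          -- of `κ`.
          hit : ∀ t → E t ≡ 0ℤ ⊎ (E t ≡ 1ℤ × ∃[ b ] f b ≡ t)
          hit t with T-bit t
          ... | inj₂ eq = inj₁ (cong (λ s → 1ℤ - s) eq)
          ... | inj₁ eq with Finₚ.any? (λ b → f b Finₚ.≟ t)
          ... | yes found = inj₂ (cong (λ s → 1ℤ - s) eq , found)
          ... | no ∄ with parity t
          ... | h , N≡q = contradiction (begin
            + 2 * - (+ k′ + h) ≡⟨ solve 2 (λ K h → :2 :* :- (K :+ h) := :1 :- ((:1 :+ ((K :+ K) :+ (K :+ K))) :* (:1 :+ :0) :- (K :+ K) :+ :2 :* h)) ≡.refl (+ k′) h ⟩
            1ℤ - ((1ℤ + ((+ k′ + + k′) + (+ k′ + + k′))) * (1ℤ + 0ℤ) - (+ k′ + + k′) + + 2 * h) ≡⟨ cong (λ K → 1ℤ - ((1ℤ + (K + K)) * (1ℤ + 0ℤ) - K + + 2 * h)) K≡ ⟨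
            1ℤ - ((1ℤ + (K + K)) * (1ℤ + 0ℤ) - K + + 2 * h) ≡⟨ cong₂ (λ q C → 1ℤ - (q * (1ℤ + 0ℤ) - C + + 2 * h)) q≡ C≡K ⟨
            1ℤ - (q * (1ℤ + 0ℤ) - C + + 2 * h) ≡⟨ cong (λ T → 1ℤ - (q * (1ℤ + T) - C + + 2 * h)) eq ⟨
            1ℤ - (q * (1ℤ + T t) - C + + 2 * h) ≡⟨ cong (λ s → 1ℤ - s) N≡q ⟨
            1ℤ - N f t ≡⟨ cong (λ s → 1ℤ - s) (≡.trans (∑-cong (λ b → δ-≢ (λ fb≡t → ∄ (b , fb≡t)))) (≡.trans (∑-const (suc n) 0ℤ) (ℤₚ.*-zeroʳ q))) ⟩
            1ℤ ∎) (even≢odd (- (+ k′ + h)))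

        private
          module OU = Occupied u residue-u
          module OV = Occupied v residue-v
          -- The nonempty rows needed for the fullest column come from the bits of v; for the
          -- fullest row the roles are exchanged.
          module CU = LargeColumn K q≡ u v injective large OV.E OV.∑E OV.hit
          module CV = LargeColumn K q≡ v u (λ v≡ u≡ → injective u≡ v≡) (λ a → subst (λ s → 0ℤ ≤ s - (K + + 2)) (ℤₚ.+-comm (N u (u a)) (N v (v a))) (large a)) OU.E OU.∑E OU.hit

        cross-shape : Shape
        cross-shape = cross a b (CrossCounting.in-cross K q≡ 3≤k u v injective a b CU.fullest-large CV.fullest-large) (CrossCounting.second K q≡ 3≤k u v a b (λ v≡ u≡ → injective u≡ v≡) CU.fullest-large) (CrossCounting.second K q≡ 3≤k v u b a injective CV.fullest-large)
          where
          a = proj₁ CU.fullest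
          b = proj₁ CV.fullest

      positive-shape : Shape
      positive-shape = [ (λ C≡1 → contradiction C≡1 C≢1) , cross-shape ]′ C≡1⊎C≡K

    shape : ∀ c → c ℕ.≤ k → Residue u (+ c) → Residue v (+ c) → (∀ y → σ y ≡ 1ℤ → Residue (w y) (+ 2 * + c)) → Shape
    shape zero _ ru rv rw = trivial-residues ru rv rw
    shape (suc c) c≤k ru rv rw = PositiveResidues.positive-shape c c≤k ru rv rw

-- The case q ≡ 1 mod 4

-- k and n are variables here, so that powers with these exponents do not unfold.
module QuadraticCharacter (k-1 k′ k n : ℕ) (k≡suc : k ≡ suc k-1) (k≡2k′ : k ≡ k′ ℕ.+ k′) (n≡2k : n ≡ k ℕ.+ k) where

  module _ (𝔾 : FieldOnFin (suc n)) where
    open FieldTheory 𝔾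
    open Roots integral
    open Squares 𝔾
    open IntegerSums using (∑; δ; δ-≡; δ-≢; δ-view; ∑-cong; ∑-+; ∑--; ∑-const; *-∑; ∑-swap; ∑-permute; ∑-δ; ∑-δ₁; δ-sym)
    open MonoidSum +-commutativeMonoid using (sum; sum-cong-≗; sum-permute)
    open ≡-Reasoning
    private
      module ℤS = IntegerSums

    0^k : 0# ^ k ≡ 0#
    0^k = ≡.trans (cong (λ m → 0# ^ m) k≡suc) (zeroˡ (0# ^ k-1))

    poly-const-k : ∀ b → Poly k 0# (λ _ → b)
    poly-const-k b = subst (λ m → Poly m 0# (λ _ → b)) (≡.sym k≡suc) (poly-const k-1 b)

    ^-n : ∀ x → x ^ n ≡ x ^ k * x ^ k
    ^-n x = ≡.trans (cong (λ m → x ^ m) n≡2k) (^-homo-* x k k)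

    opaque
      power-unit : ∀ {x} → x ≢ 0# → x ^ k ≡ 1# ⊎ x ^ k ≡ - 1#
      power-unit {x} x≢0 with integral (x ^ k - 1#) (x ^ k + 1#) (begin
        (x ^ k - 1#) * (x ^ k + 1#) ≡⟨ solve 1 (λ y → (y :- :1) :* (y :+ :1) := y :* y :- :1) ≡.refl (x ^ k) ⟩
        x ^ k * x ^ k - 1# ≡⟨ cong (λ s → s - 1#) (≡.trans (≡.sym (^-n x)) (fermat ≡.refl x≢0)) ⟩
        1# - 1# ≡⟨ -‿inverseʳ 1# ⟩
        0# ∎)
      ... | inj₁ eq = inj₁ (x∙y⁻¹≈ε⇒x≈y (x ^ k) 1# eq)
      ... | inj₂ eq = inj₂ (x∙y⁻¹≈ε⇒x≈y (x ^ k) (- 1#) (≡.trans (cong (λ s → x ^ k + s) (solve 0 (:- :- :1 := :1) ≡.refl)) eq))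

    1≢-1 : 1# ≢ - 1#
    1≢-1 = x≢-x k (cong suc n≡2k) (0≢1 ∘ ≡.sym)

    -1≢0 : - 1# ≢ 0#
    -1≢0 eq = 1≢-1 (≡.trans (solve 0 (:1 := :- :- :1) ≡.refl) (≡.trans (cong -_ eq) (≡.trans (solve 0 (:- :0 := :0) ≡.refl) (≡.sym eq))))

    data Trit : ℤ → Set where
      zero′ : Trit 0ℤ
      plus : Trit 1ℤ
      minus : Trit -1ℤ

    trit-injective : ∀ {a b} → Trit a → Trit b → fromℤ a ≡ fromℤ b → a ≡ b
    trit-injective zero′ zero′ _ = ≡.refl
    trit-injective plus plus _ = ≡.refl
    trit-injective minus minus _ = ≡.refl
    trit-injective zero′ plus eq = contradiction eq 0≢1
    trit-injective zero′ minus eq = contradiction (≡.sym eq) -1≢0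
    trit-injective plus zero′ eq = contradiction (≡.sym eq) 0≢1
    trit-injective plus minus eq = contradiction eq 1≢-1
    trit-injective minus zero′ eq = contradiction eq -1≢0
    trit-injective minus plus eq = contradiction (≡.sym eq) 1≢-1

    trit-* : ∀ {a b} → Trit a → Trit b → Trit (a ℤ.* b)
    trit-* zero′ zero′ = zero′
    trit-* zero′ plus = zero′
    trit-* zero′ minus = zero′
    trit-* plus zero′ = zero′
    trit-* plus plus = plus
    trit-* plus minus = minus
    trit-* minus zero′ = zero′
    trit-* minus plus = minus
    trit-* minus minus = plus

    opaque
      character : ∀ x → ∃[ a ] Trit a × fromℤ a ≡ x ^ k
      character x with x Finₚ.≟ 0#
      ... | yes ≡.refl = 0ℤ , zero′ , ≡.sym 0^k
      ... | no x≢0 with power-unit x≢0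
      ... | inj₁ eq = 1ℤ , plus , ≡.sym eq
      ... | inj₂ eq = -1ℤ , minus , ≡.sym eq

    -- Euler's criterion serves as the definition: -1, 0 and 1 have different images in the field,
    -- so the integer is determined by x^k, and identities between k-th powers become identities for
    -- `χ`.
    χ : Fin (suc n) → ℤ
    χ x = proj₁ (character x)

    χ-trit : ∀ x → Trit (χ x)
    χ-trit x = proj₁ (proj₂ (character x))

    fromℤ-χ : ∀ x → fromℤ (χ x) ≡ x ^ k
    fromℤ-χ x = proj₂ (proj₂ (character x))

    χ-unique : ∀ {x a} → Trit a → x ^ k ≡ fromℤ a → χ x ≡ a
    χ-unique {x} ta eq = trit-injective (χ-trit x) ta (≡.trans (fromℤ-χ x) eq)

    χ-0 : χ 0# ≡ 0ℤ
    χ-0 = χ-unique zero′ 0^k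

    χ-* : ∀ x y → χ (x * y) ≡ χ x ℤ.* χ y
    χ-* x y = χ-unique (trit-* (χ-trit x) (χ-trit y)) (begin
      (x * y) ^ k ≡⟨ ^-distrib-* x y k ⟩
      x ^ k * y ^ k ≡⟨ cong₂ _*_ (fromℤ-χ x) (fromℤ-χ y) ⟨
      fromℤ (χ x) * fromℤ (χ y) ≡⟨ fromℤ-* (χ x) (χ y) ⟨
      fromℤ (χ x ℤ.* χ y) ∎)

    -- The exponent k = 2k′ is even; this makes χ(-1) = 1 and later `κ` symmetric.
    neg-^k : ∀ x → (- x) ^ k ≡ x ^ k
    neg-^k x = begin
      (- x) ^ k ≡⟨ cong (λ m → (- x) ^ m) k≡2k′ ⟩
      (- x) ^ (k′ ℕ.+ k′) ≡⟨ square-^ (- x) k′ ⟩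
      (- x * - x) ^ k′ ≡⟨ cong (_^ k′) (solve 1 (λ x → :- x :* :- x := x :* x) ≡.refl x) ⟩
      (x * x) ^ k′ ≡⟨ square-^ x k′ ⟨
      x ^ (k′ ℕ.+ k′) ≡⟨ cong (λ m → x ^ m) k≡2k′ ⟨
      x ^ k ∎

    χ-neg : ∀ x → χ (- x) ≡ χ x
    χ-neg x = χ-unique (χ-trit x) (≡.trans (neg-^k x) (≡.sym (fromℤ-χ x)))

    χ-unit : ∀ {x} → x ≢ 0# → χ x ≡ 1ℤ ⊎ χ x ≡ -1ℤ
    χ-unit x≢0 with power-unit x≢0
    ... | inj₁ eq = inj₁ (χ-unique plus eq)
    ... | inj₂ eq = inj₂ (χ-unique minus eq)

    χ-χ : ∀ x → χ x ℤ.* χ x ≡ 1ℤ ℤ.- δ x 0#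
    χ-χ x with δ-view x 0#
    ... | inj₁ (≡.refl , d) rewrite d | χ-0 = ≡.refl
    ... | inj₂ (x≢0 , d) rewrite d with χ-unit x≢0
    ... | inj₁ eq rewrite eq = ≡.refl
    ... | inj₂ eq rewrite eq = ≡.refl

    χ-square : ∀ {x} → x ≢ 0# → Square x → χ x ≡ 1ℤ
    χ-square {x} x≢0 (t , ≡.refl) = begin
      χ (t * t) ≡⟨ χ-* t t ⟩
      χ t ℤ.* χ t ≡⟨ χ-χ t ⟩
      1ℤ ℤ.- δ t 0# ≡⟨ cong (λ d → 1ℤ ℤ.- d) (δ-≢ t≢0) ⟩
      1ℤ ∎
      where
      t≢0 : t ≢ 0#
      t≢0 ≡.refl = x≢0 (zeroˡ 0#)

    -- Otherwise all 2k nonzero elements would be roots of x^k - 1, which is more than k of them.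
    nonresidue : ∃[ x ] χ x ≡ -1ℤ
    nonresidue with Finₚ.any? (λ x → χ x ℤₚ.≟ -1ℤ)
    ... | yes found = found
    ... | no ∄ = contradiction
      (leading≈0 0≢1 k (take (suc k) nonzeros) lengths (Uniqueₚ.take⁺ (suc k) nonzeros-unique) (Allₚ.take⁺ (suc k) (All.tabulate root))
        (poly-+ k (poly-id^ k) (poly-const-k (- 1#))))
      (λ eq → 0≢1 (≡.sym (≡.trans (≡.sym (+-identityʳ 1#)) eq)))
      where
      lengths : length (take (suc k) nonzeros) ≡ suc k
      lengths = ≡.trans (Listₚ.length-take (suc k) nonzeros) (ℕₚ.m≤n⇒m⊓n≡m (ℕₚ.≤-trans (ℕₚ.≤-reflexive (≡.sym (ℕₚ.+-comm k 1)))
                  (ℕₚ.≤-trans (ℕₚ.+-monoʳ-≤ k (ℕₚ.≤-trans (s≤s z≤n) (ℕₚ.≤-reflexive (≡.sym k≡suc)))) (ℕₚ.≤-reflexive (≡.sym (≡.trans (ℕₚ.suc-injective length-nonzeros) n≡2k))))))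
      root : ∀ {x} → x ∈ nonzeros → x ^ k - 1# ≡ 0#
      root {x} x∈ with power-unit (∈-nonzeros⁻ x∈)
      ... | inj₁ eq = ≡.trans (cong (λ s → s - 1#) eq) (-‿inverseʳ 1#)
      ... | inj₂ eq = contradiction (x , χ-unique minus eq) ∄

    doubled-zero : ∀ {a} → a ≡ ℤ.- a → a ≡ 0ℤ
    doubled-zero {ℤ.+ 0} _ = ≡.refl

    -- Multiplication by a nonresidue permutes the field and changes the sign of `χ`.
    ∑χ : ∑ χ ≡ 0ℤ
    ∑χ = doubled-zero (begin
      ∑ χ ≡⟨ ∑-permute χ (injective⇒permutation (*-cancelˡ ν≢0)) ⟩
      ∑ (λ x → χ (ν * x)) ≡⟨ ∑-cong (λ x → ≡.trans (χ-* ν x) (cong (λ s → s ℤ.* χ x) (proj₂ nonresidue))) ⟩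
      ∑ (λ x → -1ℤ ℤ.* χ x) ≡⟨ *-∑ -1ℤ χ ⟨
      -1ℤ ℤ.* ∑ χ ≡⟨ ℤₚ.-1*i≡-i (∑ χ) ⟩
      ℤ.- ∑ χ ∎)
      where
      ν = proj₁ nonresidue
      ν≢0 : ν ≢ 0#
      ν≢0 eq with () ← ≡.trans (≡.sym (proj₂ nonresidue)) (≡.trans (cong χ eq) χ-0)

    q : ℤ
    q = ℤ.+ suc n

    ∑-1 : ∑ {suc n} (λ _ → 1ℤ) ≡ q
    ∑-1 = ≡.trans (∑-const (suc n) 1ℤ) (ℤₚ.*-identityʳ q)

    ∑χ² : ∑ (λ x → χ x ℤ.* χ x) ≡ ℤ.+ n
    ∑χ² = begin
      ∑ (λ x → χ x ℤ.* χ x) ≡⟨ ∑-cong χ-χ ⟩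
      ∑ (λ x → 1ℤ ℤ.- δ x 0#) ≡⟨ ∑-- (λ _ → 1ℤ) (λ x → δ x 0#) ⟩
      ∑ {suc n} (λ _ → 1ℤ) ℤ.- ∑ (λ x → δ x 0#) ≡⟨ cong₂ ℤ._-_ ∑-1 (∑-δ₁ 0#) ⟩
      ℤ.+ n ∎

    -- J takes a single value on the nonzero elements, and its total is zero.
    J : Fin (suc n) → ℤ
    J d = ∑ (λ s → χ s ℤ.* χ (d - s))

    J-0 : J 0# ≡ ℤ.+ n
    J-0 = ≡.trans (∑-cong (λ s → cong (λ c → χ s ℤ.* c) (≡.trans (cong χ (+-identityˡ (- s))) (χ-neg s)))) ∑χ²

    -- The substitution s ↦ d s takes out the factor χ(d)² = 1.
    J-unit : ∀ {d} → d ≢ 0# → J d ≡ J 1#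
    J-unit {d} d≢0 = begin
      ∑ (λ s → χ s ℤ.* χ (d - s)) ≡⟨ ∑-permute (λ s → χ s ℤ.* χ (d - s)) (injective⇒permutation (*-cancelˡ d≢0)) ⟩
      ∑ (λ s → χ (d * s) ℤ.* χ (d - d * s)) ≡⟨ ∑-cong term ⟩
      ∑ (λ s → χ s ℤ.* χ (1# - s)) ∎
      where
      term : ∀ s → χ (d * s) ℤ.* χ (d - d * s) ≡ χ s ℤ.* χ (1# - s)
      term s = begin
        χ (d * s) ℤ.* χ (d - d * s) ≡⟨ cong₂ ℤ._*_ (χ-* d s) (≡.trans (cong χ (solve 2 (λ d s → d :- d :* s := d :* (:1 :- s)) ≡.refl d s)) (χ-* d (1# - s))) ⟩
        (χ d ℤ.* χ s) ℤ.* (χ d ℤ.* χ (1# - s)) ≡⟨ ℤS.solve 3 (λ a b c → (a ℤS.:* b) ℤS.:* (a ℤS.:* c) ℤS.:= (a ℤS.:* a) ℤS.:* (b ℤS.:* c)) ≡.refl (χ d) (χ s) (χ (1# - s)) ⟩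
        (χ d ℤ.* χ d) ℤ.* (χ s ℤ.* χ (1# - s)) ≡⟨ cong (λ c → c ℤ.* (χ s ℤ.* χ (1# - s))) (≡.trans (χ-χ d) (cong (λ e → 1ℤ ℤ.- e) (δ-≢ d≢0))) ⟩
        1ℤ ℤ.* (χ s ℤ.* χ (1# - s)) ≡⟨ ℤₚ.*-identityˡ _ ⟩
        χ s ℤ.* χ (1# - s) ∎

    shift-injective : ∀ y → Injective _≡_ _≡_ (λ x → x - y)
    shift-injective y {a} {b} = +-cancelʳ (- y) a b

    ∑χ-shift : ∀ y → ∑ (λ x → χ (x - y)) ≡ 0ℤ
    ∑χ-shift y = ≡.trans (≡.sym (∑-permute χ (injective⇒permutation (shift-injective y)))) ∑χ

    ∑J : ∑ J ≡ 0ℤ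
    ∑J = begin
      ∑ (λ d → ∑ (λ s → χ s ℤ.* χ (d - s))) ≡⟨ ∑-swap (λ d s → χ s ℤ.* χ (d - s)) ⟩
      ∑ (λ s → ∑ (λ d → χ s ℤ.* χ (d - s))) ≡⟨ ∑-cong (λ s → ≡.trans (≡.sym (*-∑ (χ s) (λ d → χ (d - s)))) (≡.trans (cong (λ c → χ s ℤ.* c) (∑χ-shift s)) (ℤₚ.*-zeroʳ (χ s)))) ⟩
      ∑ {suc n} (λ s → 0ℤ) ≡⟨ ∑-const (suc n) 0ℤ ⟩
      q ℤ.* 0ℤ ≡⟨ ℤₚ.*-zeroʳ q ⟩
      0ℤ ∎

    J-split : ∀ d → J d ≡ J 1# ℤ.+ δ d 0# ℤ.* (J 0# ℤ.- J 1#)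
    J-split d with δ-view d 0#
    ... | inj₁ (≡.refl , e) = ≡.trans (ℤS.solve 2 (λ a b → a ℤS.:= b ℤS.:+ ℤS.:1 ℤS.:* (a ℤS.:- b)) ≡.refl (J 0#) (J 1#)) (cong (λ c → J 1# ℤ.+ c ℤ.* (J 0# ℤ.- J 1#)) (≡.sym e))
    ... | inj₂ (d≢0 , e) = ≡.trans (J-unit d≢0) (≡.trans (ℤS.solve 2 (λ a b → b ℤS.:= b ℤS.:+ ℤS.:0 ℤS.:* (a ℤS.:- b)) ≡.refl (J 0#) (J 1#)) (cong (λ c → J 1# ℤ.+ c ℤ.* (J 0# ℤ.- J 1#)) (≡.sym e)))

    -- The total 0 consists of J(0) = q - 1 and of q - 1 copies of J(1).
    J-1 : J 1# ≡ -1ℤ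
    J-1 = ℤₚ.*-cancelˡ-≡ (ℤ.+ n) (J 1#) -1ℤ ⦃ subst (λ m → ℕ.NonZero m) (≡.sym (≡.trans n≡2k (cong (λ m → m ℕ.+ k) k≡suc))) _ ⦄ (begin
      ℤ.+ n ℤ.* J 1# ≡⟨ ℤS.solve 2 (λ m j → m ℤS.:* j ℤS.:= ((ℤS.:1 ℤS.:+ m) ℤS.:* j ℤS.:+ ℤS.:1 ℤS.:* (m ℤS.:- j)) ℤS.:- m) ≡.refl (ℤ.+ n) (J 1#) ⟩
      ((1ℤ ℤ.+ ℤ.+ n) ℤ.* J 1# ℤ.+ 1ℤ ℤ.* (ℤ.+ n ℤ.- J 1#)) ℤ.- ℤ.+ n ≡⟨ cong (λ s → s ℤ.- ℤ.+ n) total ⟨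
      0ℤ ℤ.- ℤ.+ n ≡⟨ ℤS.solve 1 (λ m → ℤS.:0 ℤS.:- m ℤS.:= m ℤS.:* ℤS.con -1ℤ) ≡.refl (ℤ.+ n) ⟩
      ℤ.+ n ℤ.* -1ℤ ∎)
      where
      total : 0ℤ ≡ (1ℤ ℤ.+ ℤ.+ n) ℤ.* J 1# ℤ.+ 1ℤ ℤ.* (ℤ.+ n ℤ.- J 1#)
      total = begin
        0ℤ ≡⟨ ∑J ⟨
        ∑ J ≡⟨ ∑-cong J-split ⟩
        ∑ (λ d → J 1# ℤ.+ δ d 0# ℤ.* (J 0# ℤ.- J 1#)) ≡⟨ ∑-+ (λ _ → J 1#) (λ d → δ d 0# ℤ.* (J 0# ℤ.- J 1#)) ⟩
        ∑ {suc n} (λ _ → J 1#) ℤ.+ ∑ (λ d → δ d 0# ℤ.* (J 0# ℤ.- J 1#)) ≡⟨ cong₂ ℤ._+_ (≡.trans (∑-const (suc n) (J 1#)) (cong (λ s → s ℤ.* J 1#) (ℤₚ.pos-+ 1 n)))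
                                                         (≡.trans (∑-δ 0# (λ _ → J 0# ℤ.- J 1#)) (≡.trans (cong (λ s → s ℤ.- J 1#) J-0) (≡.sym (ℤₚ.*-identityˡ _)))) ⟩
        (1ℤ ℤ.+ ℤ.+ n) ℤ.* J 1# ℤ.+ 1ℤ ℤ.* (ℤ.+ n ℤ.- J 1#) ∎

    -- Shifting t by y turns the sum into J (x - y), whose value is q - 1 at 0 and -1 elsewhere.
    correlation : ∀ x y → ∑ (λ t → χ (x - t) ℤ.* χ (t - y)) ≡ q ℤ.* δ x y ℤ.- 1ℤ
    correlation x y = begin
      ∑ (λ t → χ (x - t) ℤ.* χ (t - y)) ≡⟨ ∑-cong (λ t → ≡.trans (ℤₚ.*-comm (χ (x - t)) (χ (t - y))) (cong (λ s → χ (t - y) ℤ.* χ s) (solve 3 (λ x t y → x :- t := (x :- y) :- (t :- y)) ≡.refl x t y))) ⟩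
      ∑ (λ t → χ (t - y) ℤ.* χ ((x - y) - (t - y))) ≡⟨ ∑-permute (λ s → χ s ℤ.* χ ((x - y) - s)) (injective⇒permutation (shift-injective y)) ⟨
      J (x - y) ≡⟨ value ⟩
      q ℤ.* δ x y ℤ.- 1ℤ ∎
      where
      value : J (x - y) ≡ q ℤ.* δ x y ℤ.- 1ℤ
      value with δ-view x y
      ... | inj₁ (≡.refl , e) = ≡.trans (≡.trans (cong J (-‿inverseʳ x)) J-0) (≡.trans (ℤS.solve 1 (λ m → m ℤS.:= (ℤS.:1 ℤS.:+ m) ℤS.:* ℤS.:1 ℤS.:- ℤS.:1) ≡.refl (ℤ.+ n)) (cong₂ (λ a b → a ℤ.* b ℤ.- 1ℤ) (≡.sym (ℤₚ.pos-+ 1 n)) (≡.sym e)))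
      ... | inj₂ (x≢y , e) = ≡.trans (J-unit (x≢y ∘ x∙y⁻¹≈ε⇒x≈y x y)) (≡.trans J-1 (cong (λ s → s ℤ.- 1ℤ) (≡.sym (≡.trans (cong (λ d → q ℤ.* d) e) (ℤₚ.*-zeroʳ q)))))

    bit : ℤ → Fin (suc n) → ℤ
    bit ε y = if does (χ y ℤₚ.≟ ε) then 1ℤ else 0ℤ

    bit-view : ∀ ε y → bit ε y ≡ 0ℤ ⊎ bit ε y ≡ 1ℤ
    bit-view ε y with does (χ y ℤₚ.≟ ε)
    ... | true = inj₂ ≡.refl
    ... | false = inj₁ ≡.refl

    bit-≡ : ∀ {ε y} → χ y ≡ ε → bit ε y ≡ 1ℤ
    bit-≡ {ε} {y} eq with χ y ℤₚ.≟ ε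
    ... | yes _ = ≡.refl
    ... | no ne = contradiction eq ne

    bit-≡⁻ : ∀ {ε y} → bit ε y ≡ 1ℤ → χ y ≡ ε
    bit-≡⁻ {ε} {y} eq with χ y ℤₚ.≟ ε
    bit-≡⁻ _ | yes χ≡ = χ≡
    bit-≡⁻ () | no _

    bit-≢ : ∀ {ε y} → χ y ≢ ε → bit ε y ≡ 0ℤ
    bit-≢ {ε} {y} ne with χ y ℤₚ.≟ ε
    ... | yes eq = contradiction eq ne
    ... | no _ = ≡.refl

    -- The expression ε χ + χ² is 2 where χ = ε and 0 elsewhere; its sum is 0 + n = 2k.
    ∑bit : ∀ ε → Trit ε → ε ℤ.* ε ≡ 1ℤ → ∑ (bit ε) ≡ ℤ.+ k
    ∑bit ε ε-trit ε²≡1 = ℤₚ.*-cancelˡ-≡ (ℤ.+ 2) (∑ (bit ε)) (ℤ.+ k) (begin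
      ℤ.+ 2 ℤ.* ∑ (bit ε) ≡⟨ *-∑ (ℤ.+ 2) (bit ε) ⟩
      ∑ (λ y → ℤ.+ 2 ℤ.* bit ε y) ≡⟨ ∑-cong term ⟩
      ∑ (λ y → ε ℤ.* χ y ℤ.+ χ y ℤ.* χ y) ≡⟨ ∑-+ (λ y → ε ℤ.* χ y) (λ y → χ y ℤ.* χ y) ⟩
      ∑ (λ y → ε ℤ.* χ y) ℤ.+ ∑ (λ y → χ y ℤ.* χ y) ≡⟨ cong₂ ℤ._+_ (≡.trans (≡.sym (*-∑ ε χ)) (≡.trans (cong (λ s → ε ℤ.* s) ∑χ) (ℤₚ.*-zeroʳ ε))) ∑χ² ⟩
      0ℤ ℤ.+ ℤ.+ n ≡⟨ ℤₚ.+-identityˡ (ℤ.+ n) ⟩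
      ℤ.+ n ≡⟨ cong ℤ.+_ n≡2k ⟩
      ℤ.+ (k ℕ.+ k) ≡⟨ ℤₚ.pos-+ k k ⟩
      ℤ.+ k ℤ.+ ℤ.+ k ≡⟨ ℤS.solve 1 (λ k → k ℤS.:+ k ℤS.:= ℤS.:2 ℤS.:* k) ≡.refl (ℤ.+ k) ⟩
      ℤ.+ 2 ℤ.* ℤ.+ k ∎)
      where
      table : ∀ {e a} → Trit e → e ℤ.* e ≡ 1ℤ → Trit a → ℤ.+ 2 ℤ.* (if does (a ℤₚ.≟ e) then 1ℤ else 0ℤ) ≡ e ℤ.* a ℤ.+ a ℤ.* a
      table plus _ zero′ = ≡.refl
      table plus _ plus = ≡.refl
      table plus _ minus = ≡.refl
      table minus _ zero′ = ≡.refl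
      table minus _ plus = ≡.refl
      table minus _ minus = ≡.refl
      term : ∀ y → ℤ.+ 2 ℤ.* bit ε y ≡ ε ℤ.* χ y ℤ.+ χ y ℤ.* χ y
      term y = table ε-trit ε²≡1 (χ-trit y)

    length-filter-∑ : ∀ {P : Pred (Fin (suc n)) 0ℓ} (P? : Decidable P) {m} (g : Fin m → Fin (suc n)) →
                      ℤ.+ length (filter P? (tabulate g)) ≡ ∑ (λ i → if does (P? (g i)) then 1ℤ else 0ℤ)
    length-filter-∑ P? {zero} g = ≡.refl
    length-filter-∑ P? {suc m} g with does (P? (g Fin.zero)) | length-filter-∑ P? (g ∘ Fin.suc)
    ... | true | IH = cong (λ s → 1ℤ ℤ.+ s) IH
    ... | false | IH = ≡.trans IH (≡.sym (ℤₚ.+-identityˡ _))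

    fromℤ-∑ : ∀ {m} (f : Fin m → ℤ) → fromℤ (∑ f) ≡ sum (λ i → fromℤ (f i))
    fromℤ-∑ {zero} f = ≡.refl
    fromℤ-∑ {suc m} f = ≡.trans (fromℤ-+ (f Fin.zero) (∑ (f ∘ Fin.suc))) (cong (λ s → fromℤ (f Fin.zero) + s) (fromℤ-∑ (f ∘ Fin.suc)))

    sum-power : ∀ t → sum (λ x → (x - t) ^ k) ≡ 0#
    sum-power t = begin
      sum (λ x → (x - t) ^ k) ≡⟨ sum-cong-≗ (λ x → fromℤ-χ (x - t)) ⟨
      sum (λ x → fromℤ (χ (x - t))) ≡⟨ fromℤ-∑ (λ x → χ (x - t)) ⟨
      fromℤ (∑ (λ x → χ (x - t))) ≡⟨ cong fromℤ (∑χ-shift t) ⟩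
      0# ∎

    -- As a polynomial in y of degree at most k, the left-hand side vanishes at the k nonsquares,
    -- and so does 1 + yᵏ.
    power-sums : ∀ (f g : Fin (suc n) → Fin (suc n)) → (∀ y → χ y ≡ -1ℤ → Injective _≡_ _≡_ (λ b → g b - y * f b)) →
                 ∀ y t → sum (λ b → ((g b - y * f b) - t) ^ k) ≡ sum (λ b → f b ^ k) * (1# + y ^ k)
    power-sums f g undetermined y t = begin
      sum (λ b → ((g b - y * f b) - t) ^ k) ≡⟨ sum-cong-≗ (λ b → cong (_^ k) (rearrange b y)) ⟩
      P y ≡⟨ solve 2 (λ p r → p := (p :+ (:- r)) :+ r) ≡.refl (P y) (A * (1# + y ^ k)) ⟩
      (P y + - (A * (1# + y ^ k))) + A * (1# + y ^ k) ≡⟨ cong (λ s → s + A * (1# + y ^ k)) (D≡0 y) ⟩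
      0# + A * (1# + y ^ k) ≡⟨ +-identityˡ _ ⟩
      A * (1# + y ^ k) ≡⟨ cong (λ s → s * (1# + y ^ k)) (sum-cong-≗ (λ b → neg-^k (f b))) ⟩
      sum (λ b → f b ^ k) * (1# + y ^ k) ∎
      where
      rearrange : ∀ b y → (g b - y * f b) - t ≡ (g b - t) + - f b * y
      rearrange b y = solve 4 (λ g y f t → (g :- y :* f) :- t := (g :- t) :+ :- f :* y) ≡.refl (g b) y (f b) t
      A : Fin (suc n)
      A = sum (λ b → (- f b) ^ k)
      P D : Fin (suc n) → Fin (suc n)
      P y = sum (λ b → ((g b - t) + - f b * y) ^ k)
      D y = P y + - (A * (1# + y ^ k))
      roots : List (Fin (suc n))
      roots = filter (λ y → χ y ℤₚ.≟ -1ℤ) (allFin (suc n))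
      length-roots : length roots ≡ k
      length-roots = ℤₚ.+-injective (≡.trans (length-filter-∑ (λ y → χ y ℤₚ.≟ -1ℤ) (λ y → y)) (∑bit -1ℤ minus ≡.refl))
      root : ∀ {y} → y ∈ roots → D y ≡ 0#
      root {y} y∈ = begin
        P y + - (A * (1# + y ^ k)) ≡⟨ cong₂ (λ a b → a + - (A * (1# + b))) Py≡0 (≡.trans (≡.sym (fromℤ-χ y)) (cong fromℤ χy≡-1)) ⟩
        0# + - (A * (1# + - 1#)) ≡⟨ solve 1 (λ a → :0 :+ :- (a :* (:1 :+ :- :1)) := :0) ≡.refl A ⟩
        0# ∎
        where
        χy≡-1 : χ y ≡ -1ℤ
        χy≡-1 = proj₂ (∈ₚ.∈-filter⁻ (λ y → χ y ℤₚ.≟ -1ℤ) {xs = allFin (suc n)} y∈)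
        Py≡0 : P y ≡ 0#
        Py≡0 = begin
          P y ≡⟨ sum-cong-≗ (λ b → cong (_^ k) (rearrange b y)) ⟨
          sum (λ b → ((g b - y * f b) - t) ^ k) ≡⟨ sum-permute (λ x → (x - t) ^ k) (injective⇒permutation (undetermined y χy≡-1)) ⟨
          sum (λ x → (x - t) ^ k) ≡⟨ sum-power t ⟩
          0# ∎
      -- The constant A is chosen as the coefficient of y^k in `P`, so it cancels in `D`: with
      -- leading coefficient 0 and k roots, `poly-factor` makes `D` vanish everywhere. A does not
      -- involve t.
      D-poly : Poly k 0# D
      D-poly = poly-ext k (solve 1 (λ a → a :+ :- a :* (:0 :+ :1) := :0) ≡.refl A) (λ y → solve 3 (λ p a r → p :+ :- a :* r := p :+ :- (a :* r)) ≡.refl (P y) A (1# + y ^ k))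
        (poly-+ k (poly-sum k (λ b → (- f b) ^ k) (λ b y → ((g b - t) + - f b * y) ^ k) (λ b → poly-^ k (g b - t) (- f b)))
                  (poly-scale k (- A) (poly-+ k (poly-const-k 1#) (poly-id^ k))))
      D≡0 : ∀ y → D y ≡ 0#
      D≡0 y = ≡.trans (poly-factor {a = 0#} {f = D} roots (Uniqueₚ.filter⁺ (λ y → χ y ℤₚ.≟ -1ℤ) (Uniqueₚ.allFin⁺ (suc n))) (All.tabulate root)
                        (subst (λ l → Poly l 0# D) (≡.sym length-roots) D-poly) y) (zeroˡ _)

    module _ (q-prime : Prime (suc n)) where

      -- If the remainder r of m modulo q were not 0, it would be coprime to the prime q; as r and q
      -- both become 0 in the field, Bézout's identity would give 1 = 0.
      fromℕ-multiple : ∀ m → fromℕ m ≡ 0# → ∃[ z ] m ≡ z ℕ.* suc n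
      fromℕ-multiple m m≡0 with m ℕ.% suc n in eq
      ... | zero = m ℕ./ suc n , ≡.trans (m≡m%n+[m/n]*n m (suc n)) (cong (λ r → r ℕ.+ m ℕ./ suc n ℕ.* suc n) eq)
      ... | suc r = contradiction (coprime-Bézout (prime⇒coprime q-prime (subst (ℕ._< suc n) eq (m%n<n m (suc n))))) no-identity
        where
        remainder : fromℕ (suc r) ≡ 0#
        remainder = begin
          fromℕ (suc r) ≡⟨ solve 2 (λ a b → a := a :+ b :* :0) ≡.refl (fromℕ (suc r)) (fromℕ (m ℕ./ suc n)) ⟩
          fromℕ (suc r) + fromℕ (m ℕ./ suc n) * 0# ≡⟨ cong (λ s → fromℕ (suc r) + fromℕ (m ℕ./ suc n) * s) fromℕ-q ⟨
          fromℕ (suc r) + fromℕ (m ℕ./ suc n) * fromℕ (suc n) ≡⟨ cong (λ s → fromℕ (suc r) + s) (fromℕ-* (m ℕ./ suc n) (suc n)) ⟨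
          fromℕ (suc r) + fromℕ (m ℕ./ suc n ℕ.* suc n) ≡⟨ fromℕ-+ (suc r) (m ℕ./ suc n ℕ.* suc n) ⟨
          fromℕ (suc r ℕ.+ m ℕ./ suc n ℕ.* suc n) ≡⟨ cong (λ s → fromℕ (s ℕ.+ m ℕ./ suc n ℕ.* suc n)) eq ⟨
          fromℕ (m ℕ.% suc n ℕ.+ m ℕ./ suc n ℕ.* suc n) ≡⟨ cong fromℕ (m≡m%n+[m/n]*n m (suc n)) ⟨
          fromℕ m ≡⟨ m≡0 ⟩
          0# ∎
        multiple-zero : ∀ a b → fromℕ b ≡ 0# → fromℕ (a ℕ.* b) ≡ 0#
        multiple-zero a b b≡0 = ≡.trans (fromℕ-* a b) (≡.trans (cong (λ s → fromℕ a * s) b≡0) (zeroʳ _))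
        one : ∀ a b c → fromℕ c ≡ 0# → fromℕ b ≡ 0# → 1 ℕ.+ a ≡ b → a ≡ c → 0# ≡ 1#
        one a b c c≡0 b≡0 ≡.refl ≡.refl = ≡.trans (≡.sym b≡0) (≡.trans (fromℕ-suc a) (≡.trans (cong (λ s → 1# + s) c≡0) (+-identityʳ 1#)))
        no-identity : ¬ Bézout.Identity 1 (suc n) (suc r)
        no-identity (Bézout.+- x y e) = 0≢1 (one (y ℕ.* suc r) (x ℕ.* suc n) (y ℕ.* suc r) (multiple-zero y (suc r) remainder) (multiple-zero x (suc n) fromℕ-q) e ≡.refl)
        no-identity (Bézout.-+ x y e) = 0≢1 (one (x ℕ.* suc n) (y ℕ.* suc r) (x ℕ.* suc n) (multiple-zero x (suc n) fromℕ-q) (multiple-zero y (suc r) remainder) e ≡.refl)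

      fromℤ-multiple : ∀ a → fromℤ a ≡ 0# → ∃[ z ] a ≡ q ℤ.* z
      fromℤ-multiple (ℤ.+ m) m≡0 with fromℕ-multiple m m≡0
      ... | z , eq = ℤ.+ z , ≡.trans (cong ℤ.+_ eq) (≡.trans (ℤₚ.pos-* z (suc n)) (ℤₚ.*-comm (ℤ.+ z) q))
      fromℤ-multiple (-[1+ m ]) m≡0 with fromℕ-multiple (suc m) (≡.trans (solve 1 (λ x → x := :- :- x) ≡.refl (fromℕ (suc m))) (≡.trans (cong -_ m≡0) (solve 0 (:- :0 := :0) ≡.refl)))
      ... | z , eq = ℤ.- ℤ.+ z , ≡.trans (cong (λ s → ℤ.- ℤ.+ s) eq) (≡.trans (cong ℤ.-_ (≡.trans (ℤₚ.pos-* z (suc n)) (ℤₚ.*-comm (ℤ.+ z) q))) (ℤₚ.neg-distribʳ-* q (ℤ.+ z)))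

      congruent : ∀ a c → fromℤ a ≡ fromℤ c → ∃[ z ] a ≡ c ℤ.+ q ℤ.* z
      congruent a c eq with fromℤ-multiple (a ℤ.- c) (begin
        fromℤ (a ℤ.- c) ≡⟨ fromℤ-+ a (ℤ.- c) ⟩
        fromℤ a + fromℤ (ℤ.- c) ≡⟨ cong₂ _+_ eq (fromℤ-neg c) ⟩
        fromℤ c - fromℤ c ≡⟨ -‿inverseʳ (fromℤ c) ⟩
        0# ∎)
      ... | z , e = z , ≡.trans (ℤS.solve 2 (λ a c → a ℤS.:= c ℤS.:+ (a ℤS.:- c)) ≡.refl a c) (cong (λ s → c ℤ.+ s) e)

-- Character sums of a point set in isotropic coordinates

module SquareDifferences (k-1 k′ k n : ℕ) (k≡suc : k ≡ suc k-1) (k≡2k′ : k ≡ k′ ℕ.+ k′) (n≡2k : n ≡ k ℕ.+ k)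
  (𝔾 : FieldOnFin (suc n)) (q-prime : Prime (suc n)) where

  open FieldTheory 𝔾
  open Squares 𝔾
  open IntegerSums using (∑; δ; δ-≡; δ-≢; δ-view; ∑-cong; ∑-const; *-∑; ∑-δ; gap)
  open MonoidSum +-commutativeMonoid using (sum; sum-cong-≗)
  private module QC = QuadraticCharacter k-1 k′ k n k≡suc k≡2k′ n≡2k
  open QC using (Trit; zero′; plus; minus)
  open ≡-Reasoning
  private
    χ = QC.χ 𝔾
    q = QC.q 𝔾

  module Sign (ε : ℤ) (ε-trit : Trit 𝔾 ε) (ε² : ε ℤ.* ε ≡ 1ℤ) where

    κ : Fin (suc n) → Fin (suc n) → ℤ
    κ x y = ε ℤ.* χ (x - y)

    κ-sym : ∀ x y → κ x y ≡ κ y x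
    κ-sym x y = cong (λ s → ε ℤ.* s) (≡.trans (cong χ (solve 2 (λ x y → x :- y := :- (y :- x)) ≡.refl x y)) (QC.χ-neg 𝔾 (y - x)))

    κ-diagonal : ∀ x → κ x x ≡ 0ℤ
    κ-diagonal x = ≡.trans (cong (λ s → ε ℤ.* s) (≡.trans (cong χ (-‿inverseʳ x)) (QC.χ-0 𝔾))) (ℤₚ.*-zeroʳ ε)

    κ-unit : ∀ x y → x ≢ y → κ x y ≡ 1ℤ ⊎ κ x y ≡ -1ℤ
    κ-unit x y x≢y = table ε-trit ε² (QC.χ-unit 𝔾 (x≢y ∘ x∙y⁻¹≈ε⇒x≈y x y))
      where
      table : ∀ {e a} → Trit 𝔾 e → e ℤ.* e ≡ 1ℤ → a ≡ 1ℤ ⊎ a ≡ -1ℤ → e ℤ.* a ≡ 1ℤ ⊎ e ℤ.* a ≡ -1ℤ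
      table plus _ (inj₁ ≡.refl) = inj₁ ≡.refl
      table plus _ (inj₂ ≡.refl) = inj₂ ≡.refl
      table minus _ (inj₁ ≡.refl) = inj₂ ≡.refl
      table minus _ (inj₂ ≡.refl) = inj₁ ≡.refl

    κ-sum : ∀ y → ∑ (λ x → κ x y) ≡ 0ℤ
    κ-sum y = ≡.trans (≡.sym (*-∑ ε (λ x → χ (x - y)))) (≡.trans (cong (λ s → ε ℤ.* s) (QC.∑χ-shift 𝔾 y)) (ℤₚ.*-zeroʳ ε))

    κ-correlation : ∀ x y → ∑ (λ t → κ x t ℤ.* κ t y) ≡ ℤ.+ suc n ℤ.* δ x y ℤ.- 1ℤ
    κ-correlation x y = ≡.trans (∑-cong (λ t → ≡.trans (IntegerSums.solve 3 (λ e a b → (e IntegerSums.:* a) IntegerSums.:* (e IntegerSums.:* b) IntegerSums.:= (e IntegerSums.:* e) IntegerSums.:* (a IntegerSums.:* b)) ≡.refl ε (χ (x - t)) (χ (t - y)))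
                          (≡.trans (cong (λ s → s ℤ.* (χ (x - t) ℤ.* χ (t - y))) ε²) (ℤₚ.*-identityˡ (χ (x - t) ℤ.* χ (t - y)))))) (QC.correlation 𝔾 x y)

    fromℤ-R : ∀ (f : Fin (suc n) → Fin (suc n)) t → fromℤ (∑ (λ b → κ (f b) t)) ≡ fromℤ ε * sum (λ b → (f b - t) ^ k)
    fromℤ-R f t = begin
      fromℤ (∑ (λ b → ε ℤ.* χ (f b - t))) ≡⟨ cong fromℤ (*-∑ ε (λ b → χ (f b - t))) ⟨
      fromℤ (ε ℤ.* ∑ (λ b → χ (f b - t))) ≡⟨ fromℤ-* ε (∑ (λ b → χ (f b - t))) ⟩
      fromℤ ε * fromℤ (∑ (λ b → χ (f b - t))) ≡⟨ cong (λ s → fromℤ ε * s) (≡.trans (QC.fromℤ-∑ 𝔾 (λ b → χ (f b - t))) (sum-cong-≗ (λ b → QC.fromℤ-χ 𝔾 (f b - t)))) ⟩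
      fromℤ ε * sum (λ b → (f b - t) ^ k) ∎

  data Configuration (u v : Fin (suc n) → Fin (suc n)) : Set where
    vertical : (∀ a b → u a ≡ u b) → Configuration u v
    horizontal : (∀ a b → v a ≡ v b) → Configuration u v
    slanted : ∀ y → y ≢ 0# → (∀ a b → v a - y * u a ≡ v b - y * u b) → Configuration u v
    cross : ∀ u₀ v₀ β → β ≢ 0# → (∀ z → (u z ≡ u₀ × ∃[ s ] v z ≡ v₀ + β * (s * s)) ⊎ (v z ≡ v₀ × ∃[ s ] u z ≡ u₀ + β * (s * s))) → Configuration u v

  -- Two points with the same value satisfy G = y F, so the square F G equals y F²; if F were not 0,
  -- y would be a square.
  undetermined : ∀ (f g : Fin (suc n) → Fin (suc n)) → (∀ {a b} → f a ≡ f b → g a ≡ g b → a ≡ b) →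
                 (∀ a b → Square ((f a - f b) * (g a - g b))) → ∀ y → χ y ≡ -1ℤ → Injective _≡_ _≡_ (λ b → g b - y * f b)
  undetermined f g injective squares y χy≡-1 {a} {b} eq = injective (x∙y⁻¹≈ε⇒x≈y (f a) (f b) F≡0) (x∙y⁻¹≈ε⇒x≈y (g a) (g b) (≡.trans G≡ (≡.trans (cong (λ s → y * s) F≡0) (zeroʳ y))))
    where
    F = f a - f b
    G≡ : g a - g b ≡ y * F
    G≡ = begin
      g a - g b ≡⟨ solve 5 (λ ga gb y fa fb → ga :- gb := ((ga :- y :* fa) :- (gb :- y :* fb)) :+ y :* (fa :- fb)) ≡.refl (g a) (g b) y (f a) (f b) ⟩
      ((g a - y * f a) - (g b - y * f b)) + y * F ≡⟨ cong (λ s → (s - (g b - y * f b)) + y * F) eq ⟩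
      ((g b - y * f b) - (g b - y * f b)) + y * F ≡⟨ cong (λ s → s + y * F) (-‿inverseʳ (g b - y * f b)) ⟩
      0# + y * F ≡⟨ +-identityˡ (y * F) ⟩
      y * F ∎
    y≢0 : y ≢ 0#
    y≢0 y≡0 with () ← ≡.trans (≡.sym χy≡-1) (≡.trans (cong χ y≡0) (QC.χ-0 𝔾))
    F≡0 : F ≡ 0#
    F≡0 with F Finₚ.≟ 0#
    ... | yes F≡0 = F≡0
    ... | no F≢0 = contradiction (≡.trans (≡.sym χy≡-1) (QC.χ-square 𝔾 y≢0 (square-/ (*-nonzero F≢0 F≢0) (F , ≡.refl)
                      (subst Square (≡.trans (cong (λ s → F * s) G≡) (solve 2 (λ F y → F :* (y :* F) := y :* (F :* F)) ≡.refl F y)) (squares a b))))) (λ ())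

  module Residues (u v : Fin (suc n) → Fin (suc n)) (injective : ∀ {a b} → u a ≡ u b → v a ≡ v b → a ≡ b)
                  (squares : ∀ a b → Square ((u a - u b) * (v a - v b))) where

    w : Fin (suc n) → Fin (suc n) → Fin (suc n)
    w y b = v b - y * u b

    A : Fin (suc n)
    A = sum (λ b → u b ^ k)

    w-sums : ∀ y t → sum (λ b → (w y b - t) ^ k) ≡ A * (1# + y ^ k)
    w-sums = QC.power-sums 𝔾 u v (undetermined u v injective squares)

    at-0 : ∀ a b → b ≡ b - 0# * a
    at-0 = solve 2 (λ a b → b := b :- :0 :* a) ≡.refl

    1+0^k : 1# + 0# ^ k ≡ 1#
    1+0^k = ≡.trans (cong (λ s → 1# + s) (QC.0^k 𝔾)) (+-identityʳ 1#)

    v-sums : ∀ t → sum (λ b → (v b - t) ^ k) ≡ A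
    v-sums t = begin
      sum (λ b → (v b - t) ^ k) ≡⟨ sum-cong-≗ (λ b → cong (λ s → (s - t) ^ k) (at-0 (u b) (v b))) ⟩
      sum (λ b → (w 0# b - t) ^ k) ≡⟨ w-sums 0# t ⟩
      A * (1# + 0# ^ k) ≡⟨ ≡.trans (cong (λ s → A * s) 1+0^k) (≡.trans (*-comm A 1#) (*-identityˡ A)) ⟩
      A ∎

    v-power : sum (λ b → v b ^ k) ≡ A
    v-power = ≡.trans (sum-cong-≗ (λ b → cong (_^ k) (solve 1 (λ x → x := x :- :0) ≡.refl (v b)))) (v-sums 0#)

    -- The direction u is not of the form v - y u, but becomes slope 0 when u and v are exchanged in
    -- `power-sums`. The constant is then ∑ v^k, which is `A` by `v-power`.
    u-sums : ∀ t → sum (λ b → (u b - t) ^ k) ≡ A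
    u-sums t = begin
      sum (λ b → (u b - t) ^ k) ≡⟨ sum-cong-≗ (λ b → cong (λ s → (s - t) ^ k) (at-0 (v b) (u b))) ⟩
      sum (λ b → ((u b - 0# * v b) - t) ^ k) ≡⟨ QC.power-sums 𝔾 v u (undetermined v u (λ v≡ u≡ → injective u≡ v≡) (λ a b → subst Square (*-comm (u a - u b) (v a - v b)) (squares a b))) 0# t ⟩
      sum (λ b → v b ^ k) * (1# + 0# ^ k) ≡⟨ ≡.trans (cong₂ _*_ v-power 1+0^k) (≡.trans (*-comm A 1#) (*-identityˡ A)) ⟩
      A ∎

    σ : Fin (suc n) → ℤ
    σ = QC.bit 𝔾 1ℤ

    -- If U and V are the differences of the coordinates and U ≠ 0, the only slope joining the two
    -- points is y₀ = V / U. As U V = y₀ U² is a square, so is y₀; it is 0 exactly for two points of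
    -- the same row, which the bit σ does not count.
    incidence : ∀ a b → b ≢ a → δ (u b) (u a) ℤ.+ δ (v b) (v a) ℤ.+ ∑ (λ y → σ y ℤ.* δ (w y b) (w y a)) ≡ 1ℤ
    incidence a b b≢a with δ-view (u b) (u a) | δ-view (v b) (v a)
    ... | inj₁ (u≡ , _) | inj₁ (v≡ , _) = contradiction (injective u≡ v≡) b≢a
    ... | inj₁ (u≡ , d) | inj₂ (v≢ , d′) rewrite d | d′ = cong (λ s → 1ℤ ℤ.+ s) (≡.trans (∑-cong term) (≡.trans (∑-const (suc n) 0ℤ) (ℤₚ.*-zeroʳ q)))
      where
      term : ∀ y → σ y ℤ.* δ (w y b) (w y a) ≡ 0ℤ
      term y = ≡.trans (cong (λ s → σ y ℤ.* s) (δ-≢ (λ eq → v≢ (begin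
        v b ≡⟨ solve 2 (λ v s → v := (v :- s) :+ s) ≡.refl (v b) (y * u b) ⟩
        (v b - y * u b) + y * u b ≡⟨ cong₂ (λ s t → s + y * t) eq u≡ ⟩
        (v a - y * u a) + y * u a ≡⟨ solve 2 (λ v s → v := (v :- s) :+ s) ≡.refl (v a) (y * u a) ⟨
        v a ∎)))) (ℤₚ.*-zeroʳ (σ y))
    ... | inj₂ (u≢ , d) | dv = slope dv
      where
      U = u b - u a
      V = v b - v a
      U≢0 : U ≢ 0#
      U≢0 = u≢ ∘ x∙y⁻¹≈ε⇒x≈y (u b) (u a)
      y₀ = V / U
      V≡ : V ≡ y₀ * U
      V≡ = ≡.sym (≡.trans (solve 3 (λ v i u → (v :* i) :* u := v :* (u :* i)) ≡.refl V (inv U) U) (≡.trans (cong (λ s → V * s) (x*inv U≢0)) (≡.trans (*-comm V 1#) (*-identityˡ V))))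
      on-line : ∀ y → δ (w y b) (w y a) ≡ δ y y₀
      on-line y with δ-view y y₀
      ... | inj₁ (≡.refl , e) = ≡.trans (δ-≡ (x∙y⁻¹≈ε⇒x≈y (w y₀ b) (w y₀ a) (begin
        (v b - y₀ * u b) - (v a - y₀ * u a) ≡⟨ solve 5 (λ vb va y ub ua → (vb :- y :* ub) :- (va :- y :* ua) := (vb :- va) :- y :* (ub :- ua)) ≡.refl (v b) (v a) y₀ (u b) (u a) ⟩
        V - y₀ * U ≡⟨ cong (λ s → s - y₀ * U) V≡ ⟩
        y₀ * U - y₀ * U ≡⟨ -‿inverseʳ (y₀ * U) ⟩
        0# ∎))) (≡.sym e)
      ... | inj₂ (y≢ , e) = ≡.trans (δ-≢ (λ eq → y≢ (*-cancelˡ U≢0 (begin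
        U * y ≡⟨ solve 5 (λ vb va y ub ua → (ub :- ua) :* y := (vb :- va) :- ((vb :- y :* ub) :- (va :- y :* ua))) ≡.refl (v b) (v a) y (u b) (u a) ⟩
        V - (w y b - w y a) ≡⟨ cong (λ s → V - (s - w y a)) eq ⟩
        V - (w y a - w y a) ≡⟨ solve 2 (λ v s → v :- (s :- s) := v) ≡.refl V (w y a) ⟩
        V ≡⟨ ≡.trans V≡ (*-comm y₀ U) ⟩
        U * y₀ ∎)))) (≡.sym e)
      ∑≡ : ∑ (λ y → σ y ℤ.* δ (w y b) (w y a)) ≡ σ y₀
      ∑≡ = ≡.trans (∑-cong (λ y → ≡.trans (cong (λ s → σ y ℤ.* s) (on-line y)) (ℤₚ.*-comm (σ y) (δ y y₀)))) (∑-δ y₀ σ)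
      slope : (v b ≡ v a × δ (v b) (v a) ≡ 1ℤ) ⊎ (v b ≢ v a × δ (v b) (v a) ≡ 0ℤ) →
              δ (u b) (u a) ℤ.+ δ (v b) (v a) ℤ.+ ∑ (λ y → σ y ℤ.* δ (w y b) (w y a)) ≡ 1ℤ
      slope (inj₁ (v≡ , d′)) = cong₂ ℤ._+_ (cong₂ ℤ._+_ d d′) (≡.trans ∑≡ (QC.bit-≢ 𝔾 {1ℤ} {y₀} (λ χ≡1 → 0≢1ℤ (≡.trans (≡.sym χy₀) χ≡1))))
        where
        0≢1ℤ : 0ℤ ≢ 1ℤ
        0≢1ℤ ()
        χy₀ : χ y₀ ≡ 0ℤ
        χy₀ = ≡.trans (cong χ (≡.trans (cong (λ s → s * inv U) (≡.trans (cong (λ s → s - v a) v≡) (-‿inverseʳ (v a)))) (zeroˡ (inv U)))) (QC.χ-0 𝔾)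
      slope (inj₂ (v≢ , d′)) = cong₂ ℤ._+_ (cong₂ ℤ._+_ d d′) (≡.trans ∑≡ (QC.bit-≡ 𝔾 {1ℤ} {y₀} (QC.χ-square 𝔾 y₀≢0 (square-/ (*-nonzero U≢0 U≢0) (U , ≡.refl)
          (subst Square (≡.trans (cong (λ s → U * s) V≡) (solve 2 (λ U y → U :* (y :* U) := y :* (U :* U)) ≡.refl U y₀)) (squares b a))))))
        where
        y₀≢0 : y₀ ≢ 0#
        y₀≢0 = *-nonzero (v≢ ∘ x∙y⁻¹≈ε⇒x≈y (v b) (v a)) (inv≢0 U≢0)

    record SmallResidue : Set where
      field
        ε : ℤ
        ε-trit : Trit 𝔾 ε
        ε² : ε ℤ.* ε ≡ 1ℤ
        c : ℕ
        c≤k : c ℕ.≤ k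
        fromℕ-c : fromℕ c ≡ fromℤ ε * A

    -- `A` is the image of the integer ∑ χ (v b). If the remainder r of that integer modulo q
    -- exceeds k, the sign -1 replaces it by q - r, which is at most k because q = 2k + 1.
    smallResidue : SmallResidue
    smallResidue = choose (r ℕₚ.≤? k)
      where
      a₀ : ℤ
      a₀ = ∑ (λ b → χ (v b))
      r = a₀ ℤDivMod.%ℕ suc n
      z = a₀ ℤDivMod./ℕ suc n
      fromℤ-q* : ∀ z → fromℤ (z ℤ.* q) ≡ 0#
      fromℤ-q* z = ≡.trans (fromℤ-* z q) (≡.trans (cong (λ s → fromℤ z * s) fromℕ-q) (zeroʳ (fromℤ z)))
      fromℕ-r : fromℕ r ≡ A
      fromℕ-r = begin
        fromℕ r ≡⟨ +-identityʳ (fromℕ r) ⟨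
        fromℕ r + 0# ≡⟨ cong (λ s → fromℕ r + s) (fromℤ-q* z) ⟨
        fromℕ r + fromℤ (z ℤ.* q) ≡⟨ fromℤ-+ (ℤ.+ r) (z ℤ.* q) ⟨
        fromℤ (ℤ.+ r ℤ.+ z ℤ.* q) ≡⟨ cong fromℤ (ℤDivMod.a≡a%ℕn+[a/ℕn]*n a₀ (suc n)) ⟨
        fromℤ a₀ ≡⟨ QC.fromℤ-∑ 𝔾 (λ b → χ (v b)) ⟩
        sum (λ b → fromℤ (χ (v b))) ≡⟨ sum-cong-≗ (λ b → QC.fromℤ-χ 𝔾 (v b)) ⟩
        sum (λ b → v b ^ k) ≡⟨ v-power ⟩
        A ∎
      choose : Dec (r ℕ.≤ k) → SmallResidue
      choose (yes r≤k) = record { ε = 1ℤ ; ε-trit = plus ; ε² = ≡.refl ; c = r ; c≤k = r≤k ; fromℕ-c = ≡.trans fromℕ-r (≡.sym (*-identityˡ A)) }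
      choose (no r≰k) with ℕₚ.m≤n⇒∃[o]m+o≡n (ℕₚ.<⇒≤ (ℤDivMod.n%ℕd<d a₀ (suc n)))
      ... | c , r+c≡q = record { ε = -1ℤ ; ε-trit = minus ; ε² = ≡.refl ; c = c ; c≤k = c≤k ; fromℕ-c = begin
          fromℕ c ≡⟨ solve 2 (λ r c → c := (r :+ c) :- r) ≡.refl (fromℕ r) (fromℕ c) ⟩
          (fromℕ r + fromℕ c) - fromℕ r ≡⟨ cong₂ _-_ (≡.trans (≡.sym (fromℕ-+ r c)) (≡.trans (cong fromℕ r+c≡q) fromℕ-q)) fromℕ-r ⟩
          0# - A ≡⟨ solve 1 (λ a → :0 :- a := :- :1 :* a) ≡.refl A ⟩
          - 1# * A ∎ }
        where
        c≤k : c ℕ.≤ k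
        c≤k = ℕₚ.+-cancelˡ-≤ (suc k) c k (ℕₚ.≤-trans (ℕₚ.+-monoˡ-≤ c (ℕₚ.≰⇒> r≰k)) (ℕₚ.≤-reflexive (≡.trans r+c≡q (cong suc n≡2k))))

    open SmallResidue smallResidue public
    open Sign ε ε-trit ε² public

    residue-v : ∀ t → ∃[ z ] ∑ (λ b → κ (v b) t) ≡ ℤ.+ c ℤ.+ q ℤ.* z
    residue-v t = QC.congruent 𝔾 q-prime (∑ (λ b → κ (v b) t)) (ℤ.+ c) (≡.trans (fromℤ-R v t) (≡.trans (cong (λ s → fromℤ ε * s) (v-sums t)) (≡.sym fromℕ-c)))

    residue-u : ∀ t → ∃[ z ] ∑ (λ b → κ (u b) t) ≡ ℤ.+ c ℤ.+ q ℤ.* z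
    residue-u t = QC.congruent 𝔾 q-prime (∑ (λ b → κ (u b) t)) (ℤ.+ c) (≡.trans (fromℤ-R u t) (≡.trans (cong (λ s → fromℤ ε * s) (u-sums t)) (≡.sym fromℕ-c)))

    residue-w : ∀ y → σ y ≡ 1ℤ → ∀ t → ∃[ z ] ∑ (λ b → κ (w y b) t) ≡ ℤ.+ 2 ℤ.* ℤ.+ c ℤ.+ q ℤ.* z
    residue-w y σ≡1 t = QC.congruent 𝔾 q-prime (∑ (λ b → κ (w y b) t)) (ℤ.+ 2 ℤ.* ℤ.+ c) (begin
      fromℤ (∑ (λ b → κ (w y b) t)) ≡⟨ fromℤ-R (w y) t ⟩
      fromℤ ε * sum (λ b → (w y b - t) ^ k) ≡⟨ cong (λ s → fromℤ ε * s) (w-sums y t) ⟩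
      fromℤ ε * (A * (1# + y ^ k)) ≡⟨ cong (λ s → fromℤ ε * (A * (1# + s))) (≡.trans (≡.sym (QC.fromℤ-χ 𝔾 y)) (cong fromℤ (QC.bit-≡⁻ 𝔾 {1ℤ} {y} σ≡1))) ⟩
      fromℤ ε * (A * (1# + 1#)) ≡⟨ solve 2 (λ e a → e :* (a :* (:1 :+ :1)) := (:1 :+ :1) :* (e :* a)) ≡.refl (fromℤ ε) A ⟩
      (1# + 1#) * (fromℤ ε * A) ≡⟨ cong (λ s → (1# + 1#) * s) fromℕ-c ⟨
      (1# + 1#) * fromℕ c ≡⟨ fromℤ-* (ℤ.+ 2) (ℤ.+ c) ⟨
      fromℤ (ℤ.+ 2 ℤ.* ℤ.+ c) ∎)

    -- For z in the row and z′ in the column, the product of their coordinate differences is (u z -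
    -- u a)(v b - v z′), so (u z - u a)(v z′ - v b) is a square, -1 being i². With z = z₂ this puts
    -- each column point at v b plus β times a square. For a row point z, both β α₁ and (u z - u a)
    -- α₁ are squares, so the same β works there.
    crossConfiguration : ∀ i → i * i ≡ - 1# → ∀ a b → (∀ z → u z ≡ u a ⊎ v z ≡ v b) →
                         (∃[ z ] u z ≡ u a × v z ≢ v b) → (∃[ z ] v z ≡ v b × u z ≢ u a) → Configuration u v
    crossConfiguration i i²≡-1 a b in-cross (z₁ , u₁ , v₁) (z₂ , v₂ , u₂) = cross (u a) (v b) β β≢0 (λ z → place z (in-cross z))
      where
      β = u z₂ - u a
      β≢0 : β ≢ 0#
      β≢0 = u₂ ∘ x∙y⁻¹≈ε⇒x≈y (u z₂) (u a)
      α₁ = v z₁ - v b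
      α₁≢0 : α₁ ≢ 0#
      α₁≢0 = v₁ ∘ x∙y⁻¹≈ε⇒x≈y (v z₁) (v b)
      product : ∀ z z′ → v z ≡ v b → u z′ ≡ u a → Square ((u z - u a) * (v z′ - v b))
      product z z′ vz≡ uz′≡ = subst Square (begin
        (i * i) * ((u z - u z′) * (v z - v z′)) ≡⟨ cong₂ _*_ i²≡-1 (cong₂ (λ s t → (u z - s) * (t - v z′)) uz′≡ vz≡) ⟩
        - 1# * ((u z - u a) * (v b - v z′)) ≡⟨ solve 4 (λ x a b y → :- :1 :* ((x :- a) :* (b :- y)) := (x :- a) :* (y :- b)) ≡.refl (u z) (u a) (v b) (v z′) ⟩
        (u z - u a) * (v z′ - v b) ∎) (square-* (i , ≡.refl) (squares z z′))
      multiple : ∀ x x₀ → Square (β * (x - x₀)) → ∃[ s ] x ≡ x₀ + β * (s * s)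
      multiple x x₀ (s , eq) = s / β , ≡.sym (begin
        x₀ + β * (s / β * (s / β)) ≡⟨ cong (λ t → x₀ + t) (solve 3 (λ b s i → b :* ((s :* i) :* (s :* i)) := (b :* i) :* ((s :* s) :* i)) ≡.refl β s (inv β)) ⟩
        x₀ + (β * inv β) * ((s * s) * inv β) ≡⟨ cong₂ (λ t t′ → x₀ + t * (t′ * inv β)) (x*inv β≢0) (≡.sym eq) ⟩
        x₀ + 1# * ((β * (x - x₀)) * inv β) ≡⟨ cong (λ t → x₀ + t) (solve 3 (λ b d i → :1 :* ((b :* d) :* i) := (b :* i) :* d) ≡.refl β (x - x₀) (inv β)) ⟩
        x₀ + (β * inv β) * (x - x₀) ≡⟨ cong (λ t → x₀ + t * (x - x₀)) (x*inv β≢0) ⟩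
        x₀ + 1# * (x - x₀) ≡⟨ solve 2 (λ x₀ x → x₀ :+ :1 :* (x :- x₀) := x) ≡.refl x₀ x ⟩
        x ∎)
      place : ∀ z → u z ≡ u a ⊎ v z ≡ v b → (u z ≡ u a × ∃[ s ] v z ≡ v b + β * (s * s)) ⊎ (v z ≡ v b × ∃[ s ] u z ≡ u a + β * (s * s))
      place z (inj₁ u≡) = inj₁ (u≡ , multiple (v z) (v b) (product z₂ z v₂ u≡))
      place z (inj₂ v≡) = inj₂ (v≡ , multiple (u z) (u a) (square-/ (*-nonzero α₁≢0 α₁≢0) (α₁ , ≡.refl)
        (subst Square (solve 3 (λ b x a → (b :* a) :* (x :* a) := (b :* x) :* (a :* a)) ≡.refl β (u z - u a) α₁)
          (square-* (product z₂ z₁ v₂ u₁) (product z z₁ v≡ u₁)))))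

module PrimeCase (k″ : ℕ) where
  private
    k′ k n : ℕ
    k′ = suc k″
    k = k′ ℕ.+ k′
    n = k ℕ.+ k

  module _ (𝔾 : FieldOnFin (suc n)) (q-prime : Prime (suc n)) (3≤k : 3 ℕ.≤ k) where
    open FieldTheory 𝔾
    open Squares 𝔾
    -- As k′ is a successor, k reduces to `suc (k″ + k′)`, and the three equations between the
    -- parameters hold by computation.
    private module SD = SquareDifferences (k″ ℕ.+ k′) k′ k n ≡.refl ≡.refl ≡.refl 𝔾 q-prime
    private module QC = QuadraticCharacter (k″ ℕ.+ k′) k′ k n ≡.refl ≡.refl ≡.refl

    configuration : ∀ i → i * i ≡ - 1# → (u v : Fin (suc n) → Fin (suc n)) → (∀ {a b} → u a ≡ u b → v a ≡ v b → a ≡ b) →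
                    (∀ a b → Square ((u a - u b) * (v a - v b))) → SD.Configuration u v
    configuration i i²≡-1 u v injective squares = convert
      (Net.shape k′ q-prime (IntegerSums.gap (+≤+ 3≤k)) κ κ-sym κ-diagonal κ-unit κ-sum κ-correlation u v w σ (QC.bit-view 𝔾 1ℤ)
        (QC.∑bit 𝔾 1ℤ QC.plus ≡.refl) injective incidence c c≤k residue-u residue-v residue-w)
      where
      open SD.Residues u v injective squares
      convert : Net.Shape k′ q-prime (IntegerSums.gap (+≤+ 3≤k)) κ κ-sym κ-diagonal κ-unit κ-sum κ-correlation u v w σ (QC.bit-view 𝔾 1ℤ)
                  (QC.∑bit 𝔾 1ℤ QC.plus ≡.refl) injective incidence → SD.Configuration u v
      convert (Net.vertical u-constant) = SD.vertical u-constant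
      convert (Net.horizontal v-constant) = SD.horizontal v-constant
      convert (Net.slanted y σ≡1 w-constant) = SD.slanted y y≢0 w-constant
        where
        y≢0 : y ≢ 0#
        y≢0 y≡0 with () ← ≡.trans (≡.sym (QC.bit-≡⁻ 𝔾 {1ℤ} {y} σ≡1)) (≡.trans (cong (QC.χ 𝔾) y≡0) (QC.χ-0 𝔾))
      convert (Net.cross a b in-cross z₁ z₂) = crossConfiguration i i²≡-1 a b in-cross z₁ z₂

-- Automorphisms and the classification

module Transport {c ℓ q} (F : FiniteField c ℓ q) where
  open FiniteField F hiding (zero)
  open Inverse enumeration public using (to; from; to-cong; from-cong; strictlyInverseˡ; strictlyInverseʳ)

  infixl 6 _⊞_
  infixl 7 _⊠_

  _⊞_ _⊠_ : Fin q → Fin q → Fin q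
  x ⊞ y = from (to x + to y)
  x ⊠ y = from (to x * to y)

  ⊟_ : Fin q → Fin q
  ⊟ x = from (- to x)

  to-⊞ : ∀ x y → to (x ⊞ y) ≈ to x + to y
  to-⊞ x y = strictlyInverseˡ (to x + to y)

  to-⊠ : ∀ x y → to (x ⊠ y) ≈ to x * to y
  to-⊠ x y = strictlyInverseˡ (to x * to y)

  to-⊟ : ∀ x → to (⊟ x) ≈ - to x
  to-⊟ x = strictlyInverseˡ (- to x)

  from-+ : ∀ x y → from (x + y) ≡ from x ⊞ from y
  from-+ x y = from-cong (sym (+-cong (strictlyInverseˡ x) (strictlyInverseˡ y)))

  from-* : ∀ x y → from (x * y) ≡ from x ⊠ from y
  from-* x y = from-cong (sym (*-cong (strictlyInverseˡ x) (strictlyInverseˡ y)))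

  from-neg : ∀ x → from (- x) ≡ ⊟ from x
  from-neg x = from-cong (sym (-‿cong (strictlyInverseˡ x)))

  from-injective : ∀ {x y} → from x ≡ from y → x ≈ y
  from-injective {x} {y} eq = trans (sym (strictlyInverseˡ x)) (trans (to-cong eq) (strictlyInverseˡ y))

  from≡⇒≈to : ∀ {x y} → from x ≡ y → x ≈ to y
  from≡⇒≈to {x} eq = trans (sym (strictlyInverseˡ x)) (to-cong eq)

  private
    by : ∀ {x y z} → x ≈ y → from y ≡ z → from x ≡ z
    by x≈y eq = ≡.trans (from-cong x≈y) eq

  -- Transport of structure along the enumeration. On `Fin q` equality is propositional, so values
  -- can be replaced under `cong`, and sums can run over the field itself.
  𝔾 : FieldOnFin q
  𝔾 = record
    { _+_ = _⊞_ ; _*_ = _⊠_ ; -_ = ⊟_ ; 0# = from 0# ; 1# = from 1#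
    ; isCommutativeRing = record
      { isRing = record
        { +-isAbelianGroup = record
          { isGroup = record
            { isMonoid = record
              { isSemigroup = record
                { isMagma = record { isEquivalence = ≡.isEquivalence ; ∙-cong = cong₂ _⊞_ }
                ; assoc = λ x y z → from-cong (trans (+-congʳ (to-⊞ x y)) (trans (+-assoc _ _ _) (+-congˡ (sym (to-⊞ y z))))) }
              ; identity = (λ x → by (trans (+-congʳ (strictlyInverseˡ 0#)) (+-identityˡ (to x))) (strictlyInverseʳ x))
                         , (λ x → by (trans (+-congˡ (strictlyInverseˡ 0#)) (+-identityʳ (to x))) (strictlyInverseʳ x)) }
            ; inverse = (λ x → from-cong (trans (+-congʳ (to-⊟ x)) (-‿inverseˡ (to x))))
                      , (λ x → from-cong (trans (+-congˡ (to-⊟ x)) (-‿inverseʳ (to x))))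
            ; ⁻¹-cong = cong ⊟_ }
          ; comm = λ x y → from-cong (+-comm (to x) (to y)) }
        ; *-cong = cong₂ _⊠_
        ; *-assoc = λ x y z → from-cong (trans (*-congʳ (to-⊠ x y)) (trans (*-assoc _ _ _) (*-congˡ (sym (to-⊠ y z)))))
        ; *-identity = (λ x → by (trans (*-congʳ (strictlyInverseˡ 1#)) (*-identityˡ (to x))) (strictlyInverseʳ x))
                     , (λ x → by (trans (*-congˡ (strictlyInverseˡ 1#)) (*-identityʳ (to x))) (strictlyInverseʳ x))
        ; distrib = (λ x y z → from-cong (trans (*-congˡ (to-⊞ y z)) (trans (distribˡ _ _ _) (sym (+-cong (to-⊠ x y) (to-⊠ x z))))))
                  , (λ x y z → from-cong (trans (*-congʳ (to-⊞ y z)) (trans (distribʳ _ _ _) (sym (+-cong (to-⊠ y x) (to-⊠ z x)))))) }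
      ; *-comm = λ x y → from-cong (*-comm (to x) (to y)) }
    ; 0≢1 = λ eq → 0≉1 (from-injective eq)
    ; inverse = λ x x≢0 → let y , xy≈1 = inverse (to x) (λ x≈0 → x≢0 (≡.trans (≡.sym (strictlyInverseʳ x)) (from-cong x≈0)))
                          in from y , from-cong (trans (*-congˡ (strictlyInverseˡ y)) xy≈1) }

module Similarities {c ℓ q} (F : FiniteField c ℓ q) where
  open FiniteField F hiding (zero)
  open IntegralPointSets F
  open IntegerCoefficients commutativeRing
  open Solver using (solve; _:+_; _:*_; _:-_; :-_; _:=_)
  private module 𝔽′ = Setoid 𝔽′-setoid

  infixl 6 _-′_

  _-′_ : 𝔽′ → 𝔽′ → 𝔽′
  (a , b) -′ (a′ , b′) = a - a′ , b - b′

  norm′ : 𝔽′ → Carrier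
  norm′ (a , b) = a * a + b * b

  +′-cong : ∀ {z z′ w w′} → z ≈′ z′ → w ≈′ w′ → z +′ w ≈′ z′ +′ w′
  +′-cong (p , p′) (r , r′) = +-cong p r , +-cong p′ r′

  -′-cong : ∀ {z z′ w w′} → z ≈′ z′ → w ≈′ w′ → z -′ w ≈′ z′ -′ w′
  -′-cong (p , p′) (r , r′) = +-cong p (-‿cong r) , +-cong p′ (-‿cong r′)

  □-resp : ∀ {x y} → x ≈ y → □ x → □ y
  □-resp x≈y (t , x≈t²) = t , trans (sym x≈y) x≈t²

  -- z ↦ κ z̃, where z̃ is z or its conjugate, according to e = ±1.
  record Similarity : Set (c ⊔ ℓ) where
    field
      κ₁ κ₂ e ρ ρ⁻¹ : Carrier
      e² : e * e ≈ 1#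
      norm-κ : κ₁ * κ₁ + κ₂ * κ₂ ≈ ρ * ρ
      ρρ⁻¹ : ρ * ρ⁻¹ ≈ 1#

    apply : 𝔽′ → 𝔽′
    apply (a , b) = κ₁ * a - κ₂ * (e * b) , κ₂ * a + κ₁ * (e * b)

    -- Multiplication by the conjugate of κ over its norm ρ², followed by the same conjugation,
    -- which is its own inverse.
    unapply : 𝔽′ → 𝔽′
    unapply (a , b) = (κ₁ * a + κ₂ * b) * (ρ⁻¹ * ρ⁻¹) , e * ((κ₁ * b - κ₂ * a) * (ρ⁻¹ * ρ⁻¹))

    apply-cong : ∀ {z w} → z ≈′ w → apply z ≈′ apply w
    apply-cong (p , p′) = +-cong (*-congˡ p) (-‿cong (*-congˡ (*-congˡ p′))) , +-cong (*-congˡ p) (*-congˡ (*-congˡ p′))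

    unapply-cong : ∀ {z w} → z ≈′ w → unapply z ≈′ unapply w
    unapply-cong (p , p′) = *-congʳ (+-cong (*-congˡ p) (*-congˡ p′)) , *-congˡ (*-congʳ (+-cong (*-congˡ p′) (-‿cong (*-congˡ p))))

    unit : (κ₁ * κ₁ + κ₂ * κ₂) * (ρ⁻¹ * ρ⁻¹) ≈ 1#
    unit = trans (*-congʳ norm-κ) (trans (solve 2 (λ r i → (r :* r) :* (i :* i) := (r :* i) :* (r :* i)) refl ρ ρ⁻¹)
             (trans (*-cong ρρ⁻¹ ρρ⁻¹) (*-identityˡ 1#)))

    e²unit : (e * e) * ((κ₁ * κ₁ + κ₂ * κ₂) * (ρ⁻¹ * ρ⁻¹)) ≈ 1#
    e²unit = trans (*-cong e² unit) (*-identityˡ 1#)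

    scaled : ∀ {s} → s ≈ 1# → ∀ x → s * x ≈ x
    scaled s≈1 x = trans (*-congʳ s≈1) (*-identityˡ x)

    apply-unapply : ∀ z → apply (unapply z) ≈′ z
    apply-unapply (a , b) =
        trans (solve 6 (λ k l e i a b → k :* ((k :* a :+ l :* b) :* (i :* i)) :- l :* (e :* (e :* ((k :* b :- l :* a) :* (i :* i))))
                       := ((k :* k :+ (e :* e) :* (l :* l)) :* (i :* i)) :* a :+ (:1 :- e :* e) :* (k :* l :* b :* (i :* i))) refl κ₁ κ₂ e ρ⁻¹ a b)
          (trans (+-cong (*-congʳ (*-congʳ (+-congˡ (scaled e² (κ₂ * κ₂))))) (*-congʳ 1-e²≈0)) (trans (+-cong (scaled unit a) (zeroˡ _)) (+-identityʳ a)))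
      , trans (solve 6 (λ k l e i a b → l :* ((k :* a :+ l :* b) :* (i :* i)) :+ k :* (e :* (e :* ((k :* b :- l :* a) :* (i :* i))))
                       := (((e :* e) :* (k :* k) :+ l :* l) :* (i :* i)) :* b :+ (:1 :- e :* e) :* (k :* l :* a :* (i :* i))) refl κ₁ κ₂ e ρ⁻¹ a b)
          (trans (+-cong (*-congʳ (*-congʳ (+-congʳ (scaled e² (κ₁ * κ₁))))) (*-congʳ 1-e²≈0)) (trans (+-cong (scaled unit b) (zeroˡ _)) (+-identityʳ b)))
      where
      1-e²≈0 : 1# - e * e ≈ 0#
      1-e²≈0 = trans (+-congˡ (-‿cong e²)) (-‿inverseʳ 1#)

    unapply-apply : ∀ z → unapply (apply z) ≈′ z
    unapply-apply (a , b) =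
        trans (solve 6 (λ k l e i a b → (k :* (k :* a :- l :* (e :* b)) :+ l :* (l :* a :+ k :* (e :* b))) :* (i :* i)
                       := ((k :* k :+ l :* l) :* (i :* i)) :* a) refl κ₁ κ₂ e ρ⁻¹ a b) (scaled unit a)
      , trans (solve 6 (λ k l e i a b → e :* ((k :* (l :* a :+ k :* (e :* b)) :- l :* (k :* a :- l :* (e :* b))) :* (i :* i))
                       := ((e :* e) :* ((k :* k :+ l :* l) :* (i :* i))) :* b) refl κ₁ κ₂ e ρ⁻¹ a b) (scaled e²unit b)

    d²-apply : ∀ u v → d² (apply u) (apply v) ≈ (ρ * ρ) * d² u v
    d²-apply (a , b) (a′ , b′) = begin
      d² (apply (a , b)) (apply (a′ , b′))
        ≈⟨ solve 7 (λ k l e a b a′ b′ →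
             ((k :* a :- l :* (e :* b)) :- (k :* a′ :- l :* (e :* b′))) :* ((k :* a :- l :* (e :* b)) :- (k :* a′ :- l :* (e :* b′)))
             :+ ((l :* a :+ k :* (e :* b)) :- (l :* a′ :+ k :* (e :* b′))) :* ((l :* a :+ k :* (e :* b)) :- (l :* a′ :+ k :* (e :* b′)))
             := (k :* k :+ l :* l) :* ((a :- a′) :* (a :- a′) :+ (e :* e) :* ((b :- b′) :* (b :- b′)))) refl κ₁ κ₂ e a b a′ b′ ⟩
      (κ₁ * κ₁ + κ₂ * κ₂) * ((a - a′) * (a - a′) + (e * e) * ((b - b′) * (b - b′)))
        ≈⟨ *-cong norm-κ (+-congˡ (scaled e² ((b - b′) * (b - b′)))) ⟩
      (ρ * ρ) * d² (a , b) (a′ , b′) ∎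
      where open import Relation.Binary.Reasoning.Setoid ≈-setoid

    module Centred (z₀ : 𝔽′) where

      φ : 𝔽′ → 𝔽′
      φ z = apply (z -′ z₀)

      φ-cong : ∀ {z w} → z ≈′ w → φ z ≈′ φ w
      φ-cong z≈w = apply-cong (-′-cong z≈w 𝔽′.refl)

      ψ : 𝔽′ → 𝔽′
      ψ z = unapply z +′ z₀

      φ-ψ : ∀ z → φ (ψ z) ≈′ z
      φ-ψ z = 𝔽′.trans (apply-cong (cancel (unapply z) z₀)) (apply-unapply z)
        where
        cancel : ∀ z w → (z +′ w) -′ w ≈′ z
        cancel (a , b) (c , d) = solve 2 (λ a c → (a :+ c) :- c := a) refl a c , solve 2 (λ a c → (a :+ c) :- c := a) refl b d

      ψ-φ : ∀ z → ψ (φ z) ≈′ z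
      ψ-φ z = 𝔽′.trans (+′-cong (unapply-apply (z -′ z₀)) 𝔽′.refl) (cancel z z₀)
        where
        cancel : ∀ z w → (z -′ w) +′ w ≈′ z
        cancel (a , b) (c , d) = solve 2 (λ a c → (a :- c) :+ c := a) refl a c , solve 2 (λ a c → (a :- c) :+ c := a) refl b d

      φ-injective : ∀ {z w} → φ z ≈′ φ w → z ≈′ w
      φ-injective {z} {w} eq = 𝔽′.trans (𝔽′.sym (ψ-φ z)) (𝔽′.trans (+′-cong (unapply-cong eq) 𝔽′.refl) (ψ-φ w))

      φ-affine : ∀ u w t → φ (u +′ ι t *′ w) ≈′ φ u +′ ι t *′ apply w
      φ-affine (a , b) (x , y) t = first , second
        where
        x₀ = proj₁ z₀
        y₀ = proj₂ z₀
        first : κ₁ * ((a + (t * x - 0# * y)) - x₀) - κ₂ * (e * ((b + (t * y + 0# * x)) - y₀))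
                ≈ (κ₁ * (a - x₀) - κ₂ * (e * (b - y₀))) + (t * (κ₁ * x - κ₂ * (e * y)) - 0# * (κ₂ * x + κ₁ * (e * y)))
        first = solve 10 (λ k l e a b c d x y t →
                  k :* ((a :+ (t :* x :- :0 :* y)) :- c) :- l :* (e :* ((b :+ (t :* y :+ :0 :* x)) :- d))
                  := (k :* (a :- c) :- l :* (e :* (b :- d))) :+ (t :* (k :* x :- l :* (e :* y)) :- :0 :* (l :* x :+ k :* (e :* y)))) refl κ₁ κ₂ e a b x₀ y₀ x y t
        second : κ₂ * ((a + (t * x - 0# * y)) - x₀) + κ₁ * (e * ((b + (t * y + 0# * x)) - y₀))
                ≈ (κ₂ * (a - x₀) + κ₁ * (e * (b - y₀))) + (t * (κ₂ * x + κ₁ * (e * y)) + 0# * (κ₁ * x - κ₂ * (e * y)))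
        second = solve 10 (λ k l e a b c d x y t →
                  l :* ((a :+ (t :* x :- :0 :* y)) :- c) :+ k :* (e :* ((b :+ (t :* y :+ :0 :* x)) :- d))
                  := (l :* (a :- c) :+ k :* (e :* (b :- d))) :+ (t :* (l :* x :+ k :* (e :* y)) :+ :0 :* (k :* x :- l :* (e :* y)))) refl κ₁ κ₂ e a b x₀ y₀ x y t

      d²-φ : ∀ u v → d² (φ u) (φ v) ≈ (ρ * ρ) * d² u v
      d²-φ u v = trans (d²-apply (u -′ z₀) (v -′ z₀)) (*-congˡ (translate u v z₀))
        where
        translate : ∀ u v w → d² (u -′ w) (v -′ w) ≈ d² u v
        translate (a , b) (c , d) (x , y) = solve 6 (λ a b c d x y → ((a :- x) :- (c :- x)) :* ((a :- x) :- (c :- x)) :+ ((b :- y) :- (d :- y)) :* ((b :- y) :- (d :- y))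
                                               := (a :- c) :* (a :- c) :+ (b :- d) :* (b :- d)) refl a b c d x y

      -- Squared distances are multiplied by the invertible square ρ², which affects membership in □
      -- in neither direction.
      Δ-φ : ∀ u v → Δ (φ u) (φ v) ≡ Δ u v
      Δ-φ u v = cong (λ b → if b then 1 else 0) (does-⇔ (mk⇔ down up) (□? (d² (φ u) (φ v))) (□? (d² u v)))
        where
        down : □ (d² (φ u) (φ v)) → □ (d² u v)
        down (t , eq) = ρ⁻¹ * t , (begin
          d² u v ≈⟨ *-identityˡ _ ⟨
          1# * d² u v ≈⟨ *-congʳ (trans (*-cong ρρ⁻¹ ρρ⁻¹) (*-identityˡ 1#)) ⟨
          ((ρ * ρ⁻¹) * (ρ * ρ⁻¹)) * d² u v ≈⟨ solve 3 (λ r i x → ((r :* i) :* (r :* i)) :* x := (i :* i) :* ((r :* r) :* x)) refl ρ ρ⁻¹ (d² u v) ⟩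
          (ρ⁻¹ * ρ⁻¹) * ((ρ * ρ) * d² u v) ≈⟨ *-congˡ (trans (sym (d²-φ u v)) eq) ⟩
          (ρ⁻¹ * ρ⁻¹) * (t * t) ≈⟨ solve 2 (λ i t → (i :* i) :* (t :* t) := (i :* t) :* (i :* t)) refl ρ⁻¹ t ⟩
          (ρ⁻¹ * t) * (ρ⁻¹ * t) ∎)
          where open import Relation.Binary.Reasoning.Setoid ≈-setoid
        up : □ (d² u v) → □ (d² (φ u) (φ v))
        up (t , eq) = ρ * t , trans (d²-φ u v) (trans (*-congˡ eq) (solve 2 (λ r t → (r :* r) :* (t :* t) := (r :* t) :* (r :* t)) refl ρ t))

      automorphism : Automorphism
      automorphism = record
        { bijection = record
          { to = φ ; cong = φ-cong
          ; bijective = φ-injective , λ z → ψ z , λ {w} w≈ → 𝔽′.trans (φ-cong w≈) (φ-ψ z) }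
        ; Δ-preserving = Δ-φ
        ; line-preserving = λ u w → φ u , apply w ,
            (λ (v , (t , v≈) , z≈) → t , 𝔽′.trans z≈ (𝔽′.trans (φ-cong v≈) (φ-affine u w t)))
          , (λ (t , z≈) → u +′ ι t *′ w , (t , 𝔽′.refl) , 𝔽′.trans z≈ (𝔽′.sym (φ-affine u w t))) }

lookup-injective : ∀ {a ℓ} (S : Setoid a ℓ) {xs} → AllPairs (λ x y → ¬ Setoid._≈_ S x y) xs →
                   ∀ {i j} → Setoid._≈_ S (lookup xs i) (lookup xs j) → i ≡ j
lookup-injective S (x≉ ∷ _) {Fin.zero} {Fin.zero} _ = ≡.refl
lookup-injective S {x ∷ xs} (x≉ ∷ _) {Fin.zero} {Fin.suc j} eq = contradiction eq (All.lookup x≉ (∈ₚ.∈-lookup {xs = xs} j))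
lookup-injective S {x ∷ xs} (x≉ ∷ _) {Fin.suc i} {Fin.zero} eq = contradiction (Setoid.sym S eq) (All.lookup x≉ (∈ₚ.∈-lookup {xs = xs} i))
lookup-injective S (_ ∷ u) {Fin.suc i} {Fin.suc j} eq = cong Fin.suc (lookup-injective S u eq)

-- Enumeration of the point set and recognition of its normal form

module Classification {c ℓ m : Level} {q : ℕ} (F : FiniteField c ℓ q) (P : Pred (IntegralPointSets.𝔽′ F) m)
  (P-integral : IntegralPointSets.IsIntegral F P) (cardinality : IntegralPointSets.HasCardinality F P q) where

  open IntegralPointSets F

  open FiniteField F hiding (zero; ring)
  open RingProperties (CommutativeRing.ring commutativeRing) using (x∙y⁻¹≈ε⇒x≈y)
  open IntegerCoefficients commutativeRing
  open Solver using (solve; _:+_; _:*_; _:-_; :-_; _:=_)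
  open Transport F
  open Similarities F
  open import Relation.Binary.Reasoning.Setoid ≈-setoid
  private
    module 𝔽′ = Setoid 𝔽′-setoid
    open SetoidMembership 𝔽′-setoid using () renaming (_∈_ to _∈ₗ_)

    zs : List 𝔽′
    zs = proj₁ cardinality

    length-zs : length zs ≡ q
    length-zs = proj₁ (proj₂ (proj₂ cardinality))

    members : ∀ z → P z ⇔ z ∈ₗ zs
    members = proj₂ (proj₂ (proj₂ cardinality))

  pt : Fin q → 𝔽′
  pt i = lookup zs (Fin.cast (≡.sym length-zs) i)

  pt-injective : ∀ {i j} → pt i ≈′ pt j → i ≡ j
  pt-injective {i} {j} eq = ≡.trans (≡.sym (Finₚ.cast-involutive length-zs (≡.sym length-zs) i))
    (≡.trans (cong (Fin.cast length-zs) (lookup-injective 𝔽′-setoid (proj₁ (proj₂ cardinality)) eq))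
             (Finₚ.cast-involutive length-zs (≡.sym length-zs) j))

  pt∈P : ∀ i → P (pt i)
  pt∈P i = Equivalence.from (members (pt i)) (SetoidMembershipₚ.∈-lookup 𝔽′-setoid zs (Fin.cast (≡.sym length-zs) i))

  P⇒pt : ∀ {z} → P z → ∃[ i ] z ≈′ pt i
  P⇒pt {z} z∈P = Fin.cast length-zs (Any.index z∈zs) ,
    𝔽′.trans (Anyₚ.lookup-index z∈zs) (𝔽′.reflexive (cong (lookup zs) (≡.sym (Finₚ.cast-involutive (≡.sym length-zs) length-zs (Any.index z∈zs)))))
    where
    z∈zs : z ∈ₗ zs
    z∈zs = Equivalence.to (members z) z∈P

  -- As P has q elements, it fills any set containing it that injects into the field.
  isomorphic : ∀ {x} (T : Similarity) (z₀ : 𝔽′) (X : Pred 𝔽′ x) →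
               (∀ {z w} → z ≈′ w → X z → X w) → (f : 𝔽′ → Carrier) → (∀ {z w} → z ≈′ w → f z ≈ f w) →
               (∀ {z w} → X z → X w → f z ≈ f w → z ≈′ w) → (∀ i → X (Similarity.Centred.φ T z₀ (pt i))) → Isomorphic P X
  isomorphic T z₀ X X-resp f f-cong f-injective φ∈X = T.automorphism , into , onto
    where
    module T = Similarity.Centred T z₀
    into : ∀ {z} → Image T.φ P z → X z
    into (u , u∈P , z≈φu) = let i , u≈ = P⇒pt u∈P in X-resp (𝔽′.sym (𝔽′.trans z≈φu (T.φ-cong u≈))) (φ∈X i)
    onto : ∀ {z} → X z → Image T.φ P z
    onto {z} z∈X = let i , eq = injective⇒surjective code-injective (from (f z)) in
                   pt i , pt∈P i , 𝔽′.sym (f-injective (φ∈X i) z∈X (from-injective eq))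
      where
      code-injective : Injective _≡_ _≡_ (λ i → from (f (T.φ (pt i))))
      code-injective eq = pt-injective (T.φ-injective (f-injective (φ∈X _) (φ∈X _) (from-injective eq)))

  *-cancel : ∀ {x y z} → ¬ x ≈ 0# → x * y ≈ x * z → y ≈ z
  *-cancel {x} {y} {z} x≉0 eq = let i , xi≈1 = inverse x x≉0 in begin
    y ≈⟨ *-identityˡ y ⟨
    1# * y ≈⟨ *-congʳ xi≈1 ⟨
    (x * i) * y ≈⟨ solve 3 (λ x i y → (x :* i) :* y := i :* (x :* y)) refl x i y ⟩
    i * (x * y) ≈⟨ *-congˡ eq ⟩
    i * (x * z) ≈⟨ solve 3 (λ x i y → (x :* i) :* y := i :* (x :* y)) refl x i z ⟨
    (x * i) * z ≈⟨ *-congʳ xi≈1 ⟩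
    1# * z ≈⟨ *-identityˡ z ⟩
    z ∎

  δ′ : Fin q → Fin q → 𝔽′
  δ′ x x₀ = pt x -′ pt x₀

  collinear⇒realLine : ∀ x₀ x₁ → ¬ norm′ (δ′ x₁ x₀) ≈ 0# →
                       (∀ x → proj₂ (δ′ x x₀) * proj₁ (δ′ x₁ x₀) ≈ proj₁ (δ′ x x₀) * proj₂ (δ′ x₁ x₀)) → Isomorphic P realLine
  collinear⇒realLine x₀ x₁ N≉0 collinear with P-integral (pt x₁) (pt x₀) (pt∈P x₁) (pt∈P x₀)
  -- The first `proj₁` is the coordinate on the line, the second the proof that it respects `_≈′_`.
  ... | s , N≈s² = isomorphic T (pt x₀) realLine resp proj₁ proj₁ injective on-line
    where
    w₁ = proj₁ (δ′ x₁ x₀)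
    w₂ = proj₂ (δ′ x₁ x₀)
    s≉0 : ¬ s ≈ 0#
    s≉0 s≈0 = N≉0 (trans N≈s² (trans (*-congʳ s≈0) (zeroˡ s)))
    i = proj₁ (inverse s s≉0)
    si≈1 : s * i ≈ 1#
    si≈1 = proj₂ (inverse s s≉0)
    T : Similarity
    T = record
      -- κ is the conjugate of w = w₁ + w₂ i over s². The norm of w is s², an integral distance, so
      -- κ = 1/w carries the direction of the line to 1; its norm is 1/s², whence ρ = 1/s.
      { κ₁ = w₁ * (i * i) ; κ₂ = - (w₂ * (i * i)) ; e = 1# ; ρ = i ; ρ⁻¹ = s
      ; e² = *-identityˡ 1#
      ; norm-κ = begin
          (w₁ * (i * i)) * (w₁ * (i * i)) + - (w₂ * (i * i)) * - (w₂ * (i * i))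
            ≈⟨ solve 3 (λ a b i → (a :* (i :* i)) :* (a :* (i :* i)) :+ :- (b :* (i :* i)) :* :- (b :* (i :* i)) := (a :* a :+ b :* b) :* ((i :* i) :* (i :* i))) refl w₁ w₂ i ⟩
          (w₁ * w₁ + w₂ * w₂) * ((i * i) * (i * i)) ≈⟨ *-congʳ N≈s² ⟩
          (s * s) * ((i * i) * (i * i)) ≈⟨ solve 2 (λ s i → (s :* s) :* ((i :* i) :* (i :* i)) := ((s :* i) :* (s :* i)) :* (i :* i)) refl s i ⟩
          ((s * i) * (s * i)) * (i * i) ≈⟨ *-congʳ (trans (*-cong si≈1 si≈1) (*-identityˡ 1#)) ⟩
          1# * (i * i) ≈⟨ *-identityˡ (i * i) ⟩
          i * i ∎
      ; ρρ⁻¹ = trans (*-comm i s) si≈1 }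
    resp : ∀ {z w} → z ≈′ w → realLine z → realLine w
    resp z≈w (t , t∈U , z≈) = t , t∈U , 𝔽′.trans (𝔽′.sym z≈w) z≈
    second≈0 : ∀ {z} → realLine z → proj₂ z ≈ 0#
    second≈0 (t , _ , _ , eq) = trans eq (solve 1 (λ t → :1 :* :0 :+ :0 :* t := :0) refl t)
    injective : ∀ {z w} → realLine z → realLine w → proj₁ z ≈ proj₁ w → z ≈′ w
    injective z∈ w∈ eq = eq , trans (second≈0 z∈) (sym (second≈0 w∈))
    on-line : ∀ x → realLine (Similarity.Centred.φ T (pt x₀) (pt x))
    on-line x = _ , tt , solve 1 (λ t → t := :1 :* t :- :0 :* :0) refl _ , (begin
      - (w₂ * (i * i)) * a + (w₁ * (i * i)) * (1# * b) ≈⟨ solve 5 (λ v w i a b → :- (v :* (i :* i)) :* a :+ (w :* (i :* i)) :* (:1 :* b) := (i :* i) :* (b :* w :- a :* v)) refl w₂ w₁ i a b ⟩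
      (i * i) * (b * w₁ - a * w₂) ≈⟨ *-congˡ (trans (+-congʳ (collinear x)) (-‿inverseʳ (a * w₂))) ⟩
      (i * i) * 0# ≈⟨ solve 2 (λ i t → (i :* i) :* :0 := :1 :* :0 :+ :0 :* t) refl i _ ⟩
      1# * 0# + 0# * (w₁ * (i * i) * a - - (w₂ * (i * i)) * (1# * b)) ∎)
      where
      a = proj₁ (δ′ x x₀)
      b = proj₂ (δ′ x x₀)

  □⇒Square : ∀ {x} → □ x → Squares.Square 𝔾 (from x)
  □⇒Square (t , x≈t²) = from t , ≡.trans (from-cong x≈t²) (from-* t t)

  from-- : ∀ x y → from (x - y) ≡ FieldOnFin._-_ 𝔾 (from x) (from y)
  from-- x y = ≡.trans (from-+ x (- y)) (cong (λ s → from x ⊞ s) (from-neg y))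

-- From the copy on `Fin q` back to the given field

module CongruentToThree {c ℓ m : Level} (j : ℕ) (F : FiniteField c ℓ (suc (suc (j ℕ.+ j) ℕ.+ suc (j ℕ.+ j))))
  (P : Pred (IntegralPointSets.𝔽′ F) m) (P-integral : IntegralPointSets.IsIntegral F P)
  (cardinality : IntegralPointSets.HasCardinality F P (suc (suc (j ℕ.+ j) ℕ.+ suc (j ℕ.+ j)))) where

  open IntegralPointSets F using (Isomorphic; realLine)
  open Classification F P P-integral cardinality
  open Transport F
  open Similarities F
  private
    module F = FiniteField F
    module G = FieldTheory 𝔾
    open Gaussian 𝔾 renaming (ι to ιᴳ)
    module C = NonsquareMinusOne j
    g : Fin _ → K
    g x = from (proj₁ (pt x)) , from (proj₂ (pt x))

  from-norm : ∀ z → from (norm′ z) ≡ norm (from (proj₁ z) , from (proj₂ z))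
  from-norm (a , b) = ≡.trans (from-+ (a F.* a) (b F.* b)) (cong₂ _⊞_ (from-* a a) (from-* b b))

  from-δ : ∀ x x₀ → g x ⊝ g x₀ ≡ (from (proj₁ (δ′ x x₀)) , from (proj₂ (δ′ x x₀)))
  from-δ x x₀ = ≡.trans (⊝-components (g x) (g x₀)) (≡.sym (cong₂ _,_ (from-- (proj₁ (pt x)) (proj₁ (pt x₀))) (from-- (proj₂ (pt x)) (proj₂ (pt x₀)))))

  norm-δ : ∀ x x₀ → norm (g x ⊝ g x₀) ≡ from (norm′ (δ′ x x₀))
  norm-δ x x₀ = ≡.trans (cong norm (from-δ x x₀)) (≡.sym (from-norm (δ′ x x₀)))

  clique : C.Clique 𝔾 g
  clique = record
    { injective = λ eq → pt-injective (from-injective (cong proj₁ eq) , from-injective (cong proj₂ eq))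
    ; integralDistances = λ x y → subst (Squares.Square 𝔾) (≡.sym (norm-δ x y)) (□⇒Square (P-integral (pt x) (pt y) (pt∈P x) (pt∈P y))) }

  isomorphic-realLine : Isomorphic P realLine
  isomorphic-realLine = collinear⇒realLine x₀ x₁ (λ N≈0 → proj₁ collinear (≡.trans (norm-δ x₁ x₀) (from-cong N≈0))) parallel
    where
    x₀ x₁ : Fin _
    x₀ = Fin.zero
    x₁ = Fin.suc Fin.zero
    collinear = C.clique⇒collinear 𝔾 clique
    W : K
    W = g x₁ ⊝ g x₀
    D : Fin _ → K
    D x = g x ⊝ g x₀
    parallel-G : ∀ x → proj₂ (D x) ⊠ proj₁ W ≡ proj₁ (D x) ⊠ proj₂ W
    parallel-G x with proj₂ collinear x
    ... | t , eq = ≡.trans (cong (λ d → proj₂ d ⊠ proj₁ W) D≡) (≡.trans (G.solve 3 (λ t a b → (t G.:* b G.:+ G.:0 G.:* a) G.:* a G.:= (t G.:* a G.:- G.:0 G.:* b) G.:* b) ≡.refl t (proj₁ W) (proj₂ W))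
                     (≡.sym (cong (λ d → proj₁ d ⊠ proj₂ W) D≡)))
      where
      module KI = CommutativeRing ring-K
      D≡ : D x ≡ (FieldOnFin._-_ 𝔾 (t ⊠ proj₁ W) (G.0# ⊠ proj₂ W) , (t ⊠ proj₂ W) ⊞ (G.0# ⊠ proj₁ W))
      D≡ = ≡.trans (cong (λ z → z ⊝ g x₀) eq) (≡.trans (≡.trans (cong (λ z → z ⊝ g x₀) (KI.+-comm (g x₀) (ιᴳ t ⊗ W)))
             (≡.trans (KI.+-assoc (ιᴳ t ⊗ W) (g x₀) (negᴷ (g x₀))) (≡.trans (cong (λ z → (ιᴳ t ⊗ W) ⊕ z) (KI.-‿inverseʳ (g x₀))) (KI.+-identityʳ (ιᴳ t ⊗ W))))) (⊗-components (ιᴳ t) W))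
    parallel : ∀ x → (proj₂ (δ′ x x₀) F.* proj₁ (δ′ x₁ x₀)) F.≈ (proj₁ (δ′ x x₀) F.* proj₂ (δ′ x₁ x₀))
    parallel x = from-injective (≡.trans (from-* (proj₂ (δ′ x x₀)) (proj₁ (δ′ x₁ x₀)))
      (≡.trans (≡.trans (≡.sym (cong₂ (λ d w → proj₂ d ⊠ proj₁ w) (from-δ x x₀) (from-δ x₁ x₀)))
                (≡.trans (parallel-G x) (cong₂ (λ d w → proj₁ d ⊠ proj₂ w) (from-δ x x₀) (from-δ x₁ x₀))))
       (≡.sym (from-* (proj₁ (δ′ x x₀)) (proj₂ (δ′ x₁ x₀))))))

module CongruentToOne {c ℓ m : Level} (k″ : ℕ) (F : FiniteField c ℓ (suc (suc k″ ℕ.+ suc k″ ℕ.+ (suc k″ ℕ.+ suc k″))))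
  (P : Pred (IntegralPointSets.𝔽′ F) m) (P-integral : IntegralPointSets.IsIntegral F P)
  (cardinality : IntegralPointSets.HasCardinality F P (suc (suc k″ ℕ.+ suc k″ ℕ.+ (suc k″ ℕ.+ suc k″))))
  (q-prime : Prime (suc (suc k″ ℕ.+ suc k″ ℕ.+ (suc k″ ℕ.+ suc k″)))) (3≤k : 3 ℕ.≤ suc k″ ℕ.+ suc k″)
  (ω : FiniteField.Carrier F) (ω² : FiniteField._≈_ F (FiniteField._*_ F ω ω) (FiniteField.-_ F (FiniteField.1# F))) where

  private
    k : ℕ
    k = suc k″ ℕ.+ suc k″

  open IntegralPointSets F

  open Classification F P P-integral cardinality
  open FiniteField F hiding (zero; ring)
  open RingProperties (CommutativeRing.ring commutativeRing) using (x∙y⁻¹≈ε⇒x≈y)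
  open IntegerCoefficients commutativeRing
  open Solver using (solve; _:+_; _:*_; _:-_; :-_; _:=_)
  open Transport F
  open Similarities F
  open import Relation.Binary.Reasoning.Setoid ≈-setoid
  private
    module 𝔽′ = Setoid 𝔽′-setoid
    module G = FieldTheory 𝔾
    module SG = Squares 𝔾
    module QC = QuadraticCharacter (k″ ℕ.+ suc k″) (suc k″) k (k ℕ.+ k) ≡.refl ≡.refl ≡.refl

  half : ∃[ h ] (1# + 1#) * h ≈ 1#
  half = inverse (1# + 1#) (λ 2≈0 → SG.2≢0 k ≡.refl (≡.trans (≡.sym (from-+ 1# 1#)) (from-cong 2≈0)))

  h : Carrier
  h = proj₁ half

  2h : (1# + 1#) * h ≈ 1#
  2h = proj₂ half

  2≉0 : ¬ 1# + 1# ≈ 0#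
  2≉0 2≈0 = 0≉1 (trans (sym (trans (*-congʳ 2≈0) (zeroˡ h))) 2h)

  halve : ∀ {x y} → x + x ≈ y + y → x ≈ y
  halve {x} {y} eq = *-cancel 2≉0 (trans (double x) (trans eq (sym (double y))))
    where
    double : ∀ x → (1# + 1#) * x ≈ x + x
    double = solve 1 (λ x → (:1 :+ :1) :* x := x :+ x) refl

  ωω : ∀ x → ω * (ω * x) ≈ - x
  ωω x = trans (sym (*-assoc ω ω x)) (trans (*-congʳ ω²) (solve 1 (λ x → :- :1 :* x := :- x) refl x))

  ω≉0 : ¬ ω ≈ 0#
  ω≉0 ω≈0 = 0≉1 (begin
    0# ≈⟨ solve 0 (:0 := :- (:0 :* :0)) refl ⟩
    - (0# * 0#) ≈⟨ -‿cong (*-cong ω≈0 ω≈0) ⟨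
    - (ω * ω) ≈⟨ -‿cong ω² ⟩
    - - 1# ≈⟨ solve 0 (:- :- :1 := :1) refl ⟩
    1# ∎)

  -- The isotropic coordinates, in which the squared distance is ΔU ΔV.
  U′ V′ : 𝔽′ → Carrier
  U′ (a , b) = a + ω * b
  V′ (a , b) = a - ω * b

  U′-δ : ∀ x x₀ → U′ (pt x) - U′ (pt x₀) ≈ U′ (δ′ x x₀)
  U′-δ x x₀ = solve 5 (λ a b a′ b′ w → (a :+ w :* b) :- (a′ :+ w :* b′) := (a :- a′) :+ w :* (b :- b′)) refl
                (proj₁ (pt x)) (proj₂ (pt x)) (proj₁ (pt x₀)) (proj₂ (pt x₀)) ω

  V′-δ : ∀ x x₀ → V′ (pt x) - V′ (pt x₀) ≈ V′ (δ′ x x₀)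
  V′-δ x x₀ = solve 5 (λ a b a′ b′ w → (a :- w :* b) :- (a′ :- w :* b′) := (a :- a′) :- w :* (b :- b′)) refl
                (proj₁ (pt x)) (proj₂ (pt x)) (proj₁ (pt x₀)) (proj₂ (pt x₀)) ω

  U′V′ : ∀ z → U′ z * V′ z ≈ norm′ z
  U′V′ (a , b) = trans (solve 3 (λ a b w → (a :+ w :* b) :* (a :- w :* b) := a :* a :- (w :* w) :* (b :* b)) refl a b ω)
    (trans (+-congˡ (-‿cong (*-congʳ ω²))) (solve 2 (λ a b → a :* a :- (:- :1) :* (b :* b) := a :* a :+ b :* b) refl a b))

  U′V′-injective : ∀ z w → U′ z ≈ U′ w → V′ z ≈ V′ w → z ≈′ w
  U′V′-injective (a , b) (c , d) u≈ v≈ =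
      halve (trans (solve 3 (λ a b w → a :+ a := (a :+ w :* b) :+ (a :- w :* b)) refl a b ω)
        (trans (+-cong u≈ v≈) (solve 3 (λ a b w → (a :+ w :* b) :+ (a :- w :* b) := a :+ a) refl c d ω)))
    , *-cancel ω≉0 (halve (trans (solve 3 (λ a b w → w :* b :+ w :* b := (a :+ w :* b) :- (a :- w :* b)) refl a b ω)
        (trans (+-cong u≈ (-‿cong v≈)) (solve 3 (λ a b w → (a :+ w :* b) :- (a :- w :* b) := w :* b :+ w :* b) refl c d ω))))

  u v : Fin (suc (k ℕ.+ k)) → Fin (suc (k ℕ.+ k))
  u x = from (U′ (pt x))
  v x = from (V′ (pt x))

  squares : ∀ a b → SG.Square ((u a G.- u b) G.* (v a G.- v b))
  squares a b = subst SG.Square (≡.trans (from-* (U′ (pt a) - U′ (pt b)) (V′ (pt a) - V′ (pt b))) (cong₂ G._*_ (from-- (U′ (pt a)) (U′ (pt b))) (from-- (V′ (pt a)) (V′ (pt b)))))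
    (□⇒Square (□-resp (sym (trans (*-cong (U′-δ a b) (V′-δ a b)) (U′V′ (δ′ a b)))) (P-integral (pt a) (pt b) (pt∈P a) (pt∈P b))))

  open SquareDifferences (k″ ℕ.+ suc k″) (suc k″) k (k ℕ.+ k) ≡.refl ≡.refl ≡.refl 𝔾 q-prime using (Configuration; vertical; horizontal; slanted; cross)

  configuration : Configuration u v
  configuration = PrimeCase.configuration k″ 𝔾 q-prime 3≤k (from ω) (≡.trans (≡.sym (from-* ω ω)) (≡.trans (from-cong ω²) (from-neg 1#))) u v
    (λ {a} {b} u≡ v≡ → pt-injective (U′V′-injective (pt a) (pt b) (from-injective u≡) (from-injective v≡))) squares

  nonsquare : ∃[ ν ] ¬ □ ν
  nonsquare = to ν , λ □ν → contradiction (≡.trans (≡.sym χν) (QC.χ-square 𝔾 ν≢0 (subst SG.Square (strictlyInverseʳ ν) (□⇒Square □ν)))) (λ ())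
    where
    ν = proj₁ (QC.nonresidue 𝔾)
    χν = proj₂ (QC.nonresidue 𝔾)
    ν≢0 : ν ≢ G.0#
    ν≢0 ν≡0 with () ← ≡.trans (≡.sym χν) (≡.trans (cong (QC.χ 𝔾) ν≡0) (QC.χ-0 𝔾))

  isometry : ∀ e → e * e ≈ 1# → Similarity
  isometry e e² = record { κ₁ = 1# ; κ₂ = 0# ; e = e ; ρ = 1# ; ρ⁻¹ = 1# ; e² = e²
                         ; norm-κ = solve 0 (:1 :* :1 :+ :0 :* :0 := :1 :* :1) refl ; ρρ⁻¹ = *-identityˡ 1# }

  isotropicLine-∈ : ∀ {z} → proj₂ z ≈ ω * proj₁ z → isotropicLine ω z
  isotropicLine-∈ {a , b} eq = a , tt , solve 2 (λ a w → a := :1 :* a :- w :* :0) refl a ω , trans eq (solve 2 (λ a w → w :* a := :1 :* :0 :+ w :* a) refl a ω)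

  isotropicLine-∋ : ∀ {z} → isotropicLine ω z → proj₂ z ≈ ω * proj₁ z
  isotropicLine-∋ {a , b} (s , _ , a≈ , b≈) = trans b≈ (trans (solve 2 (λ s w → :1 :* :0 :+ w :* s := w :* (:1 :* s :- w :* :0)) refl s ω) (*-congˡ (sym a≈)))

  -- e = 1 serves a constant U′ and e = -1 a constant V′: conjugation exchanges the two isotropic
  -- directions, so one normal form is enough. Multiplying a = - ω e b by ω gives ω a = e b.
  isotropic : ∀ e → e * e ≈ 1# → ∀ x₀ → (∀ x → proj₁ (δ′ x x₀) + ω * (e * proj₂ (δ′ x x₀)) ≈ 0#) → Isomorphic P (isotropicLine ω)
  isotropic e e² x₀ on-line = isomorphic (isometry e e²) (pt x₀) (isotropicLine ω) (λ z≈w (t , t∈U , z≈) → t , t∈U , 𝔽′.trans (𝔽′.sym z≈w) z≈) proj₁ proj₁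
    (λ {z} {w} z∈ w∈ eq → eq , trans (isotropicLine-∋ {z} z∈) (trans (*-congˡ eq) (sym (isotropicLine-∋ {w} w∈))))
    (λ x → isotropicLine-∈ (image (proj₁ (δ′ x x₀)) (proj₂ (δ′ x x₀)) (on-line x)))
    where
    image : ∀ a b → a + ω * (e * b) ≈ 0# → 0# * a + 1# * (e * b) ≈ ω * (1# * a - 0# * (e * b))
    image a b eq = begin
      0# * a + 1# * (e * b) ≈⟨ solve 3 (λ a b w → :0 :* a :+ :1 :* b := :- (:- b)) refl a (e * b) ω ⟩
      - - (e * b) ≈⟨ -‿cong (ωω (e * b)) ⟨
      - (ω * (ω * (e * b))) ≈⟨ solve 3 (λ a b w → :- (w :* (w :* b)) := w :* (:1 :* a :- :0 :* b) :- w :* (a :+ w :* b)) refl a (e * b) ω ⟩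
      ω * (1# * a - 0# * (e * b)) - ω * (a + ω * (e * b)) ≈⟨ +-congˡ (-‿cong (*-congˡ eq)) ⟩
      ω * (1# * a - 0# * (e * b)) - ω * 0# ≈⟨ solve 2 (λ w x → x :- w :* :0 := x) refl ω _ ⟩
      ω * (1# * a - 0# * (e * b)) ∎

  -- The injection into the field that `isomorphic` asks for. A point s (1 + ω i) is sent to its
  -- first coordinate s, a square; a point s (1 - ω i) off the first line is sent to ν s, a
  -- nonsquare. The common point 0 is counted on the first line.
  isotropicSquares-injective : ∃[ f ] (∀ {z w} → z ≈′ w → f z ≈ f w) × (∀ {z w} → isotropicSquares ω z → isotropicSquares ω w → f z ≈ f w → z ≈′ w)
  isotropicSquares-injective = f , f-cong , λ {z} {w} → f-injective z w
    where
    ν = proj₁ nonsquare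
    OnLine : 𝔽′ → Set ℓ
    OnLine z = proj₂ z ≈ ω * proj₁ z
    code : ∀ z → Dec (OnLine z) → Carrier
    code z (yes _) = proj₁ z
    code z (no _) = ν * proj₁ z
    f : 𝔽′ → Carrier
    f z = code z (proj₂ z ≟ (ω * proj₁ z))
    code-cong : ∀ z w d d′ → z ≈′ w → code z d ≈ code w d′
    code-cong z w (yes _) (yes _) (a≈ , _) = a≈
    code-cong z w (no _) (no _) (a≈ , _) = *-congˡ a≈
    code-cong z w (yes p) (no ¬p) (a≈ , b≈) = contradiction (trans (sym b≈) (trans p (*-congˡ a≈))) ¬p
    code-cong z w (no ¬p) (yes p) (a≈ , b≈) = contradiction (trans b≈ (trans p (*-congˡ (sym a≈)))) ¬p
    f-cong : ∀ {z w} → z ≈′ w → f z ≈ f w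
    f-cong {z} {w} = code-cong z w (proj₂ z ≟ (ω * proj₁ z)) (proj₂ w ≟ (ω * proj₁ w))
    first-square : ∀ z → isotropicSquares ω z → □ (proj₁ z)
    first-square z (inj₁ (s , s∈□ , a≈ , _)) = □-resp (trans (solve 2 (λ s w → s := :1 :* s :- w :* :0) refl s ω) (sym a≈)) s∈□
    first-square z (inj₂ (s , s∈□ , a≈ , _)) = □-resp (trans (solve 2 (λ s w → s := :1 :* s :- (:- w) :* :0) refl s ω) (sym a≈)) s∈□
    off-line : ∀ z → isotropicSquares ω z → ¬ OnLine z → proj₂ z ≈ - ω * proj₁ z
    off-line z (inj₁ (s , _ , a≈ , b≈)) ¬p = contradiction (trans b≈ (trans (solve 2 (λ s w → :1 :* :0 :+ w :* s := w :* (:1 :* s :- w :* :0)) refl s ω) (*-congˡ (sym a≈)))) ¬p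
    off-line z (inj₂ (s , _ , a≈ , b≈)) _ = trans b≈ (trans (solve 2 (λ s w → :1 :* :0 :+ (:- w) :* s := (:- w) :* (:1 :* s :- (:- w) :* :0)) refl s ω) (*-congˡ (sym a≈)))
    mixed : ∀ z w → isotropicSquares ω z → isotropicSquares ω w → ¬ OnLine w → ¬ proj₁ z ≈ ν * proj₁ w
    mixed z w z∈ w∈ ¬p eq = quotient (first-square z z∈) (first-square w w∈)
      where
      quotient : □ (proj₁ z) → □ (proj₁ w) → _
      quotient (s , z≈s²) (t , w≈t²) = proj₂ nonsquare (s * i , sym (begin
          (s * i) * (s * i) ≈⟨ solve 2 (λ s i → (s :* i) :* (s :* i) := (s :* s) :* (i :* i)) refl s i ⟩
          (s * s) * (i * i) ≈⟨ *-congʳ (trans (sym z≈s²) (trans eq (*-congˡ w≈t²))) ⟩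
          (ν * (t * t)) * (i * i) ≈⟨ solve 3 (λ n t i → (n :* (t :* t)) :* (i :* i) := n :* ((t :* i) :* (t :* i))) refl ν t i ⟩
          ν * ((t * i) * (t * i)) ≈⟨ *-congˡ (trans (*-cong ti≈1 ti≈1) (*-identityˡ 1#)) ⟩
          ν * 1# ≈⟨ *-identityʳ ν ⟩
          ν ∎))
        where
        t≉0 : ¬ t ≈ 0#
        t≉0 t≈0 = ¬p (trans (off-line w w∈ ¬p) (trans (*-congˡ w≈0) (trans (solve 1 (λ w → (:- w) :* :0 := w :* :0) refl ω) (*-congˡ (sym w≈0)))))
          where
          w≈0 : proj₁ w ≈ 0#
          w≈0 = trans w≈t² (trans (*-congʳ t≈0) (zeroˡ t))
        i = proj₁ (inverse t t≉0)
        ti≈1 = proj₂ (inverse t t≉0)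
    ν≉0 : ¬ ν ≈ 0#
    ν≉0 ν≈0 = proj₂ nonsquare (0# , trans ν≈0 (sym (zeroˡ 0#)))
    code-injective : ∀ z w d d′ → isotropicSquares ω z → isotropicSquares ω w → code z d ≈ code w d′ → z ≈′ w
    code-injective z w (yes p) (yes p′) z∈ w∈ eq = eq , trans p (trans (*-congˡ eq) (sym p′))
    code-injective z w (no ¬p) (no ¬p′) z∈ w∈ eq = a≈ , trans (off-line z z∈ ¬p) (trans (*-congˡ a≈) (sym (off-line w w∈ ¬p′)))
      where
      a≈ : proj₁ z ≈ proj₁ w
      a≈ = *-cancel ν≉0 eq
    code-injective z w (yes p) (no ¬p) z∈ w∈ eq = contradiction eq (mixed z w z∈ w∈ ¬p)
    code-injective z w (no ¬p) (yes p) z∈ w∈ eq = contradiction (sym eq) (mixed w z w∈ z∈ ¬p)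
    f-injective : ∀ z w → isotropicSquares ω z → isotropicSquares ω w → f z ≈ f w → z ≈′ w
    f-injective z w = code-injective z w (proj₂ z ≟ (ω * proj₁ z)) (proj₂ w ≟ (ω * proj₁ w))

  result : Isomorphic P realLine ⊎ Isomorphic P (isotropicLine ω) ⊎ Isomorphic P (isotropicSquares ω)
  result = from-configuration configuration
    where
    o : Fin (suc (k ℕ.+ k))
    o = Fin.zero
    from-configuration : Configuration u v → Isomorphic P realLine ⊎ Isomorphic P (isotropicLine ω) ⊎ Isomorphic P (isotropicSquares ω)
    from-configuration (vertical u-constant) = inj₂ (inj₁ (isotropic 1# (*-identityˡ 1#) o (λ x → begin
      proj₁ (δ′ x o) + ω * (1# * proj₂ (δ′ x o)) ≈⟨ +-congˡ (*-congˡ (*-identityˡ _)) ⟩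
      U′ (δ′ x o) ≈⟨ U′-δ x o ⟨
      U′ (pt x) - U′ (pt o) ≈⟨ +-congʳ (from-injective (u-constant x o)) ⟩
      U′ (pt o) - U′ (pt o) ≈⟨ -‿inverseʳ (U′ (pt o)) ⟩
      0# ∎)))
    from-configuration (horizontal v-constant) = inj₂ (inj₁ (isotropic (- 1#) (solve 0 (:- :1 :* :- :1 := :1) refl) o (λ x → begin
      proj₁ (δ′ x o) + ω * (- 1# * proj₂ (δ′ x o)) ≈⟨ solve 3 (λ a b w → a :+ w :* (:- :1 :* b) := a :- w :* b) refl (proj₁ (δ′ x o)) (proj₂ (δ′ x o)) ω ⟩
      V′ (δ′ x o) ≈⟨ V′-δ x o ⟨
      V′ (pt x) - V′ (pt o) ≈⟨ +-congʳ (from-injective (v-constant x o)) ⟩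
      V′ (pt o) - V′ (pt o) ≈⟨ -‿inverseʳ (V′ (pt o)) ⟩
      0# ∎)))
    from-configuration (slanted y y≢0 w-constant) = inj₁ (collinear⇒realLine o x₁ N≉0 parallel)
      where
      x₁ : Fin (suc (k ℕ.+ k))
      x₁ = Fin.suc Fin.zero
      Y = to y
      Y≉0 : ¬ Y ≈ 0#
      Y≉0 Y≈0 = y≢0 (≡.trans (≡.sym (strictlyInverseʳ y)) (from-cong Y≈0))
      from-w : ∀ x → from (V′ (pt x) - Y * U′ (pt x)) ≡ v x G.- y G.* u x
      from-w x = ≡.trans (from-- (V′ (pt x)) (Y * U′ (pt x))) (cong (λ s → v x G.- s) (≡.trans (from-* Y (U′ (pt x))) (cong (λ s → s G.* u x) (strictlyInverseʳ y))))
      slope : ∀ x → V′ (δ′ x o) ≈ Y * U′ (δ′ x o)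
      slope x = begin
        V′ (δ′ x o) ≈⟨ V′-δ x o ⟨
        V′ (pt x) - V′ (pt o) ≈⟨ solve 5 (λ v u v₀ u₀ y → v :- v₀ := ((v :- y :* u) :- (v₀ :- y :* u₀)) :+ y :* (u :- u₀)) refl (V′ (pt x)) (U′ (pt x)) (V′ (pt o)) (U′ (pt o)) Y ⟩
        ((V′ (pt x) - Y * U′ (pt x)) - (V′ (pt o) - Y * U′ (pt o))) + Y * (U′ (pt x) - U′ (pt o))
          ≈⟨ +-cong (trans (+-congʳ (from-injective (≡.trans (from-w x) (≡.trans (w-constant x o) (≡.sym (from-w o)))))) (-‿inverseʳ _)) (*-congˡ (U′-δ x o)) ⟩
        0# + Y * U′ (δ′ x o) ≈⟨ +-identityˡ _ ⟩
        Y * U′ (δ′ x o) ∎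
      -- The norm is U′ V′ = Y U′², and U′ = 0 would make V′ vanish too, so that the two points
      -- would coincide.
      N≉0 : ¬ norm′ (δ′ x₁ o) ≈ 0#
      N≉0 N≈0 = U₁≉0 (*-cancel U₁≉0 (trans (*-cancel Y≉0 (begin
        Y * (U₁ * U₁) ≈⟨ solve 2 (λ y u → y :* (u :* u) := u :* (y :* u)) refl Y U₁ ⟩
        U₁ * (Y * U₁) ≈⟨ *-congˡ (slope x₁) ⟨
        U₁ * V′ (δ′ x₁ o) ≈⟨ trans (U′V′ (δ′ x₁ o)) N≈0 ⟩
        0# ≈⟨ zeroʳ Y ⟨
        Y * 0# ∎)) (sym (zeroʳ U₁))))
        where
        U₁ = U′ (δ′ x₁ o)
        x₁≢o : x₁ ≢ o
        x₁≢o ()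
        U₁≉0 : ¬ U₁ ≈ 0#
        U₁≉0 U₁≈0 = x₁≢o (pt-injective (U′V′-injective (pt x₁) (pt o)
          (x∙y⁻¹≈ε⇒x≈y (U′ (pt x₁)) (U′ (pt o)) (trans (U′-δ x₁ o) U₁≈0))
          (x∙y⁻¹≈ε⇒x≈y (V′ (pt x₁)) (V′ (pt o)) (trans (V′-δ x₁ o) (trans (slope x₁) (trans (*-congˡ U₁≈0) (zeroʳ Y)))))))
      parallel : ∀ x → proj₂ (δ′ x o) * proj₁ (δ′ x₁ o) ≈ proj₁ (δ′ x o) * proj₂ (δ′ x₁ o)
      parallel x = determinant (δ′ x o) (δ′ x₁ o) (begin
        V′ (δ′ x o) * U′ (δ′ x₁ o) ≈⟨ *-congʳ (slope x) ⟩
        Y * U′ (δ′ x o) * U′ (δ′ x₁ o) ≈⟨ solve 3 (λ y a b → y :* a :* b := a :* (y :* b)) refl Y (U′ (δ′ x o)) (U′ (δ′ x₁ o)) ⟩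
        U′ (δ′ x o) * (Y * U′ (δ′ x₁ o)) ≈⟨ *-congˡ (slope x₁) ⟨
        U′ (δ′ x o) * V′ (δ′ x₁ o) ∎)
        where
        -- The difference of the two sides of the assumption is 2ω (a d - b c), and 2 and ω are
        -- cancelled.
        determinant : ∀ z w → V′ z * U′ w ≈ U′ z * V′ w → proj₂ z * proj₁ w ≈ proj₁ z * proj₂ w
        determinant (a , b) (c , d) eq = *-cancel ω≉0 (halve (begin
          ω * (b * c) + ω * (b * c) ≈⟨ solve 5 (λ a b c d w → w :* (b :* c) :+ w :* (b :* c) := ((w :* (a :* d) :+ w :* (a :* d)) :+ (a :+ w :* b) :* (c :- w :* d)) :- (a :- w :* b) :* (c :+ w :* d)) refl a b c d ω ⟩
          ((ω * (a * d) + ω * (a * d)) + (a + ω * b) * (c - ω * d)) - (a - ω * b) * (c + ω * d) ≈⟨ +-congˡ (-‿cong eq) ⟩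
          ((ω * (a * d) + ω * (a * d)) + (a + ω * b) * (c - ω * d)) - (a + ω * b) * (c - ω * d) ≈⟨ solve 2 (λ x y → (x :+ y) :- y := x) refl _ _ ⟩
          ω * (a * d) + ω * (a * d) ∎))
    from-configuration (cross u₀ v₀ β β≢0 in-cross) = inj₂ (inj₂ (isomorphic T z₀ (isotropicSquares ω) resp
        (proj₁ isotropicSquares-injective) (proj₁ (proj₂ isotropicSquares-injective)) (proj₂ (proj₂ isotropicSquares-injective)) φ∈))
      where
      B = to β
      B≉0 : ¬ B ≈ 0#
      B≉0 B≈0 = β≢0 (≡.trans (≡.sym (strictlyInverseʳ β)) (from-cong B≈0))
      i = proj₁ (inverse B B≉0)
      Bi≈1 : B * i ≈ 1#
      Bi≈1 = proj₂ (inverse B B≉0)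
      -- The centre has isotropic coordinates `to u₀` and `to v₀`; its second component is (u₀ - v₀)
      -- / (2ω), with 1/ω = - ω. The factor κ = 2/B then carries the isotropic coordinates (0 , B
      -- s²) and (B s² , 0) to s² (1 , ω) and s² (1 , - ω).
      z₀ : 𝔽′
      z₀ = (to u₀ + to v₀) * h , - (ω * ((to u₀ - to v₀) * h))
      κ = (1# + 1#) * i
      κhB : κ * (h * B) ≈ 1#
      κhB = trans (solve 4 (λ t i h b → t :* i :* (h :* b) := (t :* h) :* (b :* i)) refl (1# + 1#) i h B) (trans (*-cong 2h Bi≈1) (*-identityˡ 1#))
      T : Similarity
      T = record { κ₁ = κ ; κ₂ = 0# ; e = 1# ; ρ = κ ; ρ⁻¹ = h * B ; e² = *-identityˡ 1#
                 ; norm-κ = solve 1 (λ k → k :* k :+ :0 :* :0 := k :* k) refl κ ; ρρ⁻¹ = κhB }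
      resp : ∀ {z w} → z ≈′ w → isotropicSquares ω z → isotropicSquares ω w
      resp z≈w (inj₁ (t , t∈□ , z≈)) = inj₁ (t , t∈□ , 𝔽′.trans (𝔽′.sym z≈w) z≈)
      resp z≈w (inj₂ (t , t∈□ , z≈)) = inj₂ (t , t∈□ , 𝔽′.trans (𝔽′.sym z≈w) z≈)
      first : ∀ z → proj₁ z - proj₁ z₀ ≈ h * ((U′ z - to u₀) + (V′ z - to v₀))
      first (a , b) = begin
        a - (to u₀ + to v₀) * h ≈⟨ +-congʳ (trans (*-congʳ 2h) (*-identityˡ a)) ⟨
        ((1# + 1#) * h) * a - (to u₀ + to v₀) * h ≈⟨ solve 6 (λ h a b w u v → ((:1 :+ :1) :* h) :* a :- (u :+ v) :* h := h :* (((a :+ w :* b) :- u) :+ ((a :- w :* b) :- v))) refl h a b ω (to u₀) (to v₀) ⟩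
        h * (((a + ω * b) - to u₀) + ((a - ω * b) - to v₀)) ∎
      second : ∀ z → proj₂ z - proj₂ z₀ ≈ - (ω * (h * ((U′ z - to u₀) - (V′ z - to v₀))))
      second (a , b) = begin
        b - - (ω * ((to u₀ - to v₀) * h)) ≈⟨ +-congʳ (trans (*-congʳ 2h) (*-identityˡ b)) ⟨
        ((1# + 1#) * h) * b - - (ω * ((to u₀ - to v₀) * h)) ≈⟨ solve 5 (λ h b w u v → ((:1 :+ :1) :* h) :* b :- :- (w :* ((u :- v) :* h)) := :- (:- ((:1 :+ :1) :* h :* b)) :+ w :* ((u :- v) :* h)) refl h b ω (to u₀) (to v₀) ⟩
        - - ((1# + 1#) * h * b) + ω * ((to u₀ - to v₀) * h) ≈⟨ +-congʳ (-‿cong (ωω ((1# + 1#) * h * b))) ⟨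
        - (ω * (ω * ((1# + 1#) * h * b))) + ω * ((to u₀ - to v₀) * h)
          ≈⟨ solve 6 (λ h a b w u v → :- (w :* (w :* ((:1 :+ :1) :* h :* b))) :+ w :* ((u :- v) :* h) := :- (w :* (h :* (((a :+ w :* b) :- u) :- ((a :- w :* b) :- v))))) refl h a b ω (to u₀) (to v₀) ⟩
        - (ω * (h * (((a + ω * b) - to u₀) - ((a - ω * b) - to v₀)))) ∎
      difference-0 : ∀ {X x₀} → from X ≡ x₀ → X - to x₀ ≈ 0#
      difference-0 eq = trans (+-congʳ (from≡⇒≈to eq)) (-‿inverseʳ _)
      difference : ∀ {X x₀ s} → from X ≡ x₀ G.+ β G.* (s G.* s) → X - to x₀ ≈ B * (to s * to s)
      difference {X} {x₀} {s} eq = begin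
        X - to x₀ ≈⟨ +-congʳ (from≡⇒≈to eq) ⟩
        to (x₀ ⊞ (β ⊠ (s ⊠ s))) - to x₀ ≈⟨ +-congʳ (trans (to-⊞ x₀ (β ⊠ (s ⊠ s))) (+-congˡ (trans (to-⊠ β (s ⊠ s)) (*-congˡ (to-⊠ s s))))) ⟩
        (to x₀ + B * (to s * to s)) - to x₀ ≈⟨ solve 2 (λ a b → (a :+ b) :- a := b) refl (to x₀) (B * (to s * to s)) ⟩
        B * (to s * to s) ∎
      φ₁ : ∀ z S → h * S ≈ proj₁ z - proj₁ z₀ → proj₁ (Similarity.Centred.φ T z₀ z) ≈ (κ * h) * S
      φ₁ z S eq = trans (solve 3 (λ k a b → k :* a :- :0 :* (:1 :* b) := k :* a) refl κ (proj₁ z - proj₁ z₀) (proj₂ z - proj₂ z₀)) (trans (*-congˡ (sym eq)) (sym (*-assoc κ h S)))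
      φ₂ : ∀ z S → - (ω * (h * S)) ≈ proj₂ z - proj₂ z₀ → proj₂ (Similarity.Centred.φ T z₀ z) ≈ - (ω * ((κ * h) * S))
      φ₂ z S eq = trans (solve 3 (λ k a b → :0 :* a :+ k :* (:1 :* b) := k :* b) refl κ (proj₁ z - proj₁ z₀) (proj₂ z - proj₂ z₀)) (trans (*-congˡ (sym eq))
                    (solve 4 (λ k w h s → k :* :- (w :* (h :* s)) := :- (w :* ((k :* h) :* s))) refl κ ω h S))
      κh : ∀ S → (κ * h) * (B * S) ≈ S
      κh S = trans (solve 4 (λ k h b s → (k :* h) :* (b :* s) := (k :* (h :* b)) :* s) refl κ h B S) (trans (*-congʳ κhB) (*-identityˡ S))
      on-first : ∀ x s → u x ≡ u₀ → v x ≡ v₀ G.+ β G.* (s G.* s) → isotropicSquares ω (Similarity.Centred.φ T z₀ (pt x))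
      on-first x s u≡ v≡ = inj₁ (S , (to s , refl)
          , trans (φ₁ (pt x) (B * S) (trans (*-congˡ (sym (trans (+-cong U≈0 V≈) (+-identityˡ (B * S))))) (sym (first (pt x)))))
              (trans (κh S) (solve 2 (λ s w → s := :1 :* s :- w :* :0) refl S ω))
          , trans (φ₂ (pt x) (- (B * S)) (trans (-‿cong (*-congˡ (*-congˡ (sym (trans (+-cong U≈0 (-‿cong V≈)) (+-identityˡ (- (B * S)))))))) (sym (second (pt x)))))
              (trans (solve 4 (λ w p b s → :- (w :* (p :* :- (b :* s))) := w :* (p :* (b :* s))) refl ω (κ * h) B S) (trans (*-congˡ (κh S)) (solve 2 (λ s w → w :* s := :1 :* :0 :+ w :* s) refl S ω))))
        where
        S : Carrier
        S = to s * to s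
        U≈0 : U′ (pt x) - to u₀ ≈ 0#
        U≈0 = difference-0 {U′ (pt x)} {u₀} u≡
        V≈ : V′ (pt x) - to v₀ ≈ B * S
        V≈ = difference {V′ (pt x)} {v₀} {s} v≡
      on-second : ∀ x s → v x ≡ v₀ → u x ≡ u₀ G.+ β G.* (s G.* s) → isotropicSquares ω (Similarity.Centred.φ T z₀ (pt x))
      on-second x s v≡ u≡ = inj₂ (S , (to s , refl)
          , trans (φ₁ (pt x) (B * S) (trans (*-congˡ (sym (trans (+-cong U≈ V≈0) (+-identityʳ (B * S))))) (sym (first (pt x)))))
              (trans (κh S) (solve 2 (λ s w → s := :1 :* s :- (:- w) :* :0) refl S ω))
          , trans (φ₂ (pt x) (B * S) (trans (-‿cong (*-congˡ (*-congˡ (sym (trans (+-cong U≈ (-‿cong V≈0)) (solve 1 (λ s → s :- :0 := s) refl (B * S))))))) (sym (second (pt x)))))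
              (trans (-‿cong (*-congˡ (κh S))) (solve 2 (λ s w → :- (w :* s) := :1 :* :0 :+ (:- w) :* s) refl S ω)))
        where
        S : Carrier
        S = to s * to s
        V≈0 : V′ (pt x) - to v₀ ≈ 0#
        V≈0 = difference-0 {V′ (pt x)} {v₀} v≡
        U≈ : U′ (pt x) - to u₀ ≈ B * S
        U≈ = difference {U′ (pt x)} {u₀} {s} u≡
      φ∈ : ∀ x → isotropicSquares ω (Similarity.Centred.φ T z₀ (pt x))
      φ∈ x = [ (λ (u≡ , s , v≡) → on-first x s u≡ v≡) , (λ (v≡ , s , u≡) → on-second x s v≡ u≡) ]′ (in-cross x)

-- Residues of q modulo 4 and conclusion

odd-prime-mod-4 : ∀ q → Prime q → q ≢ 2 → ∃[ m ] (q ≡ 1 ℕ.+ m ℕ.* 4 ⊎ q ≡ 3 ℕ.+ m ℕ.* 4)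
odd-prime-mod-4 q q-prime q≢2 = q ℕ./ 4 , cases (q ℕ.% 4) (m%n<n q 4) (m≡m%n+[m/n]*n q 4)
  where
  2∤q : ∀ m → q ≢ m ℕ.* 2
  2∤q m q≡ with prime⇒irreducible q-prime (divides m q≡)
  ... | inj₂ 2≡q = q≢2 (≡.sym 2≡q)
  cases : ∀ r → r ℕ.< 4 → q ≡ r ℕ.+ q ℕ./ 4 ℕ.* 4 → q ≡ 1 ℕ.+ q ℕ./ 4 ℕ.* 4 ⊎ q ≡ 3 ℕ.+ q ℕ./ 4 ℕ.* 4
  cases 0 _ eq = contradiction (≡.trans eq (≡.sym (ℕₚ.*-assoc (q ℕ./ 4) 2 2))) (2∤q (q ℕ./ 4 ℕ.* 2))
  cases 1 _ eq = inj₁ eq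
  cases 2 _ eq = contradiction (≡.trans eq (cong (λ s → 2 ℕ.+ s) (≡.sym (ℕₚ.*-assoc (q ℕ./ 4) 2 2)))) (2∤q (suc (q ℕ./ 4 ℕ.* 2)))
  cases 3 _ eq = inj₂ eq
  cases (suc (suc (suc (suc _)))) (s≤s (s≤s (s≤s (s≤s ())))) _

*4 : ∀ m → m ℕ.* 4 ≡ (m ℕ.+ m) ℕ.+ (m ℕ.+ m)
*4 m = begin
  m ℕ.* 4 ≡⟨ ℕₚ.*-distribˡ-+ m 2 2 ⟩
  m ℕ.* 2 ℕ.+ m ℕ.* 2 ≡⟨ cong₂ ℕ._+_ (*2 m) (*2 m) ⟩
  (m ℕ.+ m) ℕ.+ (m ℕ.+ m) ∎
  where
  open ≡-Reasoning
  *2 : ∀ m → m ℕ.* 2 ≡ m ℕ.+ m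
  *2 m = ≡.trans (ℕₚ.*-comm m 2) (cong (m ℕ.+_) (ℕₚ.+-identityʳ m))

3+4m : ∀ m → 3 ℕ.+ m ℕ.* 4 ≡ suc (suc (m ℕ.+ m) ℕ.+ suc (m ℕ.+ m))
3+4m m = cong (λ s → suc (suc s)) (≡.trans (cong suc (*4 m)) (≡.sym (ℕₚ.+-suc (m ℕ.+ m) (m ℕ.+ m))))

-- The modules for the cases fix q in successor form. `by-cases` is general in q, so that the
-- equation can be matched with `refl` before F and P, whose types depend on q, are introduced.
case-3 : ∀ {c ℓ m} {q} j → q ≡ 3 ℕ.+ j ℕ.* 4 → (F : FiniteField c ℓ q) → let open IntegralPointSets F in (P : Pred 𝔽′ m) →
         IsIntegral P → HasCardinality P q → Isomorphic P realLine
case-3 {c} {ℓ} {m} j q≡ F P = by-cases (≡.trans q≡ (3+4m j)) F P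
  where
  by-cases : ∀ {q} → q ≡ suc (suc (j ℕ.+ j) ℕ.+ suc (j ℕ.+ j)) → (F : FiniteField c ℓ q) → let open IntegralPointSets F in (P : Pred 𝔽′ m) →
             IsIntegral P → HasCardinality P q → Isomorphic P realLine
  by-cases ≡.refl F P integral cardinality = CongruentToThree.isomorphic-realLine j F P integral cardinality

-- The values q = 1 and q = 5 contradict 9 < q; after them k′ ≥ 2, so k = 2k′ ≥ 4 supplies the bound
-- `3≤k`.
case-1 : ∀ {c ℓ m} {q} j → q ≡ 1 ℕ.+ j ℕ.* 4 → 9 ℕ.< q → Prime q → (F : FiniteField c ℓ q) → let open FiniteField F ; open IntegralPointSets F in
         (ω : Carrier) → ω * ω ≈ - 1# → (P : Pred 𝔽′ m) → IsIntegral P → HasCardinality P q →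
         Isomorphic P realLine ⊎ Isomorphic P (isotropicLine ω) ⊎ Isomorphic P (isotropicSquares ω)
case-1 0 ≡.refl (s≤s ())
case-1 1 ≡.refl (s≤s (s≤s (s≤s (s≤s (s≤s ())))))
case-1 {c} {ℓ} {m} (suc (suc j)) q≡ _ q-prime F ω ω² P = by-cases (≡.trans q≡ (cong suc (*4 (suc (suc j))))) q-prime F ω ω² P
  where
  k′ = suc (suc j)
  3≤k : 3 ℕ.≤ k′ ℕ.+ k′
  3≤k = ℕₚ.≤-trans (s≤s (s≤s (s≤s z≤n))) (ℕₚ.+-mono-≤ {2} {k′} {2} {k′} (s≤s (s≤s z≤n)) (s≤s (s≤s z≤n)))
  by-cases : ∀ {q} → q ≡ suc ((k′ ℕ.+ k′) ℕ.+ (k′ ℕ.+ k′)) → Prime q → (F : FiniteField c ℓ q) → let open FiniteField F ; open IntegralPointSets F in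
             (ω : Carrier) → ω * ω ≈ - 1# → (P : Pred 𝔽′ m) → IsIntegral P → HasCardinality P q →
             Isomorphic P realLine ⊎ Isomorphic P (isotropicLine ω) ⊎ Isomorphic P (isotropicSquares ω)
  by-cases ≡.refl q-prime F ω ω² P integral cardinality = CongruentToOne.result (suc j) F P integral cardinality q-prime 3≤k ω ω²

open import Data.Nat.Base using (_^_; _<_; _%_)

theorem6 : ∀ {c ℓ m : Level} (p r q : ℕ) → Prime p → p ≢ 2 → q ≡ p ^ r → 9 < q →
    (r ≡ 1 ⊎ q % 4 ≡ 3) →
    (F : FiniteField c ℓ q) →
    let open FiniteField F
        open IntegralPointSets F
    in
    (ω : Carrier) → (q % 4 ≡ 1 → ω * ω ≈ - 1#) →
    (P : Pred 𝔽′ m) → IsIntegral P → HasCardinality P q →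
    Isomorphic P realLine
    ⊎ (q % 4 ≡ 1 × Isomorphic P (isotropicLine ω))
    ⊎ (q % 4 ≡ 1 × Isomorphic P (isotropicSquares ω))
-- Only in this clause may q be a proper prime power: the argument rests on -1 being a nonsquare,
-- which follows from q mod 4 alone.
theorem6 p r q p-prime p≢2 q≡p^r 9<q (inj₂ q%4≡3) F ω ω² P integral cardinality =
  inj₁ (case-3 (q ℕ./ 4) (≡.trans (m≡m%n+[m/n]*n q 4) (cong (λ r → r ℕ.+ q ℕ./ 4 ℕ.* 4) q%4≡3)) F P integral cardinality)
theorem6 p r q p-prime p≢2 q≡p^r 9<q (inj₁ r≡1) F ω ω² P integral cardinality = by-residue (odd-prime-mod-4 q q-prime (λ q≡2 → p≢2 (≡.trans (≡.sym q≡p) q≡2)))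
  where
  open IntegralPointSets F
  q≡p : q ≡ p
  q≡p = ≡.trans q≡p^r (≡.trans (cong (p ^_) r≡1) (ℕₚ.^-identityʳ p))
  q-prime : Prime q
  q-prime = subst Prime (≡.sym q≡p) p-prime
  by-residue : ∃[ j ] (q ≡ 1 ℕ.+ j ℕ.* 4 ⊎ q ≡ 3 ℕ.+ j ℕ.* 4) →
               Isomorphic P realLine ⊎ (q % 4 ≡ 1 × Isomorphic P (isotropicLine ω)) ⊎ (q % 4 ≡ 1 × Isomorphic P (isotropicSquares ω))
  by-residue (j , inj₂ q≡) = inj₁ (case-3 j q≡ F P integral cardinality)
  by-residue (j , inj₁ q≡) = Sum.map₂ (Sum.map (λ iso → q%4≡1 , iso) (λ iso → q%4≡1 , iso)) (case-1 j q≡ 9<q q-prime F ω (ω² q%4≡1) P integral cardinality)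
    where
    q%4≡1 : q % 4 ≡ 1
    q%4≡1 = ≡.trans (cong (_% 4) q≡) ([m+kn]%n≡m%n 1 j 4)
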